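{- Let $c$ and $k\ge1$ be constants and let $G$ be the intersection graph of a $k$-similarly-sized $c$-fat family $\mathcal{O}$ of $n$ objects in $\mathbb{R}^2$. One can compute, in $O(n\log n)$ time, a tree decomposition $\mathcal{T}=(T,\{X_t\}_{t\in V(T)})$ and a layering $(V_1,V_2,\ldots)$ of $G$ such that $|V(T)|=O(n)$ and $\alpha(G[X_t\cap V_i])\le\lceil2\sqrt2k\rceil c$ for every bag $X_t$ and layer $V_i$. In particular, $G$ has layered tree-independence number at most $\lceil2\sqrt2k\rceil c$.
   Context: An object in $\mathbb{R}^2$ is a path-connected compact set; its size is the side length of its smallest enclosing axis-aligned square. A collection $\mathcal{O}$ is $c$-fat if for every $r\in\mathbb{R}$ and every closed axis-aligned box $R$ of side length $r$ there are at most $c$ pairwise non-intersecting objects of $\mathcal{O}$ of size at least $r$ intersecting $R$. It is $k$-similarly-sized if the ratio of the largest to the smallest diameter of its objects is at most $k$. The intersection graph has a vertex per object, two adjacent iff they intersect; the collection is given as input and basic operations on objects take constant time. $\alpha$ denotes independence number. A tree decomposition of $G$ is a pair $(T,\{X_t\})$ with $T$ a tree and bags $X_t\subseteq V(G)$ such that every vertex lies in some bag, every edge has both ends in some bag, and for each vertex the nodes whose bags contain it induce a connected subtree. A layering of $G$ is a partition $(V_1,V_2,\ldots)$ of $V(G)$ such that every edge joins vertices in the same or consecutive layers. The layered tree-independence number of $G$ is the minimum over tree decompositions and layerings of $\max_{t,i}\alpha(G[X_t\cap V_i])$. -}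

module Defs where

open import Level using (0ℓ)
open import Algebra.Bundles using (CommutativeRing)
import Algebra.Definitions.RawMonoid as RawMonoidMult
open import Data.Fin using (Fin; toℕ)
open import Data.Fin.Subset using (Subset; _∈_; _⊆_; _∩_; ⋃; ⁅_⁆; ∣_∣) renaming (⊥ to ∅)
open import Data.List using (List; []; _∷_; _∷ʳ_; length; lookup; map; allFin)
import Data.List.Membership.Propositional as ListMembership
open import Data.List.Relation.Unary.Any using (Any; here; there)
open import Data.List.Relation.Unary.Linked using (Linked)
open import Data.List.Relation.Unary.Unique.Propositional using (Unique)
open import Data.Nat using (ℕ; zero; suc)
import Data.Nat as ℕ
open import Data.Product using (Σ; ∃; ∃-syntax; _×_; _,_; proj₁; proj₂)
open import Data.Sum using (_⊎_; inj₁; inj₂)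
open import Data.Unit using (⊤; tt)
open import Relation.Binary using (Rel; IsDecTotalOrder)
import Relation.Binary.Construct.NonStrictToStrict as ToStrict
open import Relation.Binary.Construct.Closure.ReflexiveTransitive using (Star)
open import Relation.Binary.PropositionalEquality using (_≡_; _≢_; ≢-sym)
open import Relation.Nullary using (¬_; Dec; yes; no)
open import Relation.Unary using (Pred)

IsLeast IsGreatest : ∀ {a p ℓ} {A : Set a} → Rel A ℓ → Pred A p → A → Set _
IsLeast    _≤_ P x = P x × (∀ y → P y → x ≤ y)
IsGreatest _≤_ P x = P x × (∀ y → P y → y ≤ x)

record Graph (n : ℕ) : Set₁ where
  field
    Adj     : Rel (Fin n) 0ℓ
    sym-Adj : ∀ {u v} → Adj u v → Adj v u
    irrefl  : ∀ {u} → ¬ Adj u u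

open Graph public using (Adj)

ConnectedOn : ∀ {n} → Graph n → Pred (Fin n) 0ℓ → Set
ConnectedOn G P =
  ∀ {u v} → P u → P v → Star (λ a b → P a × P b × Adj G a b) u v

-- The cycle x, y₁, …, yₗ, x with l ≥ 2.
IsCycle : ∀ {n} → Graph n → Fin n → List (Fin n) → Set
IsCycle G x ys =
  2 ℕ.≤ length ys × Unique (x ∷ ys) × Linked (Adj G) (x ∷ (ys ∷ʳ x))

record IsTree {n} (T : Graph n) : Set where
  field
    nonempty  : Fin n
    connected : ConnectedOn T (λ _ → ⊤)
    acyclic   : ∀ x ys → ¬ IsCycle T x ys

record IsTreeDecomposition {n m} (G : Graph n) (T : Graph m)
                           (X : Fin m → Subset n) : Set where
  field
    tree     : IsTree T
    vertices : ∀ v → ∃[ t ] v ∈ X t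
    edges    : ∀ {u v} → Adj G u v → ∃[ t ] (u ∈ X t × v ∈ X t)
    subtrees : ∀ v → ConnectedOn T (λ t → v ∈ X t)

-- Layers may be empty, so that finite partitions are sequences that are
-- eventually empty.
record IsLayering {n} (G : Graph n) (V : ℕ → Subset n) : Set where
  field
    covers   : ∀ v → ∃[ i ] v ∈ V i
    disjoint : ∀ {v i j} → v ∈ V i → v ∈ V j → i ≡ j
    edges    : ∀ {u v i j} → Adj G u v → u ∈ V i → v ∈ V j → ℕ.∣ i - j ∣ ℕ.≤ 1

IsIndependentIn : ∀ {n} → Graph n → Subset n → Subset n → Set
IsIndependentIn G S I = I ⊆ S × (∀ {u v} → u ∈ I → v ∈ I → ¬ Adj G u v)

-- a = α(G[S])
IsIndependenceNumber : ∀ {n} → Graph n → Subset n → ℕ → Set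
IsIndependenceNumber G S =
  IsGreatest ℕ._≤_ (λ a → ∃[ I ] (IsIndependentIn G S I × ∣ I ∣ ≡ a))

-- w = max over t and i of α(G[X_t ∩ V_i])
IsLayeredWidth : ∀ {n m} → Graph n → (Fin m → Subset n) → (ℕ → Subset n) → ℕ → Set
IsLayeredWidth G X V =
  IsGreatest ℕ._≤_ (λ a → ∃[ t ] ∃[ i ] IsIndependenceNumber G (X t ∩ V i) a)

IsLayeredTreeIndependenceNumber : ∀ {n} → Graph n → ℕ → Set₁
IsLayeredTreeIndependenceNumber {n} G =
  IsLeast ℕ._≤_ λ w →
    Σ ℕ λ m → Σ (Graph m) λ T → Σ (Fin m → Subset n) λ X → Σ (ℕ → Subset n) λ V →
      IsTreeDecomposition G T X × IsLayering G V × IsLayeredWidth G X V w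

-- The real numbers, axiomatised as a Dedekind-complete ordered field over
-- a setoid equality, so that the classical reals given by Cauchy sequences
-- are a model.  The value of 0# ⁻¹ is unspecified.

record RealNumbers : Set₁ where
  field
    commutativeRing : CommutativeRing 0ℓ 0ℓ

  open CommutativeRing commutativeRing public

  infix 4 _≤_ _<_
  infix 8 _⁻¹

  field
    _≤_             : Rel Carrier 0ℓ
    isDecTotalOrder : IsDecTotalOrder _≈_ _≤_
    +-monoˡ-≤       : ∀ {x y} z → x ≤ y → x + z ≤ y + z
    *-nonneg        : ∀ {x y} → 0# ≤ x → 0# ≤ y → 0# ≤ x * y
    0≉1             : ¬ 0# ≈ 1#
    _⁻¹             : Carrier → Carrier
    *-inverseʳ      : ∀ {x} → ¬ x ≈ 0# → x * x ⁻¹ ≈ 1#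

  UpperBound : Pred Carrier 0ℓ → Pred Carrier 0ℓ
  UpperBound P b = ∀ x → P x → x ≤ b

  IsSupremum : Pred Carrier 0ℓ → Carrier → Set
  IsSupremum P = IsLeast _≤_ (UpperBound P)

  field
    complete : (P : Pred Carrier 0ℓ) → ∃ P → ∃ (UpperBound P) → ∃ (IsSupremum P)

  open IsDecTotalOrder isDecTotalOrder public using (_≤?_)

  _<_ : Rel Carrier 0ℓ
  _<_ = ToStrict._<_ _≈_ _≤_

  fromℕ : ℕ → Carrier
  fromℕ n = RawMonoidMult._×_ +-rawMonoid n 1#

  IsSqrt : Carrier → Carrier → Set
  IsSqrt x s = 0# ≤ s × s * s ≈ x

  -- For x > -1 the least natural number above x is ⌈x⌉.
  IsCeiling : Carrier → ℕ → Set
  IsCeiling x = IsLeast ℕ._≤_ (λ m → x ≤ fromℕ m)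

module Plane (R : RealNumbers) where

  open RealNumbers R

  ℝ : Set
  ℝ = Carrier

  Point : Set
  Point = ℝ × ℝ

  infix 4 _≈ᵖ_
  _≈ᵖ_ : Rel Point 0ℓ
  (x , y) ≈ᵖ (x′ , y′) = x ≈ x′ × y ≈ y′

  IsDistance : Point → Point → ℝ → Set
  IsDistance (x , y) (x′ , y′) =
    IsSqrt ((x - x′) * (x - x′) + (y - y′) * (y - y′))

  Near : ℝ → Rel Point 0ℓ
  Near ε p q = ∃[ d ] (IsDistance p q d × d < ε)

  IsOpen : Pred Point 0ℓ → Set
  IsOpen U = ∀ p → U p → ∃[ ε ] (0# < ε × (∀ q → Near ε p q → U q))

  IsCompact : Pred Point 0ℓ → Set₁
  IsCompact S = {I : Set} (U : I → Pred Point 0ℓ) → (∀ i → IsOpen (U i)) →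
    (∀ p → S p → ∃[ i ] U i p) →
    Σ (List I) λ is → ∀ p → S p → Any (λ i → U i p) is

  InUnitInterval : Pred ℝ 0ℓ
  InUnitInterval t = 0# ≤ t × t ≤ 1#

  -- Only the values of γ on [0,1] matter.
  IsPath : (ℝ → Point) → Set
  IsPath γ = ∀ t → InUnitInterval t → ∀ ε → 0# < ε →
    ∃[ δ ] (0# < δ ×
      (∀ u → InUnitInterval u → u < t + δ → t < u + δ → Near ε (γ t) (γ u)))

  IsPathConnected : Pred Point 0ℓ → Set
  IsPathConnected S = ∀ p q → S p → S q →
    ∃[ γ ] (IsPath γ × γ 0# ≈ᵖ p × γ 1# ≈ᵖ q × (∀ t → InUnitInterval t → S (γ t)))

  record Object : Set₁ where
    field
      Contains      : Pred Point 0ℓ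
      resp          : ∀ {p q} → p ≈ᵖ q → Contains p → Contains q
      nonempty      : ∃ Contains
      compact       : IsCompact Contains
      pathConnected : IsPathConnected Contains

  open Object public using (Contains)

  -- The closed square [a , a + r] × [b , b + r].
  Box : ℝ → ℝ → ℝ → Pred Point 0ℓ
  Box a b r (x , y) = (a ≤ x × x ≤ a + r) × (b ≤ y × y ≤ b + r)

  Meets : Rel (Pred Point 0ℓ) 0ℓ
  Meets S S′ = ∃[ p ] (S p × S′ p)

  IsSize : Object → ℝ → Set
  IsSize o = IsLeast _≤_ λ s →
    0# ≤ s × ∃[ a ] ∃[ b ] (∀ p → Contains o p → Box a b s p)

  IsDiameter : Object → ℝ → Set
  IsDiameter o = IsSupremum λ d →
    ∃[ p ] ∃[ q ] (Contains o p × Contains o q × IsDistance p q d)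

  Family : ℕ → Set₁
  Family n = Fin n → Object

  IsFat : ∀ {n} → ℝ → Family n → Set
  IsFat {n} c O = ∀ r a b → 0# ≤ r → (I : Subset n) →
    (∀ {i j} → i ∈ I → j ∈ I → i ≢ j → ¬ Meets (Contains (O i)) (Contains (O j))) →
    (∀ {i} → i ∈ I → ∃[ s ] (IsSize (O i) s × r ≤ s)) →
    (∀ {i} → i ∈ I → Meets (Contains (O i)) (Box a b r)) →
    fromℕ ∣ I ∣ ≤ c

  -- Multiplied out, so that families of single points are included.
  IsSimilarlySized : ∀ {n} → ℝ → Family n → Set
  IsSimilarlySized k O =
    ∀ i j d e → IsDiameter (O i) d → IsDiameter (O j) e → d ≤ k * e

  intersectionGraph : ∀ {n} → Family n → Graph n
  intersectionGraph O = record
    { Adj     = λ i j → i ≢ j × Meets (Contains (O i)) (Contains (O j))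
    ; sym-Adj = λ (i≢j , p , pᵢ , pⱼ) → ≢-sym i≢j , p , pⱼ , pᵢ
    ; irrefl  = λ (i≢i , _) → i≢i _≡_.refl
    }

  -- The constant-time operations on objects: the extents of the bounding
  -- box, the size, the diameter, and the intersection test.
  record BasicOperations {n} (O : Family n) : Set where
    field
      xmin xmax ymin ymax size diameter : Fin n → ℝ
      xmin-spec : ∀ i → IsLeast    _≤_ (λ x → ∃[ y ] Contains (O i) (x , y)) (xmin i)
      xmax-spec : ∀ i → IsGreatest _≤_ (λ x → ∃[ y ] Contains (O i) (x , y)) (xmax i)
      ymin-spec : ∀ i → IsLeast    _≤_ (λ y → ∃[ x ] Contains (O i) (x , y)) (ymin i)
      ymax-spec : ∀ i → IsGreatest _≤_ (λ y → ∃[ x ] Contains (O i) (x , y)) (ymax i)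
      size-spec     : ∀ i → IsSize (O i) (size i)
      diameter-spec : ∀ i → IsDiameter (O i) (diameter i)
      intersect?    : ∀ i j → Dec (Meets (Contains (O i)) (Contains (O j)))

-- The model of computation: a total, purely functional, call-by-value
-- language with exact real arithmetic at unit cost (no rounding
-- operation), in which objects are opaque handles inspected only through
-- the basic operations.  Every evaluation step costs one unit.  As data are
-- immutable and passed by reference, a fixed program runs on a real RAM in
-- time proportional to its cost.

infixr 5 _⇒_
infixr 6 _⊕_
infixr 7 _⊗_

data Ty : Set where
  unit nat real obj : Ty
  _⇒_ _⊕_ _⊗_       : Ty → Ty → Ty
  list              : Ty → Ty

bool : Ty
bool = unit ⊕ unit

Ctx : Set
Ctx = List Ty

data ObjectMeasure : Set where
  xmin xmax ymin ymax size diameter : ObjectMeasure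

open ListMembership using () renaming (_∈_ to _∈ˡ_)

data Tm (Γ : Ctx) : Ty → Set where
  var   : ∀ {τ} → τ ∈ˡ Γ → Tm Γ τ
  lam   : ∀ {σ τ} → Tm (σ ∷ Γ) τ → Tm Γ (σ ⇒ τ)
  app   : ∀ {σ τ} → Tm Γ (σ ⇒ τ) → Tm Γ σ → Tm Γ τ
  star  : Tm Γ unit
  pair  : ∀ {σ τ} → Tm Γ σ → Tm Γ τ → Tm Γ (σ ⊗ τ)
  fst   : ∀ {σ τ} → Tm Γ (σ ⊗ τ) → Tm Γ σ
  snd   : ∀ {σ τ} → Tm Γ (σ ⊗ τ) → Tm Γ τ
  inl   : ∀ {σ τ} → Tm Γ σ → Tm Γ (σ ⊕ τ)
  inr   : ∀ {σ τ} → Tm Γ τ → Tm Γ (σ ⊕ τ)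
  case  : ∀ {σ τ υ} → Tm Γ (σ ⊕ τ) → Tm (σ ∷ Γ) υ → Tm (τ ∷ Γ) υ → Tm Γ υ
  ze    : Tm Γ nat
  su    : Tm Γ nat → Tm Γ nat
  ncase : ∀ {τ} → Tm Γ nat → Tm Γ τ → Tm (nat ∷ Γ) τ → Tm Γ τ
  nfold : ∀ {τ} → Tm Γ nat → Tm Γ τ → Tm (τ ∷ Γ) τ → Tm Γ τ
  nil   : ∀ {σ} → Tm Γ (list σ)
  cons  : ∀ {σ} → Tm Γ σ → Tm Γ (list σ) → Tm Γ (list σ)
  lcase : ∀ {σ τ} → Tm Γ (list σ) → Tm Γ τ → Tm (σ ∷ list σ ∷ Γ) τ → Tm Γ τ
  lfold : ∀ {σ τ} → Tm Γ (list σ) → Tm Γ τ → Tm (σ ∷ τ ∷ Γ) τ → Tm Γ τ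
  rzero rone    : Tm Γ real
  rneg rinv     : Tm Γ real → Tm Γ real
  radd rmul     : Tm Γ real → Tm Γ real → Tm Γ real
  rleq          : Tm Γ real → Tm Γ real → Tm Γ bool
  measure       : ObjectMeasure → Tm Γ obj → Tm Γ real
  intersecting  : Tm Γ obj → Tm Γ obj → Tm Γ bool

Costed : Set → Set
Costed A = A × ℕ

infixl 1 _>>=_
_>>=_ : {A B : Set} → Costed A → (A → Costed B) → Costed B
(a , m) >>= f = proj₁ (f a) , m ℕ.+ proj₂ (f a)

return : {A : Set} → A → Costed A
return a = a , 0

step : {A : Set} → Costed A → Costed A
step (a , m) = a , suc m

foldNat : {A : Set} → Costed A → (A → Costed A) → ℕ → Costed A
foldNat z s zero    = z
foldNat z s (suc n) = foldNat z s n >>= λ a → step (s a)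

foldList : {A B : Set} → Costed B → (A → B → Costed B) → List A → Costed B
foldList z s []       = z
foldList z s (x ∷ xs) = foldList z s xs >>= λ b → step (s x b)

module Semantics (R : RealNumbers) {n : ℕ} {O : Plane.Family R n}
                 (B : Plane.BasicOperations R O) where

  open RealNumbers R using (Carrier; _+_; _*_; -_; _⁻¹; 0#; 1#; _≤?_)
  module B = Plane.BasicOperations B

  Val : Ty → Set
  Val unit     = ⊤
  Val nat      = ℕ
  Val real     = Carrier
  Val obj      = Fin n
  Val (σ ⇒ τ)  = Val σ → Costed (Val τ)
  Val (σ ⊕ τ)  = Val σ ⊎ Val τ
  Val (σ ⊗ τ)  = Val σ × Val τ
  Val (list σ) = List (Val σ)

  Env : Ctx → Set
  Env []      = ⊤
  Env (τ ∷ Γ) = Val τ × Env Γ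

  get : ∀ {τ Γ} → τ ∈ˡ Γ → Env Γ → Val τ
  get (here _≡_.refl) (v , _) = v
  get (there x)       (_ , ρ) = get x ρ

  fromDec : {P : Set} → Dec P → Val bool
  fromDec (yes _) = inj₁ tt
  fromDec (no _)  = inj₂ tt

  measured : ObjectMeasure → Fin n → Carrier
  measured xmin     = B.xmin
  measured xmax     = B.xmax
  measured ymin     = B.ymin
  measured ymax     = B.ymax
  measured size     = B.size
  measured diameter = B.diameter

  branch : {A C D : Set} → (A → D) → (C → D) → A ⊎ C → D
  branch f g (inj₁ a) = f a
  branch f g (inj₂ c) = g c

  branchNat : {D : Set} → D → (ℕ → D) → ℕ → D
  branchNat z s zero    = z
  branchNat z s (suc m) = s m

  branchList : {A D : Set} → D → (A → List A → D) → List A → D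
  branchList e c []       = e
  branchList e c (x ∷ xs) = c x xs

  eval : ∀ {Γ τ} → Tm Γ τ → Env Γ → Costed (Val τ)
  eval (var x)        ρ = step (return (get x ρ))
  eval (lam b)        ρ = step (return (λ v → eval b (v , ρ)))
  eval (app f a)      ρ = step (eval f ρ >>= λ g → eval a ρ >>= g)
  eval star           ρ = step (return tt)
  eval (pair a b)     ρ = step (eval a ρ >>= λ x → eval b ρ >>= λ y → return (x , y))
  eval (fst p)        ρ = step (eval p ρ >>= λ x → return (proj₁ x))
  eval (snd p)        ρ = step (eval p ρ >>= λ x → return (proj₂ x))
  eval (inl a)        ρ = step (eval a ρ >>= λ x → return (inj₁ x))
  eval (inr b)        ρ = step (eval b ρ >>= λ x → return (inj₂ x))
  eval (case s l r)   ρ = step (eval s ρ >>=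
    branch (λ x → eval l (x , ρ)) (λ y → eval r (y , ρ)))
  eval ze             ρ = step (return 0)
  eval (su m)         ρ = step (eval m ρ >>= λ x → return (suc x))
  eval (ncase m z s)  ρ = step (eval m ρ >>=
    branchNat (eval z ρ) (λ x → eval s (x , ρ)))
  eval (nfold m z s)  ρ = step (eval m ρ >>=
    foldNat (eval z ρ) (λ x → eval s (x , ρ)))
  eval nil            ρ = step (return [])
  eval (cons a l)     ρ = step (eval a ρ >>= λ x → eval l ρ >>= λ xs → return (x ∷ xs))
  eval (lcase l e c)  ρ = step (eval l ρ >>=
    branchList (eval e ρ) (λ x xs → eval c (x , xs , ρ)))
  eval (lfold l e c)  ρ = step (eval l ρ >>=
    foldList (eval e ρ) (λ x y → eval c (x , y , ρ)))
  eval rzero          ρ = step (return 0#)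
  eval rone           ρ = step (return 1#)
  eval (rneg a)       ρ = step (eval a ρ >>= λ x → return (- x))
  eval (rinv a)       ρ = step (eval a ρ >>= λ x → return (x ⁻¹))
  eval (radd a b)     ρ = step (eval a ρ >>= λ x → eval b ρ >>= λ y → return (x + y))
  eval (rmul a b)     ρ = step (eval a ρ >>= λ x → eval b ρ >>= λ y → return (x * y))
  eval (rleq a b)     ρ = step (eval a ρ >>= λ x → eval b ρ >>= λ y →
    return (fromDec (x ≤? y)))
  eval (measure μ a)  ρ = step (eval a ρ >>= λ i → return (measured μ i))
  eval (intersecting a b) ρ = step (eval a ρ >>= λ i → eval b ρ >>= λ j →
    return (fromDec (B.intersect? i j)))

-- The edges of T (as pairs of positions in the list of bags), the bags, and
-- the layers; each bag or layer is the list of its vertices.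

OutputTy : Ty
OutputTy = list (nat ⊗ nat) ⊗ list (list obj) ⊗ list (list obj)

Program : Set
Program = Tm (list obj ∷ []) OutputTy

record Output (n : ℕ) : Set where
  constructor output
  field
    treeEdges : List (ℕ × ℕ)
    bagList   : List (List (Fin n))
    layerList : List (List (Fin n))

  nodeCount : ℕ
  nodeCount = length bagList

  tree : Graph nodeCount
  tree = record
    { Adj     = λ s t → s ≢ t ×
        ((toℕ s , toℕ t) ∈ˡ treeEdges ⊎ (toℕ t , toℕ s) ∈ˡ treeEdges)
    ; sym-Adj = λ { (s≢t , inj₁ e) → ≢-sym s≢t , inj₂ e
                  ; (s≢t , inj₂ e) → ≢-sym s≢t , inj₁ e }
    ; irrefl  = λ (s≢s , _) → s≢s _≡_.refl
    }

  bag : Fin nodeCount → Subset n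
  bag t = ⋃ (map ⁅_⁆ (lookup bagList t))

  layer : ℕ → Subset n
  layer = nth layerList
    where
    nth : List (List (Fin n)) → ℕ → Subset n
    nth []       _       = ∅
    nth (l ∷ _)  zero    = ⋃ (map ⁅_⁆ l)
    nth (_ ∷ ls) (suc i) = nth ls i

module Run (R : RealNumbers) (P : Program) {n : ℕ} {O : Plane.Family R n}
           (B : Plane.BasicOperations R O) where

  evaluated : Costed (Semantics.Val R B OutputTy)
  evaluated = Semantics.eval R B P (allFin n , tt)

  result : Output n
  result = output (proj₁ (proj₁ evaluated))
                  (proj₁ (proj₂ (proj₁ evaluated)))
                  (proj₂ (proj₂ (proj₁ evaluated)))

  time : ℕ
  time = proj₂ evaluated

{-# OPTIONS --safe #-}

-- Let D be the largest diameter and r = 2D/M.  Every size is at least r, as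
-- D ≤ k√2 s for each size s and 2√2k ≤ M.  Sweeping the x-axis, open a new
-- vertical strip of width r at each left end not covered by the previous
-- strip; the bags are the sets of objects meeting the strips.  Sweeping the
-- y-axis likewise with width D on lower ends yields the layers.  An object in
-- a bag and a layer meets a box of width r and height 2D = Mr (by the
-- intermediate value theorem), which M boxes of side r cover, so fatness
-- bounds an independent set by Mc.  Since an object meets at most about M/2
-- strips, the bags have linear total size, and sorting dominates the running
-- time.

module Submission where

open import Defs
open import Level using (0ℓ; lift; lower) renaming (suc to lsuc)
open import Algebra.Bundles using (RawRing)
import Algebra.Properties.AbelianGroup as AbelianGroupProperties
import Algebra.Properties.Ring as RingProperties
import Algebra.Properties.Semiring.Mult as UnoptimisedMultiples
import Algebra.Properties.Semiring.Mult.TCOptimised as Multiples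
import Algebra.Solver.Ring
open import Algebra.Solver.Ring.AlmostCommutativeRing using (fromCommutativeRing; _-Raw-AlmostCommutative⟶_)
open import Axiom.ExcludedMiddle using (ExcludedMiddle)
open import Data.Bool using (T; true; false)
open import Data.Empty using (⊥-elim)
open import Data.Fin using (Fin; zero; suc; toℕ; fromℕ<)
import Data.Fin.Properties as Finₚ
open import Data.Fin.Subset using (Subset; _∈_; _∩_; ⋃; ⁅_⁆; ∣_∣) renaming (⊥ to ∅)
open import Data.Fin.Subset.Properties using (x∈p∪q⁻; x∈p∪q⁺; x∈p∩q⁻; x∈⁅x⁆; x∈⁅y⁆⇒x≡y; ∉⊥; ∣p∣≤n; ∣⊥∣≡0)
open import Data.List using (List; []; _∷_; _∷ʳ_; _++_; length; map; concat; foldr; lookup; allFin)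
open import Data.List.Membership.Propositional using () renaming (_∈_ to _∈ˡ_)
open import Data.List.Membership.Propositional.Properties using (∈-allFin)
open import Data.List.Properties using (concat-map-[_]; length-map; length-++; length-tabulate; ++-assoc; ++-identityʳ)
open import Data.List.Relation.Binary.Permutation.Propositional using (_↭_; ↭-refl; ↭-sym; ↭-trans; ↭-reflexive)
open import Data.List.Relation.Binary.Permutation.Propositional.Properties using (shift; ++⁺ˡ; ++⁺ʳ; ++-comm; ↭-length; ∈-resp-↭)
open import Data.List.Relation.Binary.Pointwise using (Pointwise; []; _∷_)
open import Data.List.Relation.Unary.All as All using (All; []; _∷_)
open import Data.List.Relation.Unary.AllPairs using (AllPairs; []; _∷_)
import Data.List.Relation.Unary.AllPairs.Properties as AllPairs
open import Data.List.Relation.Unary.Any using (Any; here; there)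
import Data.List.Relation.Unary.Any.Properties as Any
open import Data.List.Relation.Unary.Linked using (Linked; _∷_)
open import Data.List.Relation.Unary.Unique.Propositional using (Unique)
open import Data.Maybe using (Maybe; just; nothing)
open import Data.Nat using (ℕ; zero; suc; _⊓_) renaming (_*_ to _*ℕ_; _≤_ to _≤ℕ_)
import Data.Nat as ℕ
open import Data.Nat.Induction using (<-rec)
open import Data.Nat.Logarithm using (⌊log₂_⌋; ⌊log₂⌋-mono-≤; ⌊log₂⌊n/2⌋⌋≡⌊log₂n⌋∸1)
import Data.Nat.Properties as ℕₚ
open import Data.Nat.Tactic.RingSolver using (solve-∀)
open import Data.Product using (Σ; ∃; ∃-syntax; _×_; _,_; proj₁; proj₂)
open import Data.Sum using (_⊎_; inj₁; inj₂)
open import Data.Unit using (⊤; tt)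
import Data.Vec as Vec
open Vec using ([]; _∷_)
open import Function using (_∘_; id)
open import Relation.Binary using (IsDecTotalOrder; tri<; tri≈; tri>)
open import Relation.Binary.Construct.Closure.ReflexiveTransitive using (Star; _◅_; reverse)
import Relation.Binary.PropositionalEquality as ≡
open ≡ using (_≡_; _≢_)
import Relation.Binary.Reasoning.Setoid as SetoidReasoning
open import Relation.Nullary using (¬_; Dec; yes; no)
open import Relation.Nullary.Decidable using (map′)
open import Relation.Unary using (Pred)

-- Real arithmetic

-- The model of computation has no rounding, so the cells of a regular grid cannot be addressed;
-- strips that open at ends of objects need comparisons only, and there are at most n of them. They
-- need not be contiguous: all that is used is that successive starts differ by more than the width.
-- Correctness and cost are kept apart. Each object carries a counter into the sweep, which bounds
-- the total size of the bags by n(M + 1) without any geometry and so yields the running time;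
-- correctness then has to show that no counter runs out too soon, and there D ≤ Mr enters. The
-- program depends on k only through the literal `M` and computes D from its input. The language has
-- folds but no general recursion. A fold visits a list from its end, so an ascending sweep wants a
-- descending list, and loops that consume other data use a fold merely as a clock. The bound on the
-- layered tree-independence number comes without basic operations; these are obtained classically
-- from compactness and completeness, and the same program is run on them.

module RealArithmetic (R : RealNumbers) where

  open RealNumbers R hiding (zero)
  open IsDecTotalOrder isDecTotalOrder public
    using (antisym)
    renaming (refl to ≤-refl; trans to ≤-trans; total to ≤-total; reflexive to ≤-reflexive)
  open Multiples semiring using (×-homo-+; ×1-homo-*) renaming (_×_ to _·_)
  open RingProperties ring using (-‿distribˡ-*; -‿distribʳ-*; -‿involutive; -0#≈0#)
  open AbelianGroupProperties +-abelianGroup using (⁻¹-∙-comm)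

  -- Ring solving with integer coefficients, an integer being a formal
  -- difference of natural numbers.
  module IntegerCoefficients where

    reduced : ℕ → ℕ → ℕ × ℕ
    reduced a b = a ℕ.∸ b , b ℕ.∸ a

    differences : RawRing 0ℓ 0ℓ
    differences = record
      { Carrier = ℕ × ℕ
      ; _≈_     = _≡_
      ; _+_     = λ (a , b) (c , d) → reduced (a ℕ.+ c) (b ℕ.+ d)
      ; _*_     = λ (a , b) (c , d) → reduced (a ℕ.* c ℕ.+ b ℕ.* d) (a ℕ.* d ℕ.+ b ℕ.* c)
      ; -_      = λ (a , b) → b , a
      ; 0#      = 0 , 0
      ; 1#      = 1 , 0
      }

    -- The first clause makes `con (0 , 0)` and `con (1 , 0)` compute to `0#` and `1#`, so that
    -- solved identities fit the goals as they stand.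
    ⟦_⟧ : ℕ × ℕ → Carrier
    ⟦ a , zero ⟧  = a · 1#
    ⟦ a , suc b ⟧ = a · 1# - suc b · 1#

    ⟦⟧-difference : ∀ a b → ⟦ a , b ⟧ ≈ a · 1# - b · 1#
    ⟦⟧-difference a zero    = sym (trans (+-congˡ -0#≈0#) (+-identityʳ _))
    ⟦⟧-difference a (suc b) = refl

    open SetoidReasoning setoid

    +-interchange : ∀ w x y z → (w + x) + (y + z) ≈ (w + y) + (x + z)
    +-interchange w x y z = begin
      (w + x) + (y + z) ≈⟨ +-assoc w x (y + z) ⟩
      w + (x + (y + z)) ≈⟨ +-congˡ (sym (+-assoc x y z)) ⟩
      w + ((x + y) + z) ≈⟨ +-congˡ (+-congʳ (+-comm x y)) ⟩
      w + ((y + x) + z) ≈⟨ +-congˡ (+-assoc y x z) ⟩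
      w + (y + (x + z)) ≈⟨ sym (+-assoc w y (x + z)) ⟩
      (w + y) + (x + z) ∎

    sum-of-differences : ∀ w x y z → (w + y) - (x + z) ≈ (w - x) + (y - z)
    sum-of-differences w x y z = begin
      (w + y) - (x + z)     ≈⟨ +-congˡ (sym (⁻¹-∙-comm x z)) ⟩
      (w + y) + (- x + - z) ≈⟨ +-interchange w y (- x) (- z) ⟩
      (w - x) + (y - z)     ∎

    product-of-differences : ∀ w x y z →
      (w * y + x * z) - (w * z + x * y) ≈ (w - x) * (y - z)
    product-of-differences w x y z = sym (begin
      (w - x) * (y - z)                               ≈⟨ distribʳ (y - z) w (- x) ⟩
      w * (y - z) + (- x) * (y - z)                   ≈⟨ +-cong (distribˡ w y (- z)) (distribˡ (- x) y (- z)) ⟩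
      (w * y + w * - z) + (- x * y + - x * - z)       ≈⟨ +-congˡ (+-comm (- x * y) (- x * - z)) ⟩
      (w * y + w * - z) + (- x * - z + - x * y)       ≈⟨ +-interchange (w * y) (w * - z) (- x * - z) (- x * y) ⟩
      (w * y + - x * - z) + (w * - z + - x * y)       ≈⟨ +-cong (+-congˡ negneg) (+-cong (sym (-‿distribʳ-* w z)) (sym (-‿distribˡ-* x y))) ⟩
      (w * y + x * z) + (- (w * z) + - (x * y))       ≈⟨ +-congˡ (⁻¹-∙-comm (w * z) (x * y)) ⟩
      (w * y + x * z) - (w * z + x * y)               ∎)
      where
      negneg : - x * - z ≈ x * z
      negneg = begin
        - x * - z     ≈⟨ sym (-‿distribˡ-* x (- z)) ⟩
        - (x * - z)   ≈⟨ -‿cong (sym (-‿distribʳ-* x z)) ⟩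
        - - (x * z)   ≈⟨ -‿involutive (x * z) ⟩
        x * z         ∎

    equal : ∀ a b c d → a ℕ.+ d ≡ c ℕ.+ b → ⟦ a , b ⟧ ≈ ⟦ c , d ⟧
    equal a b c d e = begin
      ⟦ a , b ⟧                             ≈⟨ ⟦⟧-difference a b ⟩
      a · 1# - b · 1#                       ≈⟨ sym (+-identityʳ _) ⟩
      (a · 1# - b · 1#) + 0#                ≈⟨ +-congˡ (sym (-‿inverseʳ (d · 1#))) ⟩
      (a · 1# - b · 1#) + (d · 1# - d · 1#) ≈⟨ +-interchange _ _ _ _ ⟩
      (a · 1# + d · 1#) + (- (b · 1#) - d · 1#) ≈⟨ +-congʳ same ⟩
      (c · 1# + b · 1#) + (- (b · 1#) - d · 1#) ≈⟨ +-congˡ (+-comm _ _) ⟩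
      (c · 1# + b · 1#) + (- (d · 1#) - b · 1#) ≈⟨ +-interchange _ _ _ _ ⟩
      (c · 1# - d · 1#) + (b · 1# - b · 1#) ≈⟨ +-congˡ (-‿inverseʳ (b · 1#)) ⟩
      (c · 1# - d · 1#) + 0#                ≈⟨ +-identityʳ _ ⟩
      c · 1# - d · 1#                       ≈⟨ sym (⟦⟧-difference c d) ⟩
      ⟦ c , d ⟧ ∎
      where
      same : a · 1# + d · 1# ≈ c · 1# + b · 1#
      same = trans (sym (×-homo-+ 1# a d))
                   (trans (reflexive (≡.cong (_· 1#) e)) (×-homo-+ 1# c b))

    reduced-difference : ∀ a b → ⟦ reduced a b ⟧ ≈ a · 1# - b · 1#
    reduced-difference a b = trans (equal (a ℕ.∸ b) (b ℕ.∸ a) a b (balanced a b)) (⟦⟧-difference a b)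
      where
      balanced : ∀ a b → a ℕ.∸ b ℕ.+ b ≡ a ℕ.+ (b ℕ.∸ a)
      balanced zero    zero    = ≡.refl
      balanced zero    (suc b) = ≡.refl
      balanced (suc a) zero    = ≡.refl
      balanced (suc a) (suc b) = ≡.trans (ℕₚ.+-suc (a ℕ.∸ b) b) (≡.cong suc (balanced a b))

    homomorphism : differences -Raw-AlmostCommutative⟶ fromCommutativeRing commutativeRing
    homomorphism = record
      { ⟦_⟧    = ⟦_⟧
      ; +-homo = λ (a , b) (c , d) → begin
          ⟦ reduced (a ℕ.+ c) (b ℕ.+ d) ⟧             ≈⟨ reduced-difference (a ℕ.+ c) (b ℕ.+ d) ⟩
          (a ℕ.+ c) · 1# - (b ℕ.+ d) · 1#             ≈⟨ +-cong (×-homo-+ 1# a c) (-‿cong (×-homo-+ 1# b d)) ⟩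
          (a · 1# + c · 1#) - (b · 1# + d · 1#)       ≈⟨ sum-of-differences _ _ _ _ ⟩
          (a · 1# - b · 1#) + (c · 1# - d · 1#)       ≈⟨ sym (+-cong (⟦⟧-difference a b) (⟦⟧-difference c d)) ⟩
          ⟦ a , b ⟧ + ⟦ c , d ⟧                       ∎
      ; *-homo = λ (a , b) (c , d) → begin
          ⟦ reduced (a ℕ.* c ℕ.+ b ℕ.* d) (a ℕ.* d ℕ.+ b ℕ.* c) ⟧
            ≈⟨ reduced-difference (a ℕ.* c ℕ.+ b ℕ.* d) (a ℕ.* d ℕ.+ b ℕ.* c) ⟩
          (a ℕ.* c ℕ.+ b ℕ.* d) · 1# - (a ℕ.* d ℕ.+ b ℕ.* c) · 1#
            ≈⟨ +-cong (products a c b d) (-‿cong (products a d b c)) ⟩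
          (a · 1# * c · 1# + b · 1# * d · 1#) - (a · 1# * d · 1# + b · 1# * c · 1#)
            ≈⟨ product-of-differences _ _ _ _ ⟩
          (a · 1# - b · 1#) * (c · 1# - d · 1#)
            ≈⟨ sym (*-cong (⟦⟧-difference a b) (⟦⟧-difference c d)) ⟩
          ⟦ a , b ⟧ * ⟦ c , d ⟧ ∎
      ; -‿homo = λ (a , b) → begin
          ⟦ b , a ⟧                ≈⟨ ⟦⟧-difference b a ⟩
          b · 1# - a · 1#          ≈⟨ +-comm _ _ ⟩
          - (a · 1#) + b · 1#      ≈⟨ +-congˡ (sym (-‿involutive _)) ⟩
          - (a · 1#) - - (b · 1#)  ≈⟨ ⁻¹-∙-comm _ _ ⟩
          - (a · 1# - b · 1#)      ≈⟨ -‿cong (sym (⟦⟧-difference a b)) ⟩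
          - ⟦ a , b ⟧              ∎
      ; 0-homo = refl
      ; 1-homo = refl
      }
      where
      products : ∀ a c b d →
        (a ℕ.* c ℕ.+ b ℕ.* d) · 1# ≈ a · 1# * c · 1# + b · 1# * d · 1#
      products a c b d = trans (×-homo-+ 1# (a ℕ.* c) (b ℕ.* d))
                               (+-cong (×1-homo-* a c) (×1-homo-* b d))

    equal? : ∀ x y → Maybe (⟦ x ⟧ ≈ ⟦ y ⟧)
    equal? (a , b) (c , d) with a ℕ.+ d ℕ.≟ c ℕ.+ b
    ... | no _  = nothing
    ... | yes e = just (equal a b c d e)

  open Algebra.Solver.Ring IntegerCoefficients.differences (fromCommutativeRing commutativeRing)
    IntegerCoefficients.homomorphism IntegerCoefficients.equal? public
    using (solve; con; _:+_; _:*_; _:-_; :-_; _:=_)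

  -- Linear inequalities are derived by exhibiting the conclusion as a sum
  -- of the hypotheses, the remaining ring identity being left to the solver.

  ≤-respʳ : ∀ {x y z} → y ≈ z → x ≤ y → x ≤ z
  ≤-respʳ e p = ≤-trans p (≤-reflexive e)

  ≤-respˡ : ∀ {x y z} → x ≈ y → x ≤ z → y ≤ z
  ≤-respˡ e p = ≤-trans (≤-reflexive (sym e)) p

  0≤difference : ∀ {x y} → x ≤ y → 0# ≤ y - x
  0≤difference {x} {y} p = ≤-respˡ (-‿inverseʳ x) (+-monoˡ-≤ (- x) p)

  0≤difference⁻¹ : ∀ {x y} → 0# ≤ y - x → x ≤ y
  0≤difference⁻¹ {x} {y} p = ≤-respˡ (+-identityˡ x)
    (≤-respʳ (solve 2 (λ x y → y :- x :+ x := y) refl x y) (+-monoˡ-≤ x p))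

  0≤-+ : ∀ {x y} → 0# ≤ x → 0# ≤ y → 0# ≤ x + y
  0≤-+ {x} {y} p q = ≤-trans q (≤-respˡ (+-identityˡ y) (+-monoˡ-≤ y p))

  linear₁ : ∀ {a b x y} → x ≤ y → y - x ≈ b - a → a ≤ b
  linear₁ p e = 0≤difference⁻¹ (≤-respʳ e (0≤difference p))

  linear₂ : ∀ {a b x y z w} → x ≤ y → z ≤ w → (y - x) + (w - z) ≈ b - a → a ≤ b
  linear₂ p q e = 0≤difference⁻¹ (≤-respʳ e (0≤-+ (0≤difference p) (0≤difference q)))

  linear₃ : ∀ {a b x y z w u v} → x ≤ y → z ≤ w → u ≤ v →
            (y - x) + (w - z) + (v - u) ≈ b - a → a ≤ b
  linear₃ p q r e = 0≤difference⁻¹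
    (≤-respʳ e (0≤-+ (0≤-+ (0≤difference p) (0≤difference q)) (0≤difference r)))

  +-mono-≤ : ∀ {a b x y} → a ≤ b → x ≤ y → a + x ≤ b + y
  +-mono-≤ {a} {b} {x} {y} p q = linear₂ p q
    (solve 4 (λ a b x y → (b :- a) :+ (y :- x) := (b :+ y) :- (a :+ x)) refl a b x y)

  ≰⇒< : ∀ {x y} → ¬ y ≤ x → x < y
  ≰⇒< {x} {y} ¬p with ≤-total x y
  ... | inj₁ p = p , λ e → ¬p (≤-reflexive (sym e))
  ... | inj₂ p = ⊥-elim (¬p p)

  <⇒≰ : ∀ {x y} → x < y → ¬ y ≤ x
  <⇒≰ (p , ¬e) q = ¬e (antisym p q)

  ≰⇒≥ : ∀ {x y} → ¬ y ≤ x → x ≤ y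
  ≰⇒≥ ¬p = proj₁ (≰⇒< ¬p)

  0≤1 : 0# ≤ 1#
  0≤1 with ≤-total 0# 1#
  ... | inj₁ p = p
  ... | inj₂ p = ≤-respʳ (solve 0 (:- con (1 , 0) :* :- con (1 , 0) := con (1 , 0)) refl)
                   (*-nonneg 0≤-1 0≤-1)
    where
    0≤-1 : 0# ≤ - 1#
    0≤-1 = ≤-respʳ (+-identityˡ (- 1#)) (0≤difference p)

  1≰0 : ¬ 1# ≤ 0#
  1≰0 p = 0≉1 (antisym 0≤1 p)

  0≤square : ∀ x → 0# ≤ x * x
  0≤square x with ≤-total 0# x
  ... | inj₁ p = *-nonneg p p
  ... | inj₂ p = ≤-respʳ (solve 1 (λ x → (con (0 , 0) :- x) :* (con (0 , 0) :- x) := x :* x) refl x)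
                   (*-nonneg (0≤difference p) (0≤difference p))

  *-monoˡ-≤ : ∀ {x y z} → 0# ≤ z → x ≤ y → z * x ≤ z * y
  *-monoˡ-≤ {x} {y} {z} p q = 0≤difference⁻¹
    (≤-respʳ (solve 3 (λ x y z → z :* (y :- x) := z :* y :- z :* x) refl x y z)
      (*-nonneg p (0≤difference q)))

  -- Positivity is written `¬ x ≤ 0#`, the form in which a failed test `_≤?_` supplies it. If the
  -- inverse were at most 0, then `x * (0# - x ⁻¹)` would be nonnegative, yet it equals -1.
  ⁻¹-nonneg : ∀ {x} → ¬ x ≤ 0# → 0# ≤ x ⁻¹
  ⁻¹-nonneg {x} ¬p with ≤-total 0# (x ⁻¹)
  ... | inj₁ q = q
  ... | inj₂ q = ⊥-elim (1≰0 (linear₁ (*-nonneg (≰⇒≥ ¬p) (0≤difference q)) e))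
    where
    open SetoidReasoning setoid
    e : x * (0# - x ⁻¹) - 0# ≈ 0# - 1#
    e = begin
      x * (0# - x ⁻¹) - 0# ≈⟨ solve 2 (λ x i → x :* (con (0 , 0) :- i) :- con (0 , 0) := con (0 , 0) :- x :* i) refl x (x ⁻¹) ⟩
      0# - x * x ⁻¹        ≈⟨ +-congˡ (-‿cong (*-inverseʳ (λ e → ¬p (≤-reflexive e)))) ⟩
      0# - 1#              ∎

  *-cancelˡ-≤ : ∀ {x y z} → ¬ z ≤ 0# → z * x ≤ z * y → x ≤ y
  *-cancelˡ-≤ {x} {y} {z} ¬p q =
    ≤-respˡ (unscale x) (≤-respʳ (unscale y) (*-monoˡ-≤ (⁻¹-nonneg ¬p) q))
    where
    open SetoidReasoning setoid
    unscale : ∀ u → z ⁻¹ * (z * u) ≈ u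
    unscale u = begin
      z ⁻¹ * (z * u) ≈⟨ solve 3 (λ i z u → i :* (z :* u) := (z :* i) :* u) refl (z ⁻¹) z u ⟩
      (z * z ⁻¹) * u ≈⟨ *-congʳ (*-inverseʳ (λ e → ¬p (≤-reflexive e))) ⟩
      1# * u         ≈⟨ *-identityˡ u ⟩
      u              ∎

  *-positive : ∀ {x y} → ¬ x ≤ 0# → ¬ y ≤ 0# → ¬ x * y ≤ 0#
  *-positive {x} {y} ¬p ¬q r = ¬q (*-cancelˡ-≤ ¬p (≤-respʳ (sym (zeroʳ x)) r))

  +-positiveˡ : ∀ {x y} → ¬ x ≤ 0# → 0# ≤ y → ¬ x + y ≤ 0#
  +-positiveˡ {x} {y} ¬p q r = ¬p (linear₂ r q
    (solve 2 (λ x y → (con (0 , 0) :- (x :+ y)) :+ (y :- con (0 , 0)) := con (0 , 0) :- x) refl x y))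

  difference-positive : ∀ {x y} → ¬ y ≤ x → ¬ y - x ≤ 0#
  difference-positive {x} {y} ¬p q = ¬p (linear₁ q
    (solve 2 (λ x y → con (0 , 0) :- (y :- x) := x :- y) refl x y))

  square-cancel-≤ : ∀ {x y} → 0# ≤ y → x * x ≤ y * y → x ≤ y
  square-cancel-≤ {x} {y} p q with x ≤? y
  ... | yes r = r
  ... | no ¬r = ⊥-elim (*-positive (difference-positive ¬r)
      (λ s → ¬r (linear₂ s (0≤-+ p p)
        (solve 2 (λ x y → (con (0 , 0) :- (x :+ y)) :+ (y :+ y :- con (0 , 0)) := y :- x) refl x y)))
      (linear₁ q (solve 2 (λ x y → y :* y :- x :* x := con (0 , 0) :- (x :- y) :* (x :+ y)) refl x y)))

  fromℕ-mono-≤ : ∀ {m n} → m ℕ.≤ n → fromℕ m ≤ fromℕ n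
  fromℕ-mono-≤ {zero} {zero} ℕ.z≤n = ≤-refl
  fromℕ-mono-≤ {zero} {suc n} ℕ.z≤n = 0≤-+ 0≤1 (fromℕ-mono-≤ {zero} {n} ℕ.z≤n)
  fromℕ-mono-≤ (ℕ.s≤s p) = +-mono-≤ ≤-refl (fromℕ-mono-≤ p)

  fromℕ-+ : ∀ m n → fromℕ (m ℕ.+ n) ≈ fromℕ m + fromℕ n
  fromℕ-+ = UnoptimisedMultiples.×-homo-+ semiring 1#

  -- Distances are square roots, so their existence, and with it that of diameters, rests on this
  -- consequence of completeness. The root is the supremum of the nonnegative numbers whose square
  -- is at most `a`.
  sqrt : ∀ a → 0# ≤ a → ∃ (IsSqrt a)
  sqrt a 0≤a = s , 0≤s , antisym s²≤a a≤s²
    where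
    open SetoidReasoning setoid

    P : Carrier → Set
    P x = 0# ≤ x × x * x ≤ a

    0∈P : P 0#
    0∈P = ≤-refl , ≤-respˡ (sym (zeroˡ 0#)) 0≤a

    -- An upper bound because (1 + a)² exceeds a by 1 + a + a²; it serves again below as the second
    -- point of the secant.
    t : Carrier
    t = 1# + a

    0≤t : 0# ≤ t
    0≤t = 0≤-+ 0≤1 0≤a

    a≤t² : a ≤ t * t
    a≤t² = linear₃ 0≤1 0≤a (0≤square a)
      (solve 1 (λ a → (con (1 , 0) :- con (0 , 0)) :+ (a :- con (0 , 0)) :+ (a :* a :- con (0 , 0))
                := (con (1 , 0) :+ a) :* (con (1 , 0) :+ a) :- a) refl a)

    t-bound : UpperBound P t
    t-bound x (_ , x²≤a) = square-cancel-≤ 0≤t (≤-trans x²≤a a≤t²)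

    supremum : ∃ (IsSupremum P)
    supremum = complete P (0# , 0∈P) (t , t-bound)

    s : Carrier
    s = proj₁ supremum

    0≤s : 0# ≤ s
    0≤s = proj₁ (proj₂ supremum) 0# 0∈P

    -- If s² > a, then the Newton step (s² + a) / 2s is a smaller upper bound.
    s²≤a : s * s ≤ a
    s²≤a with s * s ≤? a
    ... | yes p = p
    ... | no ¬p = ⊥-elim (¬p (*-cancelˡ-≤ i-positive (linear₁ s≤y e₂)))
      where
      s-positive : ¬ s ≤ 0#
      s-positive q = ¬p (≤-respˡ (*-congˡ (antisym 0≤s q)) (≤-respˡ (sym (zeroʳ s)) 0≤a))
      i y : Carrier
      i = (s + s) ⁻¹
      y = (s * s + a) * i
      2s-positive : ¬ s + s ≤ 0#
      2s-positive = +-positiveˡ s-positive 0≤s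
      2si≈1 : (s + s) * i ≈ 1#
      2si≈1 = *-inverseʳ (λ e → 2s-positive (≤-reflexive e))
      0≤i : 0# ≤ i
      0≤i = ⁻¹-nonneg 2s-positive
      i-positive : ¬ i ≤ 0#
      i-positive q = 1≰0 (≤-respˡ 2si≈1 (≤-reflexive
        (trans (*-congˡ (antisym q 0≤i)) (zeroʳ _))))
      -- The inequality of the means: y² - a is the square of (s² - a) / 2s.
      a≤y² : a ≤ y * y
      a≤y² = 0≤difference⁻¹ (≤-respʳ e (0≤square ((s * s - a) * i)))
        where
        e : (s * s - a) * i * ((s * s - a) * i) ≈ y * y - a
        e = begin
          (s * s - a) * i * ((s * s - a) * i)
            ≈⟨ solve 3 (λ s a i → (s :* s :- a) :* i :* ((s :* s :- a) :* i)
                 := (s :* s :+ a) :* i :* ((s :* s :+ a) :* i) :- a :* (((s :+ s) :* i) :* ((s :+ s) :* i))) refl s a i ⟩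
          y * y - a * (((s + s) * i) * ((s + s) * i))
            ≈⟨ +-congˡ (-‿cong (*-congˡ (*-cong 2si≈1 2si≈1))) ⟩
          y * y - a * (1# * 1#)
            ≈⟨ solve 2 (λ y a → y :* y :- a :* (con (1 , 0) :* con (1 , 0)) := y :* y :- a) refl y a ⟩
          y * y - a ∎
      s≤y : s ≤ y
      s≤y = proj₂ (proj₂ supremum) y λ x (_ , x²≤a) →
        square-cancel-≤ (*-nonneg (0≤-+ (0≤square s) 0≤a) 0≤i) (≤-trans x²≤a a≤y²)
      e₂ : y - s ≈ i * a - i * (s * s)
      e₂ = begin
        y - s                   ≈⟨ +-congˡ (-‿cong (sym (*-identityʳ s))) ⟩
        y - s * 1#              ≈⟨ +-congˡ (-‿cong (*-congˡ (sym 2si≈1))) ⟩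
        y - s * ((s + s) * i)   ≈⟨ solve 3 (λ s a i → (s :* s :+ a) :* i :- s :* ((s :+ s) :* i)
                                     := i :* a :- i :* (s :* s)) refl s a i ⟩
        i * a - i * (s * s)     ∎

    -- If s² < a, then the secant step (s t + a) / (s + t) still lies in P.
    a≤s² : a ≤ s * s
    a≤s² with a ≤? s * s
    ... | yes p = p
    ... | no ¬p = ⊥-elim (¬p (*-cancelˡ-≤ i-positive (linear₁ y≤s e₂)))
      where
      i y : Carrier
      i = (t + s) ⁻¹
      y = (s * t + a) * i
      t+s-positive : ¬ t + s ≤ 0#
      t+s-positive = +-positiveˡ (+-positiveˡ 1≰0 0≤a) 0≤s
      qi≈1 : (t + s) * i ≈ 1#
      qi≈1 = *-inverseʳ (λ e → t+s-positive (≤-reflexive e))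
      0≤i : 0# ≤ i
      0≤i = ⁻¹-nonneg t+s-positive
      i-positive : ¬ i ≤ 0#
      i-positive q = 1≰0 (≤-respˡ qi≈1 (≤-reflexive
        (trans (*-congˡ (antisym q 0≤i)) (zeroʳ _))))
      -- Here a - y² = (a - s²)(t² - a) / (t + s)², with nonnegative factors.
      y²≤a : y * y ≤ a
      y²≤a = 0≤difference⁻¹ (≤-respʳ e
        (*-nonneg (0≤square i) (*-nonneg (0≤difference (≰⇒≥ ¬p)) (0≤difference a≤t²))))
        where
        e : i * i * ((a - s * s) * (t * t - a)) ≈ a - y * y
        e = begin
          i * i * ((a - s * s) * (t * t - a))
            ≈⟨ solve 4 (λ s a i t → i :* i :* ((a :- s :* s) :* (t :* t :- a))
                 := a :* (((t :+ s) :* i) :* ((t :+ s) :* i)) :- (s :* t :+ a) :* i :* ((s :* t :+ a) :* i)) refl s a i t ⟩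
          a * (((t + s) * i) * ((t + s) * i)) - y * y
            ≈⟨ +-congʳ (*-congˡ (*-cong qi≈1 qi≈1)) ⟩
          a * (1# * 1#) - y * y
            ≈⟨ solve 2 (λ y a → a :* (con (1 , 0) :* con (1 , 0)) :- y :* y := a :- y :* y) refl y a ⟩
          a - y * y ∎
      y≤s : y ≤ s
      y≤s = proj₁ (proj₂ supremum) y
        (*-nonneg (0≤-+ (*-nonneg 0≤s 0≤t) 0≤a) 0≤i , y²≤a)
      e₂ : s - y ≈ i * (s * s) - i * a
      e₂ = begin
        s - y                   ≈⟨ +-congʳ (sym (*-identityʳ s)) ⟩
        s * 1# - y              ≈⟨ +-congʳ (*-congˡ (sym qi≈1)) ⟩
        s * ((t + s) * i) - y   ≈⟨ solve 4 (λ s a i t → s :* ((t :+ s) :* i) :- (s :* t :+ a) :* i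
                                     := i :* (s :* s) :- i :* a) refl s a i t ⟩
        i * (s * s) - i * a     ∎

-- Plane geometry

lowerExcludedMiddle : ExcludedMiddle (lsuc 0ℓ) → ExcludedMiddle 0ℓ
lowerExcludedMiddle em = map′ lower lift em

subset-split : ∀ {n} (I : Subset n) {P : Pred (Fin n) 0ℓ} (P? : ∀ i → Dec (P i)) →
  ∃[ J ] ∃[ K ] (∣ I ∣ ≡ ∣ J ∣ ℕ.+ ∣ K ∣ ×
    (∀ {i} → i ∈ J → i ∈ I × P i) × (∀ {i} → i ∈ K → i ∈ I × ¬ P i))
subset-split [] P? = [] , [] , ≡.refl , (λ ()) , (λ ())
subset-split (b ∷ I) P? with subset-split I (P? ∘ suc)
subset-split (false ∷ I) P? | J , K , e , inJ , inK =
  false ∷ J , false ∷ K , e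
  , (λ { (Vec.there i∈J) → let (i∈I , p) = inJ i∈J in Vec.there i∈I , p })
  , (λ { (Vec.there i∈K) → let (i∈I , p) = inK i∈K in Vec.there i∈I , p })
subset-split (true ∷ I) P? | J , K , e , inJ , inK with P? zero
... | yes p =
  true ∷ J , false ∷ K , ≡.cong suc e
  , (λ { Vec.here → Vec.here , p
       ; (Vec.there i∈J) → let (i∈I , p) = inJ i∈J in Vec.there i∈I , p })
  , (λ { (Vec.there i∈K) → let (i∈I , p) = inK i∈K in Vec.there i∈I , p })
... | no ¬p =
  false ∷ J , true ∷ K , ≡.trans (≡.cong suc e) (≡.sym (ℕₚ.+-suc ∣ J ∣ ∣ K ∣))
  , (λ { (Vec.there i∈J) → let (i∈I , p) = inJ i∈J in Vec.there i∈I , p })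
  , (λ { Vec.here → Vec.here , ¬p
       ; (Vec.there i∈K) → let (i∈I , p) = inK i∈K in Vec.there i∈I , p })

module PlaneGeometry (R : RealNumbers) where

  open RealNumbers R hiding (zero)
  open RealArithmetic R
  open Plane R

  -- Distances and the intermediate value theorem

  distance-sym : ∀ {p q d} → IsDistance p q d → IsDistance q p d
  distance-sym {x , y} {x′ , y′} (0≤d , e) = 0≤d , trans e
    (solve 4 (λ x y x′ y′ → (x :- x′) :* (x :- x′) :+ (y :- y′) :* (y :- y′)
                := (x′ :- x) :* (x′ :- x) :+ (y′ :- y) :* (y′ :- y)) refl x y x′ y′)

  distance : ∀ p q → ∃ (IsDistance p q)
  distance (x , y) (x′ , y′) = sqrt _ (0≤-+ (0≤square (x - x′)) (0≤square (y - y′)))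

  -- Both coordinates and their negatives have this property, and no other form of continuity of a
  -- function on the plane is used; one minimisation over a compact set then yields all four
  -- extents. The one-sided bound suffices as distances are symmetric.
  Nonexpansive : (Point → ℝ) → Set
  Nonexpansive f = ∀ {p q d} → IsDistance p q d → f p - f q ≤ d

  x-nonexpansive : Nonexpansive proj₁
  x-nonexpansive {x , y} {x′ , y′} (0≤d , e) =
    square-cancel-≤ 0≤d (≤-respʳ (sym e) (linear₁ (0≤square (y - y′))
      (solve 2 (λ a b → b :- con (0 , 0) := a :+ b :- a) refl ((x - x′) * (x - x′)) ((y - y′) * (y - y′)))))

  y-nonexpansive : Nonexpansive proj₂
  y-nonexpansive {x , y} {x′ , y′} (0≤d , e) =
    square-cancel-≤ 0≤d (≤-respʳ (sym e) (linear₁ (0≤square (x - x′))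
      (solve 2 (λ a b → a :- con (0 , 0) := a :+ b :- b) refl ((x - x′) * (x - x′)) ((y - y′) * (y - y′)))))

  negation-nonexpansive : ∀ {f} → Nonexpansive f → Nonexpansive (λ p → - f p)
  negation-nonexpansive {f} f-ne {p} {q} δ = ≤-respˡ
    (solve 2 (λ a b → b :- a := :- a :- :- b) refl (f p) (f q)) (f-ne (distance-sym {p} {q} δ))

  near-below : ∀ {f p q ε} → Nonexpansive f → Near ε p q → ¬ f q + ε ≤ f p
  near-below {f} {p} {q} {ε} f-ne (d , δ , d<ε) r = <⇒≰ d<ε (linear₂ r (f-ne {p} {q} δ)
    (solve 4 (λ a b d ε → (a :- (b :+ ε)) :+ (d :- (a :- b)) := d :- ε) refl (f p) (f q) d ε))

  near-above : ∀ {f p q ε} → Nonexpansive f → Near ε p q → ¬ f p + ε ≤ f q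
  near-above {f} {p} {q} f-ne (d , δ , d<ε) =
    near-below {f} {q} {p} f-ne (d , distance-sym {p} {q} δ , d<ε)

  -- The parameter is the supremum of those in [0,1] at which the value is at most `v`. Were the
  -- value there above `v`, an interval to its left would contain no such parameter and the supremum
  -- would be smaller; were it below `v`, such parameters would exist further right, or else the end
  -- of the path would be too low.
  intermediate-value : ∀ {f γ v} → Nonexpansive f → IsPath γ →
    f (γ 0#) ≤ v → v ≤ f (γ 1#) → ∃[ u ] (InUnitInterval u × f (γ u) ≈ v)
  intermediate-value {f} {γ} {v} f-ne γ-path low high =
    at-supremum (complete P (0# , 0∈P) (1# , λ u p → proj₂ (proj₁ p)))
    where
    P : ℝ → Set
    P u = InUnitInterval u × f (γ u) ≤ v

    0∈P : P 0#
    0∈P = (≤-refl , 0≤1) , low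

    at-supremum : ∃ (IsSupremum P) → ∃[ u ] (InUnitInterval u × f (γ u) ≈ v)
    at-supremum (s , s-bound , s-least) = s , (0≤s , s≤1) , antisym below above
      where
      0≤s : 0# ≤ s
      0≤s = s-bound 0# 0∈P

      s≤1 : s ≤ 1#
      s≤1 = s-least 1# λ u p → proj₂ (proj₁ p)

      below : f (γ s) ≤ v
      below with f (γ s) ≤? v
      ... | yes p = p
      ... | no ¬p with γ-path s (0≤s , s≤1) (f (γ s) - v) (≰⇒< (difference-positive ¬p))
      ...   | δ , 0<δ , close = ⊥-elim (<⇒≰ 0<δ (linear₁ s≤s-δ
        (solve 2 (λ s δ → s :- δ :- s := con (0 , 0) :- δ) refl s δ)))
        where
        s≤s-δ : s ≤ s - δ
        s≤s-δ = s-least (s - δ) bound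
          where
          bound : UpperBound P (s - δ)
          bound u u∈P with u ≤? s - δ
          ... | yes r = r
          ... | no ¬r = ⊥-elim (near-below {f} {γ s} {γ u} f-ne
            (close u (proj₁ u∈P)
              (≰⇒< (λ r → <⇒≰ 0<δ (linear₂ r (s-bound u u∈P)
                (solve 3 (λ s u δ → (u :- (s :+ δ)) :+ (s :- u) := con (0 , 0) :- δ) refl s u δ))))
              (≰⇒< (λ r → ¬r (linear₁ r
                (solve 3 (λ s u δ → s :- (u :+ δ) := s :- δ :- u) refl s u δ)))))
            (linear₁ (proj₂ u∈P)
              (solve 3 (λ a b v → v :- b := a :- (b :+ (a :- v))) refl (f (γ s)) (f (γ u)) v)))

      above : v ≤ f (γ s)
      above with v ≤? f (γ s)
      ... | yes p = p
      ... | no ¬p with γ-path s (0≤s , s≤1) (v - f (γ s)) (≰⇒< (difference-positive ¬p))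
      ...   | δ , 0<δ , close = contra
        where
        -- Closeness is granted only strictly within `δ` of `s`; halving puts the closed interval
        -- from `s` to `s + h` inside that range.
        2⁻¹ h : ℝ
        2⁻¹ = (1# + 1#) ⁻¹
        h = δ * 2⁻¹
        2-positive : ¬ 1# + 1# ≤ 0#
        2-positive = +-positiveˡ 1≰0 0≤1
        h+h≈δ : h + h ≈ δ
        h+h≈δ = trans (solve 2 (λ δ i → δ :* i :+ δ :* i := δ :* ((con (1 , 0) :+ con (1 , 0)) :* i)) refl δ 2⁻¹)
          (trans (*-congˡ (*-inverseʳ (λ e → 2-positive (≤-reflexive e)))) (*-identityʳ δ))
        h-positive : ¬ h ≤ 0#
        h-positive p = <⇒≰ 0<δ (≤-respˡ h+h≈δ (≤-respʳ (+-identityˡ 0#) (+-mono-≤ p p)))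
        0≤h : 0# ≤ h
        0≤h = ≰⇒≥ h-positive
        f-close : ∀ u → InUnitInterval u → s ≤ u → u ≤ s + h → ¬ v ≤ f (γ u)
        f-close u u∈ s≤u u≤s+h q = near-above {f} {γ s} {γ u} f-ne
          (close u u∈
            (≰⇒< (λ r → h-positive (linear₂ (≤-respˡ (+-congˡ (sym h+h≈δ)) r) u≤s+h
              (solve 3 (λ s u h → (u :- (s :+ (h :+ h))) :+ (s :+ h :- u) := con (0 , 0) :- h) refl s u h))))
            (≰⇒< (λ r → <⇒≰ 0<δ (linear₂ r s≤u
              (solve 3 (λ s u δ → (s :- (u :+ δ)) :+ (u :- s) := con (0 , 0) :- δ) refl s u δ)))))
          (≤-respˡ (solve 2 (λ a v → v := a :+ (v :- a)) refl (f (γ s)) v) q)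
        contra : v ≤ f (γ s)
        -- Either the end of the path lies within `h` of `s`, against `high`, or `s + h` is a member
        -- of `P` beyond the supremum.
        contra with 1# ≤? s + h
        ... | yes r = ⊥-elim (f-close 1# (0≤1 , ≤-refl) s≤1 r high)
        ... | no ¬r = ⊥-elim (h-positive (linear₁ (s-bound (s + h) (s+h∈ , ≰⇒≥ (f-close (s + h) s+h∈ s≤s+h ≤-refl)))
            (solve 2 (λ s h → s :- (s :+ h) := con (0 , 0) :- h) refl s h)))
          where
          s≤s+h : s ≤ s + h
          s≤s+h = linear₁ 0≤h (solve 2 (λ s h → h :- con (0 , 0) := s :+ h :- s) refl s h)
          s+h∈ : InUnitInterval (s + h)
          s+h∈ = ≤-trans 0≤s s≤s+h , ≰⇒≥ ¬r

  meets-vertical-line : ∀ (o : Object) {p q v} → Contains o p → Contains o q →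
    proj₁ p ≤ v → v ≤ proj₁ q → ∃[ r ] (Contains o r × proj₁ r ≈ v)
  meets-vertical-line o {p} {q} p∈ q∈ p≤v v≤q with Object.pathConnected o p q p∈ q∈
  ... | γ , γ-path , γ0≈p , γ1≈q , γ∈
    with intermediate-value {proj₁} {γ} (λ {p} {q} → x-nonexpansive {p} {q}) γ-path
           (≤-respˡ (sym (proj₁ γ0≈p)) p≤v) (≤-respʳ (sym (proj₁ γ1≈q)) v≤q)
  ...   | u , u∈ , e = γ u , γ∈ u u∈ , e

  -- Sizes and diameters

  square-mono : ∀ {x s} → x ≤ s → - s ≤ x → x * x ≤ s * s
  square-mono {x} {s} p q = 0≤difference⁻¹ (≤-respʳ
    (solve 2 (λ x s → (s :- x) :* (x :- :- s) := s :* s :- x :* x) refl x s)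
    (*-nonneg (0≤difference p) (0≤difference q)))

  gap-in-interval : ∀ {a s x x′} → a ≤ x × x ≤ a + s → a ≤ x′ × x′ ≤ a + s →
    (x - x′) * (x - x′) ≤ s * s
  gap-in-interval {a} {s} {x} {x′} (p , q) (p′ , q′) = square-mono
    (linear₂ q p′ (solve 4 (λ a s x x′ → (a :+ s :- x) :+ (x′ :- a) := s :- (x :- x′)) refl a s x x′))
    (linear₂ p q′ (solve 4 (λ a s x x′ → (x :- a) :+ (a :+ s :- x′) := (x :- x′) :- :- s) refl a s x x′))

  distance-in-box : ∀ {a b s p q d} → Box a b s p → Box a b s q → IsDistance p q d →
    d * d ≤ s * s + s * s
  distance-in-box (px , py) (qx , qy) (_ , e) =
    ≤-respˡ (sym e) (+-mono-≤ (gap-in-interval px qx) (gap-in-interval py qy))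

  diameter-nonneg : ∀ {o d} → IsDiameter o d → 0# ≤ d
  diameter-nonneg {o} (bound , _) with Object.nonempty o
  ... | p , p∈ with distance p p
  ...   | d , δ = ≤-trans (proj₁ δ) (bound d (p , p , p∈ , p∈ , δ))

  nonexpansive≤diameter : ∀ {f o d p q} → Nonexpansive f → IsDiameter o d →
    Contains o p → Contains o q → f p ≤ f q + d
  nonexpansive≤diameter {f} {o} {d} {p} {q} f-ne (bound , _) p∈ q∈ with distance p q
  ... | e , δ = linear₂ (f-ne {p} {q} δ) (bound e (p , q , p∈ , q∈ , δ))
    (solve 4 (λ a b d e → (e :- (a :- b)) :+ (d :- e) := (b :+ d) :- a) refl (f p) (f q) d e)

  diameter≤√2size : ∀ {o d s √2} → IsSqrt (1# + 1#) √2 → IsDiameter o d → IsSize o s → d ≤ √2 * s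
  diameter≤√2size {o} {d} {s} {√2} (0≤√2 , e) (_ , least) ((0≤s , a , b , inBox) , _) =
    least (√2 * s) λ { d′ (p , q , p∈ , q∈ , δ) → square-cancel-≤ (*-nonneg 0≤√2 0≤s)
      (≤-respʳ eq (distance-in-box (inBox p p∈) (inBox q q∈) δ)) }
    where
    eq : s * s + s * s ≈ √2 * s * (√2 * s)
    eq = trans (solve 1 (λ s → s :* s :+ s :* s := (con (1 , 0) :+ con (1 , 0)) :* (s :* s)) refl s)
      (trans (*-congʳ (sym e))
        (solve 2 (λ s r → r :* r :* (s :* s) := r :* s :* (r :* s)) refl s √2))

  negated : ∀ {x y} → - x ≤ - y → y ≤ x
  negated {x} {y} p = linear₁ p (solve 2 (λ x y → :- y :- :- x := x :- y) refl x y)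

  max : ∀ x y → ∃[ m ] (x ≤ m × y ≤ m × (∀ z → x ≤ z → y ≤ z → m ≤ z))
  max x y with ≤-total x y
  ... | inj₁ p = y , p , ≤-refl , λ z _ q → q
  ... | inj₂ p = x , ≤-refl , p , λ z q _ → q

  -- The size is the longer side of the bounding box, attained by the square with the same lower
  -- left corner. No enclosing square is smaller, as it contains the four extreme points.
  extents⇒size : ∀ {o p q u v} →
    Contains o p → (∀ z → Contains o z → proj₁ p ≤ proj₁ z) →
    Contains o q → (∀ z → Contains o z → proj₁ z ≤ proj₁ q) →
    Contains o u → (∀ z → Contains o z → proj₂ u ≤ proj₂ z) →
    Contains o v → (∀ z → Contains o z → proj₂ z ≤ proj₂ v) →
    ∃ (IsSize o)
  extents⇒size {o} {l , _} {r , _} {_ , b} {_ , t} l∈ l-min r∈ r-max b∈ b-min t∈ t-max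
    with max (r - l) (t - b)
  ... | s , w≤s , h≤s , s-least =
    s , (0≤s , l , b , λ p p∈ →
          (l-min p p∈ , within w≤s (r-max p p∈)) , (b-min p p∈ , within h≤s (t-max p p∈)))
      , λ { s′ (0≤s′ , a′ , b′ , inBox) → s-least s′
            (linear₂ (proj₁ (proj₁ (inBox _ l∈))) (proj₂ (proj₁ (inBox _ r∈))) (gap a′ s′ l r))
            (linear₂ (proj₁ (proj₂ (inBox _ b∈))) (proj₂ (proj₂ (inBox _ t∈))) (gap b′ s′ b t)) }
    where
    0≤s : 0# ≤ s
    0≤s = ≤-trans (0≤difference (l-min _ r∈)) w≤s
    within : ∀ {s u v z} → v - u ≤ s → z ≤ v → z ≤ u + s
    within {s} {u} {v} {z} p q = linear₂ p q
      (solve 4 (λ s u v z → (s :- (v :- u)) :+ (v :- z) := u :+ s :- z) refl s u v z)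
    gap : ∀ a s u v → (u - a) + (a + s - v) ≈ s - (v - u)
    gap = solve 4 (λ a s u v → (u :- a) :+ (a :+ s :- v) := s :- (v :- u)) refl

  -- Completeness asks only for some upper bound of the distances; twice the side is one and avoids
  -- the root in the length of the diagonal.
  size⇒diameter : ∀ {o s} → IsSize o s → ∃ (IsDiameter o)
  size⇒diameter {o} {s} ((0≤s , a , b , inBox) , _) = complete Distances inhabited (s + s , bound)
    where
    Distances : ℝ → Set
    Distances d = ∃[ p ] ∃[ q ] (Contains o p × Contains o q × IsDistance p q d)

    inhabited : ∃ Distances
    inhabited with Object.nonempty o
    ... | p , p∈ with distance p p
    ...   | d , δ = d , p , p , p∈ , p∈ , δ

    bound : UpperBound Distances (s + s)
    bound d (p , q , p∈ , q∈ , δ) = square-cancel-≤ (0≤-+ 0≤s 0≤s)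
      (≤-trans (distance-in-box (inBox p p∈) (inBox q q∈) δ)
        (linear₂ (0≤square s) (0≤square s)
          (solve 1 (λ s → (s :* s :- con (0 , 0)) :+ (s :* s :- con (0 , 0))
                      := (s :+ s) :* (s :+ s) :- (s :* s :+ s :* s)) refl s)))

  -- Fatness of columns and existence of extents

  module _ (em : ExcludedMiddle 0ℓ) where

    -- Boxes are stacked from below. At most `c` of the objects meet the lowest box; any other
    -- object has its witness above that box, since the witness lies in the same column, and
    -- induction applies. The count starts at one box because a column of height zero still contains
    -- a segment of points.
    fat-column : ∀ {n c r a} {O : Family n} → IsFat c O → 0# ≤ r → ∀ m b (I : Subset n) →
      (∀ {i j} → i ∈ I → j ∈ I → i ≢ j → ¬ Meets (Contains (O i)) (Contains (O j))) →
      (∀ {i} → i ∈ I → ∃[ s ] (IsSize (O i) s × r ≤ s)) →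
      (∀ {i} → i ∈ I → ∃[ p ] (Contains (O i) p × (a ≤ proj₁ p × proj₁ p ≤ a + r) ×
                                (b ≤ proj₂ p × proj₂ p ≤ b + fromℕ (suc m) * r))) →
      fromℕ ∣ I ∣ ≤ fromℕ (suc m) * c
    fat-column {c = c} {r} {a} fat 0≤r zero b I disjoint large meet =
      ≤-respʳ (solve 1 (λ c → c := (con (1 , 0) :+ con (0 , 0)) :* c) refl c)
        (fat r a b 0≤r I disjoint large λ i∈ →
          let (p , p∈ , xs , ys) = meet i∈ in
          p , p∈ , xs , proj₁ ys , ≤-respʳ
            (solve 2 (λ b r → b :+ (con (1 , 0) :+ con (0 , 0)) :* r := b :+ r) refl b r) (proj₂ ys))
    fat-column {c = c} {r} {a} {O} fat 0≤r (suc m) b I disjoint large meet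
      with subset-split I {λ i → Meets (Contains (O i)) (Box a b r)} (λ i → em)
    ... | J , K , e , inJ , inK =
      ≤-respˡ (sym (trans (reflexive (≡.cong fromℕ e)) (fromℕ-+ ∣ J ∣ ∣ K ∣)))
        (≤-respʳ (solve 2 (λ c k → c :+ k :* c := (con (1 , 0) :+ k) :* c) refl c (fromℕ (suc m)))
          (+-mono-≤
            (fat r a b 0≤r J (λ i∈ j∈ → disjoint (proj₁ (inJ i∈)) (proj₁ (inJ j∈)))
              (λ i∈ → large (proj₁ (inJ i∈))) (λ i∈ → proj₂ (inJ i∈)))
            (fat-column {a = a} {O} fat 0≤r m (b + r) K (λ i∈ j∈ → disjoint (proj₁ (inK i∈)) (proj₁ (inK j∈)))
              (λ i∈ → large (proj₁ (inK i∈))) meetK)))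
      where
      meetK : ∀ {i} → i ∈ K → ∃[ p ] (Contains (O i) p × (a ≤ proj₁ p × proj₁ p ≤ a + r) ×
                (b + r ≤ proj₂ p × proj₂ p ≤ b + r + fromℕ (suc m) * r))
      meetK i∈ with inK i∈
      ... | i∈I , ¬meets with meet i∈I
      ...   | p , p∈ , xs , b≤y , y≤ = p , p∈ , xs
        , ≰⇒≥ (λ y≤b+r → ¬meets (p , p∈ , xs , b≤y , y≤b+r))
        , ≤-respʳ (solve 3 (λ b r k → b :+ (con (1 , 0) :+ k) :* r := b :+ r :+ k :* r) refl b r (fromℕ (suc m))) y≤

    list-minimum : ∀ {A : Set} (f : A → ℝ) x (xs : List A) → ∃[ m ] All (λ y → f m ≤ f y) (x ∷ xs)
    list-minimum f x [] = x , ≤-refl ∷ []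
    list-minimum f x (y ∷ ys) with list-minimum f y ys
    ... | m , least with ≤-total (f x) (f m)
    ...   | inj₁ p = x , ≤-refl ∷ All.map (≤-trans p) least
    ...   | inj₂ p = m , p ∷ least

    -- Without a minimum, the open sets of points whose value exceeds that of `q`, for `q` in `S`,
    -- would cover `S`. But among the finitely many `q` of a subcover, one of least value lies in
    -- none of the chosen sets.
    compact-minimum : ∀ {f S} → Nonexpansive f → IsCompact S → ∃ S →
      ∃[ p ] (S p × (∀ q → S q → f p ≤ f q))
    compact-minimum {f} {S} f-ne compact (p₀ , p₀∈)
      with em {∃[ p ] (S p × (∀ q → S q → f p ≤ f q))}
    ... | yes min = min
    ... | no ¬min with compact {∃ S} (λ (q , _) p → ¬ f p ≤ f q) open-above covered
      where
      open-above : ∀ i → IsOpen (λ p → ¬ f p ≤ f (proj₁ i))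
      open-above (q , _) p ¬p≤q = f p - f q , ≰⇒< (difference-positive ¬p≤q) , λ p′ near p′≤q →
        near-below {f} {p} {p′} f-ne near (linear₁ p′≤q
          (solve 3 (λ a b c → b :- c := a :- (c :+ (a :- b))) refl (f p) (f q) (f p′)))
      covered : ∀ p → S p → ∃[ i ] ¬ f p ≤ f (proj₁ i)
      covered p p∈ with em {∃[ q ] (S q × ¬ f p ≤ f q)}
      ... | yes (q , q∈ , ¬p≤q) = (q , q∈) , ¬p≤q
      ... | no ¬lower = ⊥-elim (¬min (p , p∈ , λ q q∈ → minimal q q∈))
        where
        minimal : ∀ q → S q → f p ≤ f q
        minimal q q∈ with f p ≤? f q
        ... | yes r = r
        ... | no ¬r = ⊥-elim (¬lower (q , q∈ , ¬r))
    ...   | is , cover with list-minimum (f ∘ proj₁) (p₀ , p₀∈) is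
    ...     | (m , m∈) , _ ∷ least = ⊥-elim (absurd least (cover m m∈))
      where
      absurd : ∀ {is : List (∃ S)} → All (λ i → f m ≤ f (proj₁ i)) is → ¬ Any (λ i → ¬ f m ≤ f (proj₁ i)) is
      absurd (p ∷ _)  (here ¬p) = ¬p p
      absurd (_ ∷ ps) (there a) = absurd ps a

    -- The bound on the layered tree-independence number is claimed for a bare family; running the
    -- program on these operations proves it.
    basicOperations : ∀ {n} (O : Family n) → BasicOperations O
    basicOperations {n} O = record
      { xmin = λ i → proj₁ (proj₁ (left i))
      ; xmax = λ i → proj₁ (proj₁ (right i))
      ; ymin = λ i → proj₂ (proj₁ (bottom i))
      ; ymax = λ i → proj₂ (proj₁ (top i))
      ; size = λ i → proj₁ (sizeOf i)
      ; diameter = λ i → proj₁ (diameterOf i)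
      ; xmin-spec = λ i → (_ , proj₁ (proj₂ (left i))) , λ x (y , p∈) → proj₂ (proj₂ (left i)) (x , y) p∈
      ; xmax-spec = λ i → (_ , proj₁ (proj₂ (right i))) , λ x (y , p∈) → negated (proj₂ (proj₂ (right i)) (x , y) p∈)
      ; ymin-spec = λ i → (_ , proj₁ (proj₂ (bottom i))) , λ y (x , p∈) → proj₂ (proj₂ (bottom i)) (x , y) p∈
      ; ymax-spec = λ i → (_ , proj₁ (proj₂ (top i))) , λ y (x , p∈) → negated (proj₂ (proj₂ (top i)) (x , y) p∈)
      ; size-spec = λ i → proj₂ (sizeOf i)
      ; diameter-spec = λ i → proj₂ (diameterOf i)
      ; intersect? = λ i j → em
      }
      where
      Minimizer : (Point → ℝ) → Fin n → Set
      Minimizer f i = ∃[ p ] (Contains (O i) p × (∀ q → Contains (O i) q → f p ≤ f q))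

      minimizer : ∀ {f} → Nonexpansive f → ∀ i → Minimizer f i
      minimizer {f} f-ne i = compact-minimum f-ne (Object.compact (O i)) (Object.nonempty (O i))

      left : ∀ i → Minimizer proj₁ i
      left = minimizer (λ {p} {q} → x-nonexpansive {p} {q})
      right : ∀ i → Minimizer (λ p → - proj₁ p) i
      right = minimizer (λ {p} {q} → negation-nonexpansive {proj₁} (λ {p} {q} → x-nonexpansive {p} {q}) {p} {q})
      bottom : ∀ i → Minimizer proj₂ i
      bottom = minimizer (λ {p} {q} → y-nonexpansive {p} {q})
      top : ∀ i → Minimizer (λ p → - proj₂ p) i
      top = minimizer (λ {p} {q} → negation-nonexpansive {proj₂} (λ {p} {q} → y-nonexpansive {p} {q}) {p} {q})

      sizeOf : ∀ i → ∃ (IsSize (O i))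
      sizeOf i = extents⇒size {O i}
        (proj₁ (proj₂ (left i)))   (proj₂ (proj₂ (left i)))
        (proj₁ (proj₂ (right i)))  (λ q q∈ → negated (proj₂ (proj₂ (right i)) q q∈))
        (proj₁ (proj₂ (bottom i))) (proj₂ (proj₂ (bottom i)))
        (proj₁ (proj₂ (top i)))    (λ q q∈ → negated (proj₂ (proj₂ (top i)) q q∈))

      diameterOf : ∀ i → ∃ (IsDiameter (O i))
      diameterOf i = size⇒diameter {O i} (proj₂ (sizeOf i))

-- Merge sort

v₀ : ∀ {Γ a} → Tm (a ∷ Γ) a
v₀ = var (here ≡.refl)

v₁ : ∀ {Γ a b} → Tm (b ∷ a ∷ Γ) a
v₁ = var (there (here ≡.refl))

v₂ : ∀ {Γ a b c} → Tm (c ∷ b ∷ a ∷ Γ) a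
v₂ = var (there (there (here ≡.refl)))

v₃ : ∀ {Γ a b c d} → Tm (d ∷ c ∷ b ∷ a ∷ Γ) a
v₃ = var (there (there (there (here ≡.refl))))

v₄ : ∀ {Γ a b c d e} → Tm (e ∷ d ∷ c ∷ b ∷ a ∷ Γ) a
v₄ = var (there (there (there (there (here ≡.refl)))))

v₅ : ∀ {Γ a b c d e f} → Tm (f ∷ e ∷ d ∷ c ∷ b ∷ a ∷ Γ) a
v₅ = var (there (there (there (there (there (here ≡.refl))))))

v₆ : ∀ {Γ a b c d e f g} → Tm (g ∷ f ∷ e ∷ d ∷ c ∷ b ∷ a ∷ Γ) a
v₆ = var (there (there (there (there (there (there (here ≡.refl)))))))

MergeState : Ty
MergeState = list obj ⊗ list obj ⊗ list obj

PassState : Ty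
PassState = bool ⊗ list (list obj)

opaque

  -- A fold visits the last element first, so pushing what it visits would only restore the order.
  -- The visited element is therefore ignored, and heads are popped from a copy kept in the state.
  reverseStep : ∀ {Γ a} → Tm (a ∷ list obj ⊗ list obj ∷ Γ) (list obj ⊗ list obj)
  reverseStep = lcase (fst v₁) v₁ (pair v₁ (cons v₀ (snd v₃)))

  reverseLoop : ∀ {Γ} → Tm (list obj ∷ Γ) (list obj ⊗ list obj)
  reverseLoop = lfold v₀ (pair v₀ nil) reverseStep

  reverseTm : ∀ {Γ} → Tm Γ (list obj ⇒ list obj)
  reverseTm = lam (snd reverseLoop)

opaque

  -- The larger head is pushed, so descending inputs leave an ascending accumulator; hence the
  -- reversal in `mergeTm`.
  mergeStep : ∀ {Γ a} → ObjectMeasure → Tm (a ∷ MergeState ∷ Γ) MergeState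
  mergeStep key =
    lcase (fst v₁)
      (lcase (fst (snd v₁)) v₁
        (pair nil (pair v₁ (cons v₀ (snd (snd v₃))))))
      (lcase (fst (snd v₃))
        (pair v₁ (pair nil (cons v₀ (snd (snd v₃)))))
        (case (rleq (measure key v₀) (measure key v₂))
          (pair v₄ (pair (cons v₁ v₂) (cons v₃ (snd (snd v₆)))))
          (pair (cons v₃ v₄) (pair v₂ (cons v₁ (snd (snd v₆)))))))

  -- The loop runs once per element of the two lists, so that it ends with
  -- both of them exhausted.
  mergeInnerLoop mergeLoop : ∀ {Γ} → ObjectMeasure → Tm (list obj ⊗ list obj ∷ Γ) MergeState
  mergeInnerLoop key = lfold (snd v₀) (pair (fst v₀) (pair (snd v₀) nil)) (mergeStep key)
  mergeLoop key = lfold (fst v₀) (mergeInnerLoop key) (mergeStep key)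

  mergeTm : ∀ {Γ} → ObjectMeasure → Tm Γ (list obj ⊗ list obj ⇒ list obj)
  mergeTm key = lam (app reverseTm (snd (snd (mergeLoop key))))

opaque

  mergeCall : ∀ {Γ} → ObjectMeasure → Tm (list obj ∷ list (list obj) ∷ unit ∷ list obj ∷ PassState ∷ Γ) (list obj)
  mergeCall key = app (mergeTm key) (pair v₀ v₃)

  -- The flag tells whether the last list still waits for its partner.
  passStep : ∀ {Γ} → ObjectMeasure → Tm (list obj ∷ PassState ∷ Γ) PassState
  passStep key =
    case (fst v₁)
      (lcase (snd v₂)
        (pair (inl star) (cons v₁ nil))
        (pair (inr star) (cons (mergeCall key) v₁)))
      (pair (inl star) (cons v₁ (snd v₂)))

  passStart : ∀ {Γ} → Tm Γ PassState
  passStart = pair (inr star) nil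

  passLoop : ∀ {Γ} → ObjectMeasure → Tm (list (list obj) ∷ Γ) PassState
  passLoop key = lfold v₀ passStart (passStep key)

  passTm : ∀ {Γ} → ObjectMeasure → Tm Γ (list (list obj) ⇒ list (list obj))
  passTm key = lam (snd (passLoop key))

opaque

  passCall : ∀ {Γ} → ObjectMeasure → Tm (obj ∷ list (list obj) ∷ Γ) (list (list obj))
  passCall key = app (passTm key) v₁

  singletonsLoop : ∀ {Γ} → Tm (list obj ∷ Γ) (list (list obj))
  singletonsLoop = lfold v₀ nil (cons (cons v₀ nil) v₁)

  -- As many passes are made as there are objects; all but the first
  -- logarithmically many find a single list and cost a constant.
  sortLoop : ∀ {Γ} → ObjectMeasure → Tm (list obj ∷ Γ) (list (list obj))
  sortLoop key = lfold v₀ singletonsLoop (passCall key)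

  sortTm : ∀ {Γ} → ObjectMeasure → Tm Γ (list obj ⇒ list obj)
  sortTm key = lam (lcase (sortLoop key) nil v₀)

-- Rules for results and costs

record Yields {A : Set} (c : Costed A) (P : A → Set) (b : ℕ) : Set where
  constructor yields
  field
    result : P (proj₁ c)
    cost   : proj₂ c ℕ.≤ b

open Yields

-- The specified functions are all of the form `lam`, whose evaluation is a single step; the work is
-- charged to the call.
Computes : ∀ {A B : Set} → Costed (A → Costed B) → (A → B → Set) → (A → ℕ) → Set
Computes f Post bound = proj₂ f ≡ 1 × ∀ a → Yields (proj₁ f a) (Post a) (bound a)

foldList-rule : ∀ {A B : Set} {z : Costed B} {s : A → B → Costed B} (Inv : List A → B → Set) (b c : ℕ) →
  Yields z (Inv []) b → (∀ x xs y → Inv xs y → Yields (s x y) (Inv (x ∷ xs)) c) →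
  ∀ xs → Yields (foldList z s xs) (Inv xs) (b ℕ.+ length xs ℕ.* suc c)
foldList-rule Inv b c base induct [] = yields (result base) (ℕₚ.≤-trans (cost base) (ℕₚ.m≤m+n b 0))
foldList-rule Inv b c base induct (x ∷ xs) with foldList-rule Inv b c base induct xs
... | yields inv m≤ = yields (result (induct x xs _ inv))
  (ℕₚ.≤-trans (ℕₚ.+-mono-≤ m≤ (ℕ.s≤s (cost (induct x xs _ inv))))
    (ℕₚ.≤-reflexive (rearrange b (length xs ℕ.* suc c) (suc c))))
  where
  rearrange : ∀ b l c → b ℕ.+ l ℕ.+ c ≡ b ℕ.+ (c ℕ.+ l)
  rearrange = solve-∀

≤-literal : ∀ {m n} {_ : T (m ℕ.≤ᵇ n)} → m ℕ.≤ n
≤-literal {m} {n} {t} = ℕₚ.≤ᵇ⇒≤ m n t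

weaken : ∀ {A : Set} {c : Costed A} {P Q : A → Set} {b b′} →
  (∀ a → P a → Q a) → b ℕ.≤ b′ → Yields c P b → Yields c Q b′
weaken f p (yields x m≤) = yields (f _ x) (ℕₚ.≤-trans m≤ p)

n≤2^n : ∀ n → n ℕ.≤ 2 ℕ.^ n
n≤2^n zero    = ℕ.z≤n
n≤2^n (suc n) = ℕₚ.≤-trans (ℕₚ.+-mono-≤ (ℕₚ.m^n>0 2 n) (n≤2^n n)) (ℕₚ.≤-reflexive (double (2 ℕ.^ n)))
  where
  double : ∀ z → z ℕ.+ z ≡ 2 ℕ.* z
  double = solve-∀

-- Strong induction on halves, n being at most 2⌊n/2⌋ + 1. It shows that one pass more than the
-- logarithm leaves the sort with at most one list.
n<2^[1+⌊log₂n⌋] : ∀ n → n ℕ.< 2 ℕ.^ suc ⌊log₂ n ⌋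
n<2^[1+⌊log₂n⌋] = <-rec _ bound
  where
  bound : ∀ n → (∀ {m} → m ℕ.< n → m ℕ.< 2 ℕ.^ suc ⌊log₂ m ⌋) → n ℕ.< 2 ℕ.^ suc ⌊log₂ n ⌋
  bound zero          rec = ≤-literal
  bound (suc zero)    rec = ≤-literal
  bound n@(suc (suc m)) rec = begin-strict
    n                                  ≤⟨ n≤ ⟩
    suc (h ℕ.+ h)                      <⟨ ℕ.s≤s (ℕₚ.≤-reflexive (≡.sym (ℕₚ.+-suc h h))) ⟩
    suc h ℕ.+ suc h                    ≤⟨ ℕₚ.+-mono-≤ ih ih ⟩
    2 ℕ.^ ⌊log₂ n ⌋ ℕ.+ 2 ℕ.^ ⌊log₂ n ⌋ ≡⟨ double (2 ℕ.^ ⌊log₂ n ⌋) ⟩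
    2 ℕ.^ suc ⌊log₂ n ⌋                ∎
    where
    open ℕₚ.≤-Reasoning
    h : ℕ
    h = ℕ.⌊ n /2⌋
    double : ∀ z → z ℕ.+ z ≡ 2 ℕ.* z
    double = solve-∀
    n≤ : n ℕ.≤ suc (h ℕ.+ h)
    n≤ = ℕₚ.≤-trans (ℕₚ.≤-reflexive (≡.sym (ℕₚ.⌊n/2⌋+⌈n/2⌉≡n n)))
      (ℕₚ.≤-trans (ℕₚ.+-monoʳ-≤ h (ℕₚ.⌊n/2⌋-mono (ℕₚ.n≤1+n (suc n)))) (ℕₚ.≤-reflexive (ℕₚ.+-suc h h)))
    positive : 1 ℕ.≤ ⌊log₂ n ⌋
    positive = ⌊log₂⌋-mono-≤ {2} {n} (ℕ.s≤s (ℕ.s≤s ℕ.z≤n))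
    exponent : suc ⌊log₂ h ⌋ ≡ ⌊log₂ n ⌋
    exponent = ≡.trans (≡.cong suc (⌊log₂⌊n/2⌋⌋≡⌊log₂n⌋∸1 n)) (ℕₚ.m+[n∸m]≡n positive)
    ih : h ℕ.< 2 ℕ.^ ⌊log₂ n ⌋
    ih = ≡.subst (λ e → h ℕ.< 2 ℕ.^ e) exponent (rec (ℕₚ.⌊n/2⌋<n (suc m)))

module Rules (R : RealNumbers) {n : ℕ} {O : Plane.Family R n} (B : Plane.BasicOperations R O) where

  open Semantics R B

  snd-rule : ∀ {Γ a b} (p : Tm Γ (a ⊗ b)) ρ {P : Val b → Set} {k} →
    Yields (eval p ρ) (λ x → P (proj₂ x)) k → Yields (eval (snd p) ρ) P (suc k)
  snd-rule p ρ (yields x m≤) = yields x (ℕ.s≤s (ℕₚ.≤-trans (ℕₚ.≤-reflexive (ℕₚ.+-identityʳ _)) m≤))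

  fst-rule : ∀ {Γ a b} (p : Tm Γ (a ⊗ b)) ρ {P : Val a → Set} {k} →
    Yields (eval p ρ) (λ x → P (proj₁ x)) k → Yields (eval (fst p) ρ) P (suc k)
  fst-rule p ρ (yields x m≤) = yields x (ℕ.s≤s (ℕₚ.≤-trans (ℕₚ.≤-reflexive (ℕₚ.+-identityʳ _)) m≤))

  app-rule : ∀ {Γ a b} (f : Tm Γ (a ⇒ b)) (t : Tm Γ a) ρ {Post bound} {Q : Val b → Set} {k l} →
    Computes (eval f ρ) Post bound →
    Yields (eval t ρ) (λ x → (∀ y → Post x y → Q y) × bound x ℕ.≤ l) k →
    Yields (eval (app f t) ρ) Q (2 ℕ.+ (k ℕ.+ l))
  app-rule f t ρ (f-cost , f-spec) (yields (imp , b≤l) m≤) = yields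
    (imp _ (result (f-spec _)))
    (ℕ.s≤s (ℕₚ.+-mono-≤ (ℕₚ.≤-reflexive f-cost) (ℕₚ.+-mono-≤ m≤ (ℕₚ.≤-trans (cost (f-spec _)) b≤l))))

  lfold-rule : ∀ {Γ a b} (l : Tm Γ (list a)) (e : Tm Γ b) (c : Tm (a ∷ b ∷ Γ) b) ρ
    (Inv : List (Val a) → Val b → Set) (k m : ℕ) →
    Yields (eval e ρ) (Inv []) k →
    (∀ x xs y → Inv xs y → Yields (eval c (x , y , ρ)) (Inv (x ∷ xs)) m) →
    Yields (eval (lfold l e c) ρ) (Inv (proj₁ (eval l ρ)))
      (suc (proj₂ (eval l ρ) ℕ.+ (k ℕ.+ length (proj₁ (eval l ρ)) ℕ.* suc m)))
  lfold-rule l e c ρ Inv k m base induct with foldList-rule Inv k m base induct (proj₁ (eval l ρ))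
  ... | yields inv m≤ = yields inv (ℕ.s≤s (ℕₚ.+-monoʳ-≤ (proj₂ (eval l ρ)) m≤))

  let-rule : ∀ {Γ a b} (t : Tm Γ a) (u : Tm (a ∷ Γ) b) ρ {Q : Val b → Set} {k l} →
    Yields (eval t ρ) (λ v → Yields (eval u (v , ρ)) Q l) k →
    Yields (eval (app (lam u) t) ρ) Q (2 ℕ.+ (k ℕ.+ l))
  let-rule t u ρ (yields (yields q l≤) k≤) = yields q (ℕ.s≤s (ℕ.s≤s (ℕₚ.+-mono-≤ k≤ l≤)))

  pair-rule : ∀ {Γ a b} (t : Tm Γ a) (u : Tm Γ b) ρ {P : Val a → Set} {Q : Val b → Set} {k l} →
    Yields (eval t ρ) P k → Yields (eval u ρ) Q l →
    Yields (eval (pair t u) ρ) (λ (x , y) → P x × Q y) (suc (k ℕ.+ l))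
  pair-rule t u ρ (yields p k≤) (yields q l≤) =
    yields (p , q) (ℕ.s≤s (ℕₚ.+-mono-≤ k≤ (ℕₚ.≤-trans (ℕₚ.≤-reflexive (ℕₚ.+-identityʳ _)) l≤)))

-- Correctness and cost of merge sort

module Sorting (R : RealNumbers) {n : ℕ} {O : Plane.Family R n} (B : Plane.BasicOperations R O)
               (key : ObjectMeasure) where

  open RealNumbers R using (_≤_; _≤?_)
  open RealArithmetic R using (≤-trans; ≰⇒≥)
  open Semantics R B
  open Rules R B

  infix 4 _≼_
  _≼_ : Val obj → Val obj → Set
  u ≼ v = measured key u ≤ measured key v

  Descending Ascending : List (Val obj) → Set
  Descending = AllPairs (λ u v → v ≼ u)
  Ascending  = AllPairs _≼_

  -- `m` counts the ticks of the clock. The last component places everything popped below everything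
  -- left, so that pushing the next head keeps the accumulator descending.
  ReverseInv : List (Val obj) → ℕ → Val (list obj ⊗ list obj) → Set
  ReverseInv xs m (rest , acc) =
    length rest ≡ length xs ℕ.∸ m × acc ++ rest ↭ xs ×
    (Ascending xs → Ascending rest × Descending acc × All (λ a → All (a ≼_) rest) acc)

  pred-∸ : ∀ {l} k m → suc l ≡ k ℕ.∸ m → l ≡ k ℕ.∸ suc m
  pred-∸ k m e = ≡.trans (≡.cong ℕ.pred e) (ℕₚ.pred[m∸n]≡m∸[1+n] k m)

  exhausted-∸ : ∀ k m → 0 ≡ k ℕ.∸ m → 0 ≡ k ℕ.∸ suc m
  exhausted-∸ k m e = ≡.trans (≡.cong ℕ.pred e) (ℕₚ.pred[m∸n]≡m∸[1+n] k m)

  opaque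
    unfolding reverseStep

    reverseStep-spec : ∀ Γ a (x : Val a) (ρ : Env Γ) xs m st → ReverseInv xs m st →
      Yields (eval (reverseStep {a = a}) (x , st , ρ)) (ReverseInv xs (suc m)) 20
    reverseStep-spec _ _ _ _ xs m ([] , acc) (len , perm , sorted) =
      yields (exhausted-∸ (length xs) m len , perm , sorted) ≤-literal
    reverseStep-spec _ _ _ _ xs m (r ∷ rest , acc) (len , perm , sorted) =
      yields ( pred-∸ (length xs) m len
      , ↭-trans (↭-sym (shift r acc rest)) perm
      , λ asc → popped (sorted asc)) ≤-literal
      where
      popped : Ascending (r ∷ rest) × Descending acc × All (λ a → All (a ≼_) (r ∷ rest)) acc →
        Ascending rest × Descending (r ∷ acc) × All (λ a → All (a ≼_) rest) (r ∷ acc)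
      popped (r≼ ∷ asc , desc , below) = asc , All.map All.head below ∷ desc , r≼ ∷ All.map All.tail below

    reverseTm-spec : ∀ {Γ} {ρ : Env Γ} → Computes (eval reverseTm ρ)
      (λ xs ys → ys ↭ xs × (Ascending xs → Descending ys)) (λ xs → 10 ℕ.+ length xs ℕ.* 21)
    reverseTm-spec {Γ} {ρ} = ≡.refl , λ xs →
      weaken (λ _ → id) (ℕₚ.+-monoˡ-≤ _ (≤-literal {6} {10}))
        (snd-rule reverseLoop (xs , ρ)
          (weaken (finish xs) ℕₚ.≤-refl
            (lfold-rule v₀ (pair v₀ nil) reverseStep (xs , ρ) (λ done → ReverseInv xs (length done)) 3 20
              (yields (≡.refl , ↭-refl , λ asc → asc , [] , []) ≤-literal)
              (λ x done st → reverseStep-spec (list obj ∷ Γ) obj x (xs , ρ) xs (length done) st))))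
      where
      finish : ∀ xs st → ReverseInv xs (length xs) st →
        proj₂ st ↭ xs × (Ascending xs → Descending (proj₂ st))
      finish xs ([] , acc) (_ , perm , sorted) =
        ↭-trans (↭-reflexive (≡.sym (++-identityʳ acc))) perm , λ asc → proj₁ (proj₂ (sorted asc))
      finish xs (_ ∷ _ , acc) (len , _) with ≡.trans len (ℕₚ.n∸n≡0 (length xs))
      ... | ()

  MergeInv : (xs ys : List (Val obj)) → ℕ → Val MergeState → Set
  MergeInv xs ys m (xs′ , ys′ , acc) =
    length xs′ ℕ.+ length ys′ ≡ (length xs ℕ.+ length ys) ℕ.∸ m × acc ++ xs′ ++ ys′ ↭ xs ++ ys ×
    (Descending xs × Descending ys →
      Descending xs′ × Descending ys′ × Ascending acc ×
      All (λ a → All (_≼ a) xs′) acc × All (λ a → All (_≼ a) ys′) acc)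

  opaque
    unfolding mergeStep

    mergeStep-spec : ∀ Γ a (x : Val a) (ρ : Env Γ) xs ys m st → MergeInv xs ys m st →
      Yields (eval (mergeStep {a = a} key) (x , st , ρ)) (MergeInv xs ys (suc m)) 40
    mergeStep-spec _ _ _ _ xs ys m ([] , [] , acc) (len , perm , sorted) =
      yields (exhausted-∸ (length xs ℕ.+ length ys) m len , perm , sorted) ≤-literal
    mergeStep-spec _ _ _ _ xs ys m ([] , y ∷ ys′ , acc) (len , perm , sorted) =
      yields ( pred-∸ (length xs ℕ.+ length ys) m len
      , ↭-trans (↭-sym (shift y acc ys′)) perm
      , λ desc → popped (sorted desc)) ≤-literal
      where
      popped : Descending [] × Descending (y ∷ ys′) × Ascending acc ×
          All (λ a → All (_≼ a) []) acc × All (λ a → All (_≼ a) (y ∷ ys′)) acc →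
        Descending [] × Descending ys′ × Ascending (y ∷ acc) ×
          All (λ a → All (_≼ a) []) (y ∷ acc) × All (λ a → All (_≼ a) ys′) (y ∷ acc)
      popped (_ , y≽ ∷ descʸ , asc , leˣ , leʸ) =
        [] , descʸ , All.map All.head leʸ ∷ asc , [] ∷ leˣ , y≽ ∷ All.map All.tail leʸ
    mergeStep-spec _ _ _ _ xs ys m (x ∷ xs′ , [] , acc) (len , perm , sorted) =
      yields ( pred-∸ (length xs ℕ.+ length ys) m len
      , ↭-trans (↭-sym (shift x acc (xs′ ++ []))) perm
      , λ desc → popped (sorted desc)) ≤-literal
      where
      popped : Descending (x ∷ xs′) × Descending [] × Ascending acc ×
          All (λ a → All (_≼ a) (x ∷ xs′)) acc × All (λ a → All (_≼ a) []) acc →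
        Descending xs′ × Descending [] × Ascending (x ∷ acc) ×
          All (λ a → All (_≼ a) xs′) (x ∷ acc) × All (λ a → All (_≼ a) []) (x ∷ acc)
      popped (x≽ ∷ descˣ , _ , asc , leˣ , leʸ) =
        descˣ , [] , All.map All.head leˣ ∷ asc , x≽ ∷ All.map All.tail leˣ , [] ∷ leʸ
    mergeStep-spec _ _ _ _ xs ys m (x ∷ xs′ , y ∷ ys′ , acc) (len , perm , sorted)
      with measured key y ≤? measured key x
    ... | yes y≼x =
      yields ( pred-∸ (length xs ℕ.+ length ys) m len
      , ↭-trans (↭-sym (shift x acc (xs′ ++ y ∷ ys′))) perm
      , λ desc → popped (sorted desc)) ≤-literal
      where
      popped : Descending (x ∷ xs′) × Descending (y ∷ ys′) × Ascending acc ×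
          All (λ a → All (_≼ a) (x ∷ xs′)) acc × All (λ a → All (_≼ a) (y ∷ ys′)) acc →
        Descending xs′ × Descending (y ∷ ys′) × Ascending (x ∷ acc) ×
          All (λ a → All (_≼ a) xs′) (x ∷ acc) × All (λ a → All (_≼ a) (y ∷ ys′)) (x ∷ acc)
      popped (x≽ ∷ descˣ , y≽ ∷ descʸ , asc , leˣ , leʸ) =
        descˣ , y≽ ∷ descʸ , All.map All.head leˣ ∷ asc , x≽ ∷ All.map All.tail leˣ ,
        (y≼x ∷ All.map (λ p → ≤-trans p y≼x) y≽) ∷ leʸ
    ... | no y⋠x =
      yields ( pred-∸ (length xs ℕ.+ length ys) m
          (≡.trans (≡.sym (ℕₚ.+-suc (suc (length xs′)) (length ys′))) len)
      , ↭-trans (↭-trans (↭-sym (shift y acc (x ∷ xs′ ++ ys′)))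
          (++⁺ˡ acc (↭-sym (shift y (x ∷ xs′) ys′)))) perm
      , λ desc → popped (sorted desc)) ≤-literal
      where
      popped : Descending (x ∷ xs′) × Descending (y ∷ ys′) × Ascending acc ×
          All (λ a → All (_≼ a) (x ∷ xs′)) acc × All (λ a → All (_≼ a) (y ∷ ys′)) acc →
        Descending (x ∷ xs′) × Descending ys′ × Ascending (y ∷ acc) ×
          All (λ a → All (_≼ a) (x ∷ xs′)) (y ∷ acc) × All (λ a → All (_≼ a) ys′) (y ∷ acc)
      popped (x≽ ∷ descˣ , y≽ ∷ descʸ , asc , leˣ , leʸ) =
        x≽ ∷ descˣ , descʸ , All.map All.head leʸ ∷ asc ,
        (≰⇒≥ y⋠x ∷ All.map (λ p → ≤-trans p (≰⇒≥ y⋠x)) x≽) ∷ leˣ ,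
        y≽ ∷ All.map All.tail leʸ

    mergeTm-spec : ∀ {Γ} {ρ : Env Γ} → Computes (eval (mergeTm key) ρ)
      (λ (xs , ys) zs → zs ↭ xs ++ ys × (Descending xs × Descending ys → Descending zs))
      (λ (xs , ys) → 27 ℕ.+ (length xs ℕ.+ length ys) ℕ.* 62)
    mergeTm-spec {Γ} {ρ} = ≡.refl , λ (xs , ys) →
      weaken (λ _ → id) (ℕₚ.≤-reflexive (total (length xs) (length ys)))
        (app-rule reverseTm (snd (snd (mergeLoop key))) ((xs , ys) , ρ) reverseTm-spec
          (snd-rule (snd (mergeLoop key)) ((xs , ys) , ρ) (snd-rule (mergeLoop key) ((xs , ys) , ρ)
            (weaken (finish xs ys) ℕₚ.≤-refl
              (lfold-rule (fst v₀) (mergeInnerLoop key) (mergeStep key) ((xs , ys) , ρ)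
                (λ done → MergeInv xs ys (length done ℕ.+ length ys)) (10 ℕ.+ length ys ℕ.* 41) 40
                (lfold-rule (snd v₀) (pair (fst v₀) (pair (snd v₀) nil)) (mergeStep key) ((xs , ys) , ρ)
                  (λ done → MergeInv xs ys (length done)) 7 40
                  (yields (≡.refl , ↭-refl , λ (descˣ , descʸ) → descˣ , descʸ , [] , [] , []) ≤-literal)
                  (λ x done st → mergeStep-spec (list obj ⊗ list obj ∷ Γ) obj x ((xs , ys) , ρ) xs ys (length done) st))
                (λ x done st → mergeStep-spec (list obj ⊗ list obj ∷ Γ) obj x ((xs , ys) , ρ) xs ys (length done ℕ.+ length ys) st))))))
      where
      total : ∀ a b → 2 ℕ.+ ((2 ℕ.+ (3 ℕ.+ (10 ℕ.+ b ℕ.* 41 ℕ.+ a ℕ.* 41))) ℕ.+ (10 ℕ.+ (a ℕ.+ b) ℕ.* 21))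
                      ≡ 27 ℕ.+ (a ℕ.+ b) ℕ.* 62
      total = solve-∀
      finish : ∀ xs ys st → MergeInv xs ys (length xs ℕ.+ length ys) st →
        let acc = proj₂ (proj₂ st) in
        (∀ zs → zs ↭ acc × (Ascending acc → Descending zs) →
          zs ↭ xs ++ ys × (Descending xs × Descending ys → Descending zs)) ×
        10 ℕ.+ length acc ℕ.* 21 ℕ.≤ 10 ℕ.+ (length xs ℕ.+ length ys) ℕ.* 21
      finish xs ys ([] , [] , acc) (_ , perm , sorted) =
        (λ zs (zs↭acc , desc) → ↭-trans zs↭acc acc↭ , λ d → desc (proj₁ (proj₂ (proj₂ (sorted d))))) ,
        ℕₚ.+-monoʳ-≤ 10 (ℕₚ.*-monoˡ-≤ 21 (ℕₚ.≤-reflexive (≡.trans (↭-length acc↭) (length-++ xs))))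
        where
        acc↭ : acc ↭ xs ++ ys
        acc↭ = ↭-trans (↭-reflexive (≡.sym (++-identityʳ acc))) perm
      finish xs ys (_ ∷ _ , _ , acc) (len , _) with ≡.trans len (ℕₚ.n∸n≡0 (length xs ℕ.+ length ys))
      ... | ()
      finish xs ys ([] , _ ∷ _ , acc) (len , _) with ≡.trans len (ℕₚ.n∸n≡0 (length xs ℕ.+ length ys))
      ... | ()

  waiting : Val bool → ℕ
  waiting (inj₁ _) = 1
  waiting (inj₂ _) = 0

  -- The list waiting for its partner has yet to be paid for.
  credit : Val PassState → ℕ
  credit (inj₁ _ , p ∷ _) = length p
  credit _                = 0

  volume : List (List (Val obj)) → ℕ
  volume []       = 0
  volume (l ∷ ls) = length l ℕ.+ volume ls

  volume-concat : ∀ ls → volume ls ≡ length (concat ls)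
  volume-concat []       = ≡.refl
  volume-concat (l ∷ ls) = ≡.trans (≡.cong (length l ℕ.+_) (volume-concat ls)) (≡.sym (length-++ l))

  -- The invariant includes the cost instead of going through `foldList-rule`: a merge costs in
  -- proportion to the lists it joins, and no uniform bound per step would give a linear total. The
  -- factor 62 is the price per element in `mergeTm-spec`.
  record PassInv (ls : List (List (Val obj))) (c : Costed (Val PassState)) : Set where
    constructor passInv
    field
      content : concat (proj₂ (proj₁ c)) ↭ concat ls
      sorted  : All Descending ls → All Descending (proj₂ (proj₁ c))
      halved  : length (proj₂ (proj₁ c)) ℕ.* 2 ℕ.≤ length ls ℕ.+ waiting (proj₁ (proj₁ c))
      paid    : proj₂ c ℕ.+ credit (proj₁ c) ℕ.* 62 ℕ.≤ 4 ℕ.+ (length ls ℕ.* 50 ℕ.+ volume ls ℕ.* 62)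

  pay-later : ∀ m d x a b c → m ℕ.+ d ℕ.≤ 4 ℕ.+ (a ℕ.* 50 ℕ.+ b ℕ.* 62) → x ℕ.≤ 50 →
    m ℕ.+ x ℕ.+ c ℕ.* 62 ℕ.≤ 4 ℕ.+ (suc a ℕ.* 50 ℕ.+ (c ℕ.+ b) ℕ.* 62)
  pay-later m d x a b c p q = ℕₚ.≤-trans
    (ℕₚ.+-monoˡ-≤ (c ℕ.* 62) (ℕₚ.+-mono-≤ (ℕₚ.≤-trans (ℕₚ.m≤m+n m d) p) q))
    (ℕₚ.≤-reflexive (total a b c))
    where
    total : ∀ a b c → (4 ℕ.+ (a ℕ.* 50 ℕ.+ b ℕ.* 62)) ℕ.+ 50 ℕ.+ c ℕ.* 62
                      ≡ 4 ℕ.+ (suc a ℕ.* 50 ℕ.+ (c ℕ.+ b) ℕ.* 62)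
    total = solve-∀

  pay-now : ∀ m d x a b c → m ℕ.+ d ℕ.* 62 ℕ.≤ 4 ℕ.+ (a ℕ.* 50 ℕ.+ b ℕ.* 62) →
    x ℕ.≤ 32 ℕ.+ (d ℕ.+ c) ℕ.* 62 →
    m ℕ.+ suc (9 ℕ.+ (suc (x ℕ.+ 1) ℕ.+ 0)) ℕ.+ 0 ℕ.≤ 4 ℕ.+ (suc a ℕ.* 50 ℕ.+ (c ℕ.+ b) ℕ.* 62)
  pay-now m d x a b c p q = begin
    m ℕ.+ suc (9 ℕ.+ (suc (x ℕ.+ 1) ℕ.+ 0)) ℕ.+ 0         ≡⟨ shape m x ⟩
    m ℕ.+ 12 ℕ.+ x                                        ≤⟨ ℕₚ.+-monoʳ-≤ (m ℕ.+ 12) q ⟩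
    m ℕ.+ 12 ℕ.+ (32 ℕ.+ (d ℕ.+ c) ℕ.* 62)                ≡⟨ split m d c ⟩
    m ℕ.+ d ℕ.* 62 ℕ.+ (44 ℕ.+ c ℕ.* 62)                  ≤⟨ ℕₚ.+-mono-≤ p (ℕₚ.+-monoˡ-≤ (c ℕ.* 62) (≤-literal {44} {50})) ⟩
    4 ℕ.+ (a ℕ.* 50 ℕ.+ b ℕ.* 62) ℕ.+ (50 ℕ.+ c ℕ.* 62)   ≡⟨ total a b c ⟩
    4 ℕ.+ (suc a ℕ.* 50 ℕ.+ (c ℕ.+ b) ℕ.* 62)             ∎
    where
    open ℕₚ.≤-Reasoning
    shape : ∀ m x → m ℕ.+ suc (9 ℕ.+ (suc (x ℕ.+ 1) ℕ.+ 0)) ℕ.+ 0 ≡ m ℕ.+ 12 ℕ.+ x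
    shape = solve-∀
    split : ∀ m a b → m ℕ.+ 12 ℕ.+ (32 ℕ.+ (a ℕ.+ b) ℕ.* 62) ≡ m ℕ.+ a ℕ.* 62 ℕ.+ (44 ℕ.+ b ℕ.* 62)
    split = solve-∀
    total : ∀ a b c → (4 ℕ.+ (a ℕ.* 50 ℕ.+ b ℕ.* 62)) ℕ.+ (50 ℕ.+ c ℕ.* 62)
                      ≡ 4 ℕ.+ (suc a ℕ.* 50 ℕ.+ (c ℕ.+ b) ℕ.* 62)
    total = solve-∀

  opaque
    unfolding passStep

    passStep-spec : ∀ Γ (ρ : Env Γ) l ls (c : Costed (Val PassState)) → PassInv ls c →
      PassInv (l ∷ ls) (c >>= λ st → step (eval (passStep {Γ} key) (l , st , ρ)))
    passStep-spec Γ ρ l ls ((inj₁ tt , []) , m) (passInv content sorted halved paid) =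
      passInv
        (++⁺ˡ l content)
        (λ { (d ∷ ds) → d ∷ [] })
        (ℕ.s≤s (ℕₚ.m≤n+m 1 (length ls)))
        (pay-later m 0 13 (length ls) (volume ls) (length l) paid ≤-literal)
    passStep-spec Γ ρ l ls ((inj₂ tt , done) , m) (passInv content sorted halved paid) =
      passInv
        (++⁺ˡ l content)
        (λ { (d ∷ ds) → d ∷ sorted ds })
        (ℕ.s≤s (ℕₚ.≤-trans (ℕ.s≤s halved) (ℕₚ.≤-reflexive (≡.sym (ℕₚ.+-suc (length ls) 0)))))
        (pay-later m 0 11 (length ls) (volume ls) (length l) paid ≤-literal)
    passStep-spec Γ ρ l ls ((inj₁ tt , p ∷ ps) , m) (passInv content sorted halved paid) =
      passInv
        (↭-trans (++⁺ʳ (concat ps) (proj₁ (result merged)))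
          (↭-trans (++⁺ʳ (concat ps) (++-comm p l))
            (↭-trans (↭-reflexive (++-assoc l p (concat ps))) (++⁺ˡ l content))))
        (λ { (d ∷ ds) → proj₂ (result merged) (All.head (sorted ds) , d) ∷ All.tail (sorted ds) })
        (ℕₚ.≤-trans halved (ℕₚ.≤-reflexive (ℕₚ.+-suc (length ls) 0)))
        (pay-now m (length p) (proj₂ (eval (mergeCall {Γ} key) (p , ps , tt , l , (inj₁ tt , p ∷ ps) , ρ))) (length ls) (volume ls) (length l) paid (cost merged))
      where
      merged : Yields (eval (mergeCall {Γ} key) (p , ps , tt , l , (inj₁ tt , p ∷ ps) , ρ))
        (λ zs → zs ↭ p ++ l × (Descending p × Descending l → Descending zs))
        (32 ℕ.+ (length p ℕ.+ length l) ℕ.* 62)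
      merged = app-rule {Γ = list obj ∷ list (list obj) ∷ unit ∷ list obj ∷ PassState ∷ Γ} (mergeTm key) (pair v₀ v₃) (p , ps , tt , l , (inj₁ tt , p ∷ ps) , ρ) mergeTm-spec
        (yields {P = λ x → (∀ zs → _ → _) × _} ((λ zs q → q) , ℕₚ.≤-refl) (≤-literal {_} {3}))

    passTm-inv : ∀ Γ (ρ : Env Γ) ls →
      PassInv ls (foldList (eval (passStart {Γ}) ρ) (λ l st → eval (passStep {Γ} key) (l , st , ρ)) ls)
    passTm-inv Γ ρ []       = passInv ↭-refl (λ _ → []) ℕ.z≤n ≤-literal
    passTm-inv Γ ρ (l ∷ ls) = passStep-spec Γ ρ l ls _ (passTm-inv Γ ρ ls)

  -- A lone list is passed along unmerged, at constant cost whatever its length. Charged linearly,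
  -- the idle passes alone would add up to n².
  passBound : List (List (Val obj)) → ℕ
  passBound ls@(_ ∷ _ ∷ _) = 7 ℕ.+ (length ls ℕ.* 50 ℕ.+ volume ls ℕ.* 62)
  passBound _              = 30

  opaque
    unfolding passStep

    passTm-cost : ∀ Γ (ρ : Env Γ) ls → proj₂ (proj₁ (eval (passTm key) ρ) ls) ℕ.≤ passBound ls
    passTm-cost Γ ρ [] = ≤-literal
    passTm-cost Γ ρ (l ∷ []) = ≤-literal
    passTm-cost Γ ρ ls@(_ ∷ _ ∷ _) = ℕₚ.≤-trans (ℕₚ.≤-reflexive (ℕₚ.+-identityʳ _))
      (ℕₚ.+-monoʳ-≤ 3 (ℕₚ.≤-trans (ℕₚ.m≤m+n _ _) (PassInv.paid (passTm-inv (list (list obj) ∷ Γ) (ls , ρ) ls))))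

    passTm-spec : ∀ {Γ} {ρ : Env Γ} → Computes (eval (passTm key) ρ)
      (λ ls ls′ → concat ls′ ↭ concat ls × (All Descending ls → All Descending ls′) ×
                  length ls′ ℕ.* 2 ℕ.≤ length ls ℕ.+ 1) passBound
    passTm-spec {Γ} {ρ} = ≡.refl , λ ls →
      let inv = passTm-inv (list (list obj) ∷ Γ) (ls , ρ) ls in
      yields (PassInv.content inv , PassInv.sorted inv ,
              ℕₚ.≤-trans (PassInv.halved inv) (ℕₚ.+-monoʳ-≤ (length ls) (waiting≤1 (proj₁ (proj₁ (eval (passLoop {Γ} key) (ls , ρ)))))))
             (passTm-cost Γ ρ ls)
      where
      waiting≤1 : ∀ b → waiting b ℕ.≤ 1
      waiting≤1 (inj₁ _) = ℕₚ.≤-refl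
      waiting≤1 (inj₂ _) = ℕ.z≤n

  -- Rounding up does no harm: an even number cannot equal 2 ^ suc k + 1.
  halving : ∀ a b k → a ℕ.* 2 ℕ.≤ b ℕ.+ 1 → b ℕ.≤ 2 ℕ.^ suc k → a ℕ.≤ 2 ℕ.^ k
  halving a b k p q with a ℕ.≤? 2 ℕ.^ k
  ... | yes r = r
  ... | no ¬r = ⊥-elim (ℕₚ.<-irrefl ≡.refl (begin-strict
    2 ℕ.^ suc k ℕ.+ 1      <⟨ ℕₚ.≤-refl ⟩
    suc (2 ℕ.^ suc k ℕ.+ 1) ≡⟨ shape (2 ℕ.^ k) ⟩
    suc (2 ℕ.^ k) ℕ.* 2    ≤⟨ ℕₚ.*-monoˡ-≤ 2 (ℕₚ.≰⇒> ¬r) ⟩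
    a ℕ.* 2                ≤⟨ p ⟩
    b ℕ.+ 1                ≤⟨ ℕₚ.+-monoˡ-≤ 1 q ⟩
    2 ℕ.^ suc k ℕ.+ 1      ∎))
    where
    open ℕₚ.≤-Reasoning
    shape : ∀ z → suc (2 ℕ.* z ℕ.+ 1) ≡ suc z ℕ.* 2
    shape = solve-∀

  -- `i` counts the passes made, and `L` is the number of passes allowed to take linear time. Those
  -- are charged 112 per object, namely 50 per list and 62 per element, on top of the 34 units of an
  -- idle pass. In `halved` the exponent `j` is arbitrary, so that a pass can move one unit from `j`
  -- to `i`.
  record SortInv (xs : List (Val obj)) (L i : ℕ) (c : Costed (List (List (Val obj)))) : Set where
    constructor sortInv
    field
      content : concat (proj₁ c) ↭ xs
      sorted  : All Descending (proj₁ c)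
      few     : length (proj₁ c) ℕ.≤ length xs
      halved  : ∀ j → length xs ℕ.≤ 2 ℕ.^ (i ℕ.+ j) → length (proj₁ c) ℕ.≤ 2 ℕ.^ j
      paid    : proj₂ c ℕ.≤ 4 ℕ.+ length xs ℕ.* 7 ℕ.+ (i ℕ.* 34 ℕ.+ (i ⊓ L) ℕ.* (length xs ℕ.* 112))

  few-after-pass : ∀ a b n → a ℕ.* 2 ℕ.≤ b ℕ.+ 1 → b ℕ.≤ n → a ℕ.≤ n
  few-after-pass zero    b n p q = ℕ.z≤n
  few-after-pass (suc a) b n p q = ℕₚ.≤-trans (ℕₚ.≤-trans (ℕ.s≤s (ℕₚ.m≤m*n a 2))
    (ℕ.s≤s⁻¹ (ℕₚ.≤-trans p (ℕₚ.≤-reflexive (ℕₚ.+-comm b 1))))) q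

  passBound≤ : ∀ xs ls → concat ls ↭ xs → length ls ℕ.≤ length xs → passBound ls ℕ.≤ 30 ℕ.+ length xs ℕ.* 112
  passBound≤ xs [] _ _ = ℕₚ.m≤m+n 30 _
  passBound≤ xs (_ ∷ []) _ _ = ℕₚ.m≤m+n 30 _
  passBound≤ xs ls@(_ ∷ _ ∷ _) perm few = begin
    7 ℕ.+ (length ls ℕ.* 50 ℕ.+ volume ls ℕ.* 62)      ≤⟨ ℕₚ.+-mono-≤ (≤-literal {7} {30}) (ℕₚ.+-mono-≤ (ℕₚ.*-monoˡ-≤ 50 few)
                                                          (ℕₚ.*-monoˡ-≤ 62 (ℕₚ.≤-reflexive (≡.trans (volume-concat ls) (↭-length perm))))) ⟩
    30 ℕ.+ (length xs ℕ.* 50 ℕ.+ length xs ℕ.* 62)     ≡⟨ shape (length xs) ⟩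
    30 ℕ.+ length xs ℕ.* 112                           ∎
    where
    open ℕₚ.≤-Reasoning
    shape : ∀ a → 30 ℕ.+ (a ℕ.* 50 ℕ.+ a ℕ.* 62) ≡ 30 ℕ.+ a ℕ.* 112
    shape = solve-∀

  passBound-single : ∀ ls → length ls ℕ.≤ 1 → passBound ls ℕ.≤ 30
  passBound-single [] _ = ℕₚ.≤-refl
  passBound-single (_ ∷ []) _ = ℕₚ.≤-refl
  passBound-single (_ ∷ _ ∷ _) (ℕ.s≤s ())

  opaque
    unfolding sortTm

    sort-pass : ∀ Γ (ρ : Env Γ) xs L → length xs ℕ.≤ 2 ℕ.^ L → ∀ i (x : Val obj) c → SortInv xs L i c →
      SortInv xs L (suc i) (c >>= λ ls → step (eval (passCall {Γ} key) (x , ls , ρ)))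
    sort-pass Γ ρ xs L xs≤ i x (ls , m) (sortInv content sorted few halved paid) =
      sortInv
        (↭-trans (proj₁ (result passed)) content)
        (proj₁ (proj₂ (result passed)) sorted)
        (few-after-pass _ (length ls) (length xs) (proj₂ (proj₂ (result passed))) few)
        (λ j p → halving _ (length ls) j (proj₂ (proj₂ (result passed)))
                   (halved (suc j) (ℕₚ.≤-trans p (ℕₚ.≤-reflexive (≡.cong (2 ℕ.^_) (≡.sym (ℕₚ.+-suc i j)))))))
        (pay (i ℕ.<? L))
      where
      passed : Yields (eval (passCall {Γ} key) (x , ls , ρ))
        (λ ls′ → concat ls′ ↭ concat ls × (All Descending ls → All Descending ls′) ×
                  length ls′ ℕ.* 2 ℕ.≤ length ls ℕ.+ 1) (3 ℕ.+ passBound ls)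
      passed = app-rule {Γ = obj ∷ list (list obj) ∷ Γ} (passTm key) v₁ (x , ls , ρ) passTm-spec
        (yields {P = λ x → (∀ zs → _ → _) × _} ((λ zs q → q) , ℕₚ.≤-refl) (≤-literal {_} {1}))
      base N : ℕ
      base = 4 ℕ.+ length xs ℕ.* 7
      N = length xs ℕ.* 112
      open ℕₚ.≤-Reasoning
      pay : Dec (i ℕ.< L) → m ℕ.+ suc (proj₂ (eval (passCall {Γ} key) (x , ls , ρ)))
        ℕ.≤ base ℕ.+ (suc i ℕ.* 34 ℕ.+ (suc i ⊓ L) ℕ.* N)
      pay (yes i<L) = begin
        m ℕ.+ suc (proj₂ (eval (passCall {Γ} key) (x , ls , ρ)))  ≤⟨ ℕₚ.+-mono-≤ paid (ℕ.s≤s (ℕₚ.≤-trans (cost passed) (ℕₚ.+-monoʳ-≤ 3 (passBound≤ xs ls content few)))) ⟩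
        base ℕ.+ (i ℕ.* 34 ℕ.+ (i ⊓ L) ℕ.* N) ℕ.+ (4 ℕ.+ (30 ℕ.+ N)) ≡⟨ ≡.cong (λ z → base ℕ.+ (i ℕ.* 34 ℕ.+ z ℕ.* N) ℕ.+ (4 ℕ.+ (30 ℕ.+ N))) (ℕₚ.m≤n⇒m⊓n≡m (ℕₚ.<⇒≤ i<L)) ⟩
        base ℕ.+ (i ℕ.* 34 ℕ.+ i ℕ.* N) ℕ.+ (4 ℕ.+ (30 ℕ.+ N))       ≡⟨ shape base i N ⟩
        base ℕ.+ (suc i ℕ.* 34 ℕ.+ suc i ℕ.* N)                      ≡⟨ ≡.cong (λ z → base ℕ.+ (suc i ℕ.* 34 ℕ.+ z ℕ.* N)) (≡.sym (ℕₚ.m≤n⇒m⊓n≡m i<L)) ⟩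
        base ℕ.+ (suc i ℕ.* 34 ℕ.+ (suc i ⊓ L) ℕ.* N)                ∎
        where
        shape : ∀ b i N → b ℕ.+ (i ℕ.* 34 ℕ.+ i ℕ.* N) ℕ.+ (4 ℕ.+ (30 ℕ.+ N)) ≡ b ℕ.+ (suc i ℕ.* 34 ℕ.+ suc i ℕ.* N)
        shape = solve-∀
      pay (no i≮L) = begin
        m ℕ.+ suc (proj₂ (eval (passCall {Γ} key) (x , ls , ρ)))  ≤⟨ ℕₚ.+-mono-≤ paid (ℕ.s≤s (ℕₚ.≤-trans (cost passed) (ℕₚ.+-monoʳ-≤ 3 (passBound-single ls single)))) ⟩
        base ℕ.+ (i ℕ.* 34 ℕ.+ (i ⊓ L) ℕ.* N) ℕ.+ 34                 ≡⟨ ≡.cong (λ z → base ℕ.+ (i ℕ.* 34 ℕ.+ z ℕ.* N) ℕ.+ 34) (ℕₚ.m≥n⇒m⊓n≡n L≤i) ⟩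
        base ℕ.+ (i ℕ.* 34 ℕ.+ L ℕ.* N) ℕ.+ 34                       ≡⟨ shape base i (L ℕ.* N) ⟩
        base ℕ.+ (suc i ℕ.* 34 ℕ.+ L ℕ.* N)                          ≡⟨ ≡.cong (λ z → base ℕ.+ (suc i ℕ.* 34 ℕ.+ z ℕ.* N)) (≡.sym (ℕₚ.m≥n⇒m⊓n≡n (ℕₚ.m≤n⇒m≤1+n L≤i))) ⟩
        base ℕ.+ (suc i ℕ.* 34 ℕ.+ (suc i ⊓ L) ℕ.* N)                ∎
        where
        L≤i : L ℕ.≤ i
        L≤i = ℕₚ.≮⇒≥ i≮L
        single : length ls ℕ.≤ 1
        single = halved 0 (ℕₚ.≤-trans xs≤ (ℕₚ.^-monoʳ-≤ 2 (ℕₚ.≤-trans L≤i (ℕₚ.m≤m+n i 0))))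
        shape : ∀ b i N → b ℕ.+ (i ℕ.* 34 ℕ.+ N) ℕ.+ 34 ≡ b ℕ.+ (suc i ℕ.* 34 ℕ.+ N)
        shape = solve-∀

    singletons-spec : ∀ Γ (ρ : Env Γ) xs → Yields (eval (singletonsLoop {Γ}) (xs , ρ))
      (_≡ map (_∷ []) xs) (4 ℕ.+ length xs ℕ.* 7)
    singletons-spec Γ ρ xs = weaken (λ _ → id) (ℕₚ.+-monoˡ-≤ _ (≤-literal {3} {4}))
      (lfold-rule {Γ = list obj ∷ Γ} {obj} {list (list obj)} v₀ nil (cons (cons v₀ nil) v₁) (xs , ρ) (λ done ls → ls ≡ map (_∷ []) done) 1 6
        (yields ≡.refl ≤-literal) (λ { x done _ ≡.refl → yields ≡.refl ≤-literal }))

    sortLoop-inv : ∀ Γ (ρ : Env Γ) xs L → length xs ℕ.≤ 2 ℕ.^ L → ∀ done → SortInv xs L (length done)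
      (foldList (eval (singletonsLoop {Γ}) (xs , ρ))
        (λ x ls → eval (passCall {list obj ∷ Γ} key) (x , ls , xs , ρ)) done)
    sortLoop-inv Γ ρ xs L xs≤ [] = start (singletons-spec Γ ρ xs)
      where
      start : ∀ {c} → Yields c (_≡ map (_∷ []) xs) (4 ℕ.+ length xs ℕ.* 7) → SortInv xs L 0 c
      start (yields ≡.refl m≤) = sortInv (↭-reflexive (concat-map-[_] xs)) (singletons xs)
        (ℕₚ.≤-reflexive (length-map _ xs)) (λ j p → ℕₚ.≤-trans (ℕₚ.≤-reflexive (length-map _ xs)) p)
        (ℕₚ.≤-trans m≤ (ℕₚ.m≤m+n _ _))
        where
        singletons : ∀ xs → All Descending (map (_∷ []) xs)
        singletons []       = []
        singletons (x ∷ xs) = ([] ∷ []) ∷ singletons xs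
    sortLoop-inv Γ ρ xs L xs≤ (x ∷ done) =
      sort-pass (list obj ∷ Γ) (xs , ρ) xs L xs≤ (length done) x
        (foldList (eval (singletonsLoop {Γ}) (xs , ρ))
          (λ x ls → eval (passCall {list obj ∷ Γ} key) (x , ls , xs , ρ)) done)
        (sortLoop-inv Γ ρ xs L xs≤ done)

    sortTm-spec : ∀ {Γ} {ρ : Env Γ} → Computes (eval (sortTm key) ρ)
      (λ xs ys → ys ↭ xs × Descending ys)
      (λ xs → 8 ℕ.+ length xs ℕ.* 41 ℕ.+ suc ⌊log₂ length xs ⌋ ℕ.* (length xs ℕ.* 112))
    sortTm-spec {Γ} {ρ} = ≡.refl , λ xs → finish xs (eval (sortLoop {Γ} key) (xs , ρ))
      (sortLoop-inv Γ ρ xs (suc ⌊log₂ length xs ⌋) (ℕₚ.<⇒≤ (n<2^[1+⌊log₂n⌋] (length xs))) xs)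
      where
      finish : ∀ xs (c : Costed (List (List (Val obj)))) →
        -- The invariant measures the fold alone; the two units removed are the step of `lfold`
        -- itself and that of the variable folded over.
        SortInv xs (suc ⌊log₂ length xs ⌋) (length xs) (proj₁ c , proj₂ c ℕ.∸ 2) →
        Yields (step (c >>= branchList (eval {Γ = list obj ∷ Γ} {list obj} nil (xs , ρ))
                 (λ y ys → eval {Γ = list obj ∷ list (list obj) ∷ list obj ∷ Γ} v₀ (y , ys , xs , ρ))))
          (λ ys → ys ↭ xs × Descending ys)
          (8 ℕ.+ length xs ℕ.* 41 ℕ.+ suc ⌊log₂ length xs ⌋ ℕ.* (length xs ℕ.* 112))
      finish xs (ls , m) (sortInv content sorted few halved paid) =
        go ls content sorted (halved 0 (ℕₚ.≤-trans (n≤2^n (length xs)) (ℕₚ.^-monoʳ-≤ 2 (ℕₚ.m≤m+n (length xs) 0))))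
        where
        open ℕₚ.≤-Reasoning
        N L : ℕ
        N = length xs
        L = suc ⌊log₂ length xs ⌋
        total : suc (m ℕ.+ 1) ℕ.≤ 8 ℕ.+ N ℕ.* 41 ℕ.+ L ℕ.* (N ℕ.* 112)
        total = begin
          suc (m ℕ.+ 1)                 ≡⟨ ≡.cong suc (ℕₚ.+-comm m 1) ⟩
          2 ℕ.+ m                       ≤⟨ ℕₚ.+-monoʳ-≤ 2 (ℕₚ.m≤n+m∸n m 2) ⟩
          4 ℕ.+ (m ℕ.∸ 2)               ≤⟨ ℕₚ.+-monoʳ-≤ 4 paid ⟩
          4 ℕ.+ (4 ℕ.+ N ℕ.* 7 ℕ.+ (N ℕ.* 34 ℕ.+ (N ⊓ L) ℕ.* (N ℕ.* 112)))
            ≤⟨ ℕₚ.+-monoʳ-≤ 4 (ℕₚ.+-monoʳ-≤ (4 ℕ.+ N ℕ.* 7) (ℕₚ.+-monoʳ-≤ (N ℕ.* 34) (ℕₚ.*-monoˡ-≤ (N ℕ.* 112) (ℕₚ.m⊓n≤n N L)))) ⟩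
          4 ℕ.+ (4 ℕ.+ N ℕ.* 7 ℕ.+ (N ℕ.* 34 ℕ.+ L ℕ.* (N ℕ.* 112)))
            ≡⟨ shape N (L ℕ.* (N ℕ.* 112)) ⟩
          8 ℕ.+ N ℕ.* 41 ℕ.+ L ℕ.* (N ℕ.* 112) ∎
          where
          shape : ∀ a b → 4 ℕ.+ (4 ℕ.+ a ℕ.* 7 ℕ.+ (a ℕ.* 34 ℕ.+ b)) ≡ 8 ℕ.+ a ℕ.* 41 ℕ.+ b
          shape = solve-∀
        go : ∀ ls → concat ls ↭ xs → All Descending ls → length ls ℕ.≤ 1 →
          Yields (step ((ls , m) >>= branchList (eval {Γ = list obj ∷ Γ} {list obj} nil (xs , ρ))
                   (λ y ys → eval {Γ = list obj ∷ list (list obj) ∷ list obj ∷ Γ} v₀ (y , ys , xs , ρ))))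
            (λ ys → ys ↭ xs × Descending ys) (8 ℕ.+ N ℕ.* 41 ℕ.+ L ℕ.* (N ℕ.* 112))
        go []           perm _        _ = yields (perm , []) total
        go (l ∷ [])     perm (d ∷ []) _ = yields (↭-trans (↭-reflexive (≡.sym (++-identityʳ l))) perm , d) total
        go (_ ∷ _ ∷ _)  _    _        (ℕ.s≤s ())

-- Sweeping

StripTy SweepTy : Ty
StripTy = real ⊗ list (obj ⊗ nat)
SweepTy = list obj ⊗ (real ⊗ nat)

opaque

  -- An interval ends before its counter runs out, so the counter changes no
  -- bag; it only bounds how often an object is carried over.
  carryStep : ∀ {Γ} → (key end : ObjectMeasure) →
    Tm (obj ⊗ nat ∷ list (obj ⊗ nat) ∷ unit ∷ StripTy ∷ list StripTy ∷ obj ∷ Γ) (list (obj ⊗ nat))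
  carryStep key end =
    ncase (snd v₀) v₁
      (case (rleq (measure key v₆) (measure end (fst v₁)))
        (cons (pair (fst v₂) v₁) v₃)
        v₃)

  carryLoop : ∀ {Γ} → (key end : ObjectMeasure) →
    Tm (unit ∷ StripTy ∷ list StripTy ∷ obj ∷ Γ) (list (obj ⊗ nat))
  carryLoop key end = lfold (snd v₁) nil (carryStep key end)

opaque

  -- The fold starts at the end of a descending list, hence at the smallest key, and the newest
  -- strip heads the result. Only that strip is compared with and carried from: older strips end
  -- before it starts, and an interval that meets both an older strip and the next one contains its
  -- start.
  sweepStep : ∀ {Γ} → (key end : ObjectMeasure) →
    Tm (obj ∷ list StripTy ∷ SweepTy ∷ Γ) (list StripTy)
  sweepStep key end =
    lcase v₁
      (cons (pair (measure key v₀) (cons (pair v₀ (snd (snd v₂))) nil)) nil)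
      (case (rleq (measure key v₂) (radd (fst v₀) (fst (snd v₄))))
        (cons (pair (fst v₁) (cons (pair v₃ (snd (snd v₅))) (snd v₁))) v₂)
        (cons (pair (measure key v₃) (cons (pair v₃ (snd (snd v₅))) (carryLoop key end))) v₄))

opaque

  stripsLoop : ∀ {Γ} → (key end : ObjectMeasure) → Tm (SweepTy ∷ Γ) (list StripTy)
  stripsLoop key end = lfold (app (sortTm key) (fst v₀)) nil (sweepStep key end)

  forgetLoop : ∀ {Γ} → Tm (StripTy ∷ list (list obj) ∷ Γ) (list obj)
  forgetLoop = lfold (snd v₀) nil (cons (fst v₀) v₁)

  sweepTm : ∀ {Γ} → (key end : ObjectMeasure) → Tm Γ (SweepTy ⇒ list (list obj))
  sweepTm key end = lam (lfold (stripsLoop key end) nil (cons forgetLoop v₁))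

-- Cost of the sweep

module Sweeping (R : RealNumbers) {n : ℕ} {O : Plane.Family R n} (B : Plane.BasicOperations R O)
                (key end : ObjectMeasure) where

  open RealNumbers R hiding (zero)
  open RealArithmetic R
  open Semantics R B
  open Rules R B
  open Sorting R B key

  Strip : Set
  Strip = Carrier × List (Val obj × ℕ)

  carry : Carrier → List (Val obj × ℕ) → List (Val obj × ℕ)
  carry t [] = []
  carry t ((v , zero)  ∷ es) = carry t es
  carry t ((v , suc f) ∷ es) with t ≤? measured end v
  ... | yes _ = (v , f) ∷ carry t es
  ... | no  _ = carry t es

  insert : Carrier → ℕ → Val obj → List Strip → List Strip
  insert w f x [] = (measured key x , (x , f) ∷ []) ∷ []
  insert w f x ((t , es) ∷ ss) with measured key x ≤? t + w
  ... | yes _ = (t , (x , f) ∷ es) ∷ ss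
  ... | no  _ = (measured key x , (x , f) ∷ carry (measured key x) es) ∷ (t , es) ∷ ss

  strips : Carrier → ℕ → List (Val obj) → List Strip
  strips w f = foldr (insert w f) []

  members : Strip → List (Val obj)
  members (_ , es) = map proj₁ es

  fuel : List (Val obj × ℕ) → ℕ
  fuel []             = 0
  fuel ((_ , f) ∷ es) = f ℕ.+ fuel es

  entries : List Strip → ℕ
  entries []              = 0
  entries ((_ , es) ∷ ss) = length es ℕ.+ entries ss

  current : List Strip → List (Val obj × ℕ)
  current []             = []
  current ((_ , es) ∷ _) = es

  -- An object enters strips at most once per unit of fuel.
  carry-fuel : ∀ t es → length (carry t es) ℕ.+ fuel (carry t es) ℕ.≤ fuel es
  carry-fuel t [] = ℕ.z≤n
  carry-fuel t ((v , zero)  ∷ es) = carry-fuel t es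
  carry-fuel t ((v , suc f) ∷ es) with t ≤? measured end v
  ... | yes _ = ℕ.s≤s (ℕₚ.≤-trans (ℕₚ.≤-reflexive (shape (length (carry t es)) f (fuel (carry t es))))
                  (ℕₚ.+-monoʳ-≤ f (carry-fuel t es)))
    where
    shape : ∀ a f b → a ℕ.+ (f ℕ.+ b) ≡ f ℕ.+ (a ℕ.+ b)
    shape = solve-∀
  ... | no  _ = ℕₚ.≤-trans (carry-fuel t es) (ℕₚ.m≤n+m (fuel es) (suc f))

  -- The fuel left in the current strip is a potential that pays for the entries made by carrying; a
  -- new object adds one entry and `f` units. Summed over the sweep this bounds all entries by
  -- counting alone.
  insert-fuel : ∀ w f x ss → entries (insert w f x ss) ℕ.+ fuel (current (insert w f x ss))
                              ℕ.≤ suc f ℕ.+ (entries ss ℕ.+ fuel (current ss))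
  insert-fuel w f x [] = ℕₚ.≤-refl
  insert-fuel w f x ((t , es) ∷ ss) with measured key x ≤? t + w
  ... | yes _ = ℕₚ.≤-reflexive (shape (length es) (entries ss) f (fuel es))
    where
    shape : ∀ a b f c → suc a ℕ.+ b ℕ.+ (f ℕ.+ c) ≡ suc f ℕ.+ (a ℕ.+ b ℕ.+ c)
    shape = solve-∀
  ... | no  _ = ℕₚ.≤-trans (ℕₚ.≤-reflexive (shape (length c) (length es) (entries ss) f (fuel c)))
                  (ℕₚ.+-monoʳ-≤ (suc f) (ℕₚ.≤-trans (ℕₚ.+-monoʳ-≤ (length es ℕ.+ entries ss) (carry-fuel (measured key x) es)) ℕₚ.≤-refl))
    where
    c : List (Val obj × ℕ)
    c = carry (measured key x) es
    shape : ∀ a e s f d → suc a ℕ.+ (e ℕ.+ s) ℕ.+ (f ℕ.+ d) ≡ suc f ℕ.+ (e ℕ.+ s ℕ.+ (a ℕ.+ d))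
    shape = solve-∀

  strips-fuel : ∀ w f xs → entries (strips w f xs) ℕ.+ fuel (current (strips w f xs)) ℕ.≤ length xs ℕ.* suc f
  strips-fuel w f []       = ℕ.z≤n
  strips-fuel w f (x ∷ xs) = ℕₚ.≤-trans (insert-fuel w f x (strips w f xs)) (ℕₚ.+-monoʳ-≤ (suc f) (strips-fuel w f xs))

  insert-count : ∀ w f x ss → length (insert w f x ss) ℕ.≤ suc (length ss)
  insert-count w f x [] = ℕₚ.≤-refl
  insert-count w f x ((t , es) ∷ ss) with measured key x ≤? t + w
  ... | yes _ = ℕₚ.n≤1+n _
  ... | no  _ = ℕₚ.≤-refl

  strips-count : ∀ w f xs → length (strips w f xs) ℕ.≤ length xs
  strips-count w f []       = ℕ.z≤n
  strips-count w f (x ∷ xs) = ℕₚ.≤-trans (insert-count w f x (strips w f xs)) (ℕ.s≤s (strips-count w f xs))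

  -- Opening a strip scans the current one, which from then on belongs to the past and is not
  -- scanned again; the growth of `past` pays for the scans.
  past : List Strip → ℕ
  past []       = 0
  past (_ ∷ ss) = entries ss

  past≤entries : ∀ ss → past ss ℕ.≤ entries ss
  past≤entries []              = ℕ.z≤n
  past≤entries ((_ , es) ∷ ss) = ℕₚ.m≤n+m (entries ss) (length es)

  opaque
    unfolding carryStep

    carryStep-spec : ∀ Γ (ρ : Env Γ) (u : ⊤) (s : Strip) (ss : List Strip) (x : Val obj) e es →
      Yields (eval (carryStep {Γ} key end) (e , carry (measured key x) es , u , s , ss , x , ρ))
        (_≡ carry (measured key x) (e ∷ es)) 20
    carryStep-spec Γ ρ u s ss x (v , zero) es = yields ≡.refl ≤-literal
    carryStep-spec Γ ρ u s ss x (v , suc f) es with measured key x ≤? measured end v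
    ... | yes _ = yields ≡.refl ≤-literal
    ... | no  _ = yields ≡.refl ≤-literal

    carryLoop-spec : ∀ Γ (ρ : Env Γ) (u : ⊤) (s : Strip) (ss : List Strip) (x : Val obj) →
      Yields (eval (carryLoop {Γ} key end) (u , s , ss , x , ρ))
        (_≡ carry (measured key x) (proj₂ s)) (4 ℕ.+ length (proj₂ s) ℕ.* 21)
    carryLoop-spec Γ ρ u s ss x =
      lfold-rule {Γ = unit ∷ StripTy ∷ list StripTy ∷ obj ∷ Γ} {obj ⊗ nat} {list (obj ⊗ nat)}
        (snd v₁) nil (carryStep key end) (u , s , ss , x , ρ)
        (λ es r → r ≡ carry (measured key x) es) 1 20 (yields ≡.refl ≤-literal)
        (λ { e es _ ≡.refl → carryStep-spec Γ ρ u s ss x e es })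

  opaque
    unfolding sweepStep

    sweepStep-spec : ∀ Γ (ρ : Env Γ) xs w f x ss →
      let c = eval (sweepStep {Γ} key end) (x , ss , (xs , w , f) , ρ) in
      proj₁ c ≡ insert w f x ss × proj₂ c ℕ.+ past ss ℕ.* 21 ℕ.≤ 40 ℕ.+ past (insert w f x ss) ℕ.* 21
    sweepStep-spec Γ ρ xs w f x [] = ≡.refl , ≤-literal
    sweepStep-spec Γ ρ xs w f x ((t , es) ∷ ss) with measured key x ≤? t + w
    ... | yes _ = ≡.refl , ℕₚ.+-monoˡ-≤ (entries ss ℕ.* 21) ≤-literal
    ... | no  _ = ≡.cong (λ z → (measured key x , (x , f) ∷ z) ∷ (t , es) ∷ ss) (result carried) , pay
      where
      carried : Yields (eval (carryLoop {list StripTy ∷ SweepTy ∷ Γ} key end)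
          (tt , (t , es) , ss , x , (t , es) ∷ ss , (xs , w , f) , ρ))
        (_≡ carry (measured key x) es) (4 ℕ.+ length es ℕ.* 21)
      carried = carryLoop-spec (list StripTy ∷ SweepTy ∷ Γ) ((t , es) ∷ ss , (xs , w , f) , ρ) tt (t , es) ss x
      c : ℕ
      c = proj₂ (eval (carryLoop {list StripTy ∷ SweepTy ∷ Γ} key end)
            (tt , (t , es) , ss , x , (t , es) ∷ ss , (xs , w , f) , ρ))
      pay : 22 ℕ.+ (c ℕ.+ 0 ℕ.+ 0 ℕ.+ 1 ℕ.+ entries ss ℕ.* 21) ℕ.≤ 40 ℕ.+ (length es ℕ.+ entries ss) ℕ.* 21
      pay = lemma c (length es) (entries ss) (cost carried)
        where
        lemma : ∀ c a b → c ℕ.≤ 4 ℕ.+ a ℕ.* 21 →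
          22 ℕ.+ (c ℕ.+ 0 ℕ.+ 0 ℕ.+ 1 ℕ.+ b ℕ.* 21) ℕ.≤ 40 ℕ.+ (a ℕ.+ b) ℕ.* 21
        lemma c a b p = begin
          22 ℕ.+ (c ℕ.+ 0 ℕ.+ 0 ℕ.+ 1 ℕ.+ b ℕ.* 21) ≡⟨ shape c b ⟩
          c ℕ.+ (23 ℕ.+ b ℕ.* 21)                   ≤⟨ ℕₚ.+-mono-≤ p (ℕₚ.+-monoˡ-≤ (b ℕ.* 21) (≤-literal {23} {36})) ⟩
          4 ℕ.+ a ℕ.* 21 ℕ.+ (36 ℕ.+ b ℕ.* 21)      ≡⟨ collect a b ⟩
          40 ℕ.+ (a ℕ.+ b) ℕ.* 21                   ∎
          where
          open ℕₚ.≤-Reasoning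
          shape : ∀ c b → 22 ℕ.+ (c ℕ.+ 0 ℕ.+ 0 ℕ.+ 1 ℕ.+ b ℕ.* 21) ≡ c ℕ.+ (23 ℕ.+ b ℕ.* 21)
          shape = solve-∀
          collect : ∀ a b → 4 ℕ.+ a ℕ.* 21 ℕ.+ (36 ℕ.+ b ℕ.* 21) ≡ 40 ℕ.+ (a ℕ.+ b) ℕ.* 21
          collect = solve-∀

  -- Of the 27 units per entry, 21 pay for its scan when the next strip opens and 6 for removing its
  -- counter.
  sweepBound : Val SweepTy → ℕ
  sweepBound (xs , w , f) = 16 ℕ.+ length xs ℕ.* 91 ℕ.+ length xs ℕ.* suc f ℕ.* 27
                              ℕ.+ suc ⌊log₂ length xs ⌋ ℕ.* (length xs ℕ.* 112)

  opaque
    unfolding sweepTm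

    strips-spec : ∀ Γ (ρ : Env Γ) xs w f ys →
      Yields (foldList (eval {Γ = SweepTy ∷ Γ} {list StripTy} nil ((xs , w , f) , ρ))
               (λ x ss → eval (sweepStep {Γ} key end) (x , ss , (xs , w , f) , ρ)) ys)
        (_≡ strips w f ys) (1 ℕ.+ length ys ℕ.* 41 ℕ.+ past (strips w f ys) ℕ.* 21)
    strips-spec Γ ρ xs w f []       = yields ≡.refl ≤-literal
    strips-spec Γ ρ xs w f (x ∷ ys) = grow _ (strips-spec Γ ρ xs w f ys)
      where
      grow : ∀ c → Yields c (_≡ strips w f ys) (1 ℕ.+ length ys ℕ.* 41 ℕ.+ past (strips w f ys) ℕ.* 21) →
        Yields (c >>= λ ss → step (eval (sweepStep {Γ} key end) (x , ss , (xs , w , f) , ρ)))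
          (_≡ strips w f (x ∷ ys)) (1 ℕ.+ length (x ∷ ys) ℕ.* 41 ℕ.+ past (strips w f (x ∷ ys)) ℕ.* 21)
      grow (_ , m) (yields ≡.refl m≤) with sweepStep-spec Γ ρ xs w f x (strips w f ys)
      ... | value , c≤ = yields value (lemma m _ (length ys) (past (strips w f ys)) (past (strips w f (x ∷ ys))) m≤ c≤)
        where
        lemma : ∀ m c a p q → m ℕ.≤ 1 ℕ.+ a ℕ.* 41 ℕ.+ p ℕ.* 21 → c ℕ.+ p ℕ.* 21 ℕ.≤ 40 ℕ.+ q ℕ.* 21 →
          m ℕ.+ suc c ℕ.≤ 1 ℕ.+ suc a ℕ.* 41 ℕ.+ q ℕ.* 21
        lemma m c a p q h₁ h₂ = begin
          m ℕ.+ suc c                                     ≤⟨ ℕₚ.+-monoˡ-≤ (suc c) h₁ ⟩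
          1 ℕ.+ a ℕ.* 41 ℕ.+ p ℕ.* 21 ℕ.+ suc c           ≡⟨ shape a p c ⟩
          2 ℕ.+ a ℕ.* 41 ℕ.+ (c ℕ.+ p ℕ.* 21)             ≤⟨ ℕₚ.+-monoʳ-≤ (2 ℕ.+ a ℕ.* 41) h₂ ⟩
          2 ℕ.+ a ℕ.* 41 ℕ.+ (40 ℕ.+ q ℕ.* 21)            ≡⟨ collect a q ⟩
          1 ℕ.+ suc a ℕ.* 41 ℕ.+ q ℕ.* 21                 ∎
          where
          open ℕₚ.≤-Reasoning
          shape : ∀ a p c → 1 ℕ.+ a ℕ.* 41 ℕ.+ p ℕ.* 21 ℕ.+ suc c ≡ 2 ℕ.+ a ℕ.* 41 ℕ.+ (c ℕ.+ p ℕ.* 21)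
          shape = solve-∀
          collect : ∀ a q → 2 ℕ.+ a ℕ.* 41 ℕ.+ (40 ℕ.+ q ℕ.* 21) ≡ 1 ℕ.+ suc a ℕ.* 41 ℕ.+ q ℕ.* 21
          collect = solve-∀

    forgetLoop-spec : ∀ Γ (ρ : Env Γ) s (gs : List (List (Val obj))) →
      Yields (eval (forgetLoop {Γ}) (s , gs , ρ)) (_≡ members s) (4 ℕ.+ length (proj₂ s) ℕ.* 6)
    forgetLoop-spec Γ ρ s gs =
      lfold-rule {Γ = StripTy ∷ list (list obj) ∷ Γ} {obj ⊗ nat} {list obj}
        (snd v₀) nil (cons (fst v₀) v₁) (s , gs , ρ) (λ es r → r ≡ map proj₁ es) 1 5
        (yields ≡.refl ≤-literal) (λ { e es _ ≡.refl → yields ≡.refl ≤-literal })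

    forget-spec : ∀ Γ (ρ : Env Γ) ss →
      Yields (foldList (eval {Γ = Γ} {list (list obj)} nil ρ)
               (λ s gs → eval {Γ = StripTy ∷ list (list obj) ∷ Γ} (cons forgetLoop v₁) (s , gs , ρ)) ss)
        (_≡ map members ss) (1 ℕ.+ length ss ℕ.* 8 ℕ.+ entries ss ℕ.* 6)
    forget-spec Γ ρ []       = yields ≡.refl ≤-literal
    forget-spec Γ ρ (s ∷ ss) = grow _ (forget-spec Γ ρ ss)
      where
      grow : ∀ c → Yields c (_≡ map members ss) (1 ℕ.+ length ss ℕ.* 8 ℕ.+ entries ss ℕ.* 6) →
        Yields (c >>= λ gs → step (eval {Γ = StripTy ∷ list (list obj) ∷ Γ} (cons forgetLoop v₁) (s , gs , ρ)))
          (_≡ map members (s ∷ ss)) (1 ℕ.+ length (s ∷ ss) ℕ.* 8 ℕ.+ entries (s ∷ ss) ℕ.* 6)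
      grow (gs , m) (yields ≡.refl m≤) with forgetLoop-spec Γ ρ s gs
      ... | yields value c≤ = yields (≡.cong (_∷ gs) value)
        (lemma m _ (length ss) (entries ss) (length (proj₂ s)) m≤ c≤)
        where
        lemma : ∀ m c a p q → m ℕ.≤ 1 ℕ.+ a ℕ.* 8 ℕ.+ p ℕ.* 6 → c ℕ.≤ 4 ℕ.+ q ℕ.* 6 →
          m ℕ.+ suc (suc (c ℕ.+ 1)) ℕ.≤ 1 ℕ.+ suc a ℕ.* 8 ℕ.+ (q ℕ.+ p) ℕ.* 6
        lemma m c a p q h₁ h₂ = begin
          m ℕ.+ suc (suc (c ℕ.+ 1))                         ≤⟨ ℕₚ.+-mono-≤ h₁ (ℕ.s≤s (ℕ.s≤s (ℕₚ.+-monoˡ-≤ 1 h₂))) ⟩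
          1 ℕ.+ a ℕ.* 8 ℕ.+ p ℕ.* 6 ℕ.+ (6 ℕ.+ q ℕ.* 6 ℕ.+ 1) ≤⟨ ℕₚ.n≤1+n _ ⟩
          suc (1 ℕ.+ a ℕ.* 8 ℕ.+ p ℕ.* 6 ℕ.+ (6 ℕ.+ q ℕ.* 6 ℕ.+ 1)) ≡⟨ shape a p q ⟩
          1 ℕ.+ suc a ℕ.* 8 ℕ.+ (q ℕ.+ p) ℕ.* 6             ∎
          where
          open ℕₚ.≤-Reasoning
          shape : ∀ a p q → suc (1 ℕ.+ a ℕ.* 8 ℕ.+ p ℕ.* 6 ℕ.+ (6 ℕ.+ q ℕ.* 6 ℕ.+ 1))
                            ≡ 1 ℕ.+ suc a ℕ.* 8 ℕ.+ (q ℕ.+ p) ℕ.* 6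
          shape = solve-∀

    sweepTm-spec : ∀ {Γ} {ρ : Env Γ} → Computes (eval (sweepTm key end) ρ)
      (λ (xs , w , f) gs → ∃[ ys ] (ys ↭ xs × Descending ys × gs ≡ map members (strips w f ys))) sweepBound
    sweepTm-spec {Γ} {ρ} = ≡.refl , λ { (xs , w , f) →
      finish xs w f (eval {Γ = SweepTy ∷ Γ} (app (sortTm key) (fst v₀)) ((xs , w , f) , ρ))
        (app-rule {Γ = SweepTy ∷ Γ} (sortTm key) (fst v₀) ((xs , w , f) , ρ) sortTm-spec
          (yields {P = λ x → (∀ zs → _ → _) × _} ((λ zs q → q) , ℕₚ.≤-refl) (≤-literal {_} {2}))) }
      where
      finish : ∀ xs w f c → Yields c (λ ys → ys ↭ xs × Descending ys)
          (4 ℕ.+ (8 ℕ.+ length xs ℕ.* 41 ℕ.+ suc ⌊log₂ length xs ⌋ ℕ.* (length xs ℕ.* 112))) →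
        Yields (step (step (c >>= foldList (eval {Γ = SweepTy ∷ Γ} {list StripTy} nil ((xs , w , f) , ρ))
                             (λ x ss → eval (sweepStep {Γ} key end) (x , ss , (xs , w , f) , ρ)))
                 >>= foldList (eval {Γ = SweepTy ∷ Γ} {list (list obj)} nil ((xs , w , f) , ρ))
                      (λ s gs → eval {Γ = StripTy ∷ list (list obj) ∷ SweepTy ∷ Γ} (cons forgetLoop v₁) (s , gs , (xs , w , f) , ρ))))
          (λ gs → ∃[ ys ] (ys ↭ xs × Descending ys × gs ≡ map members (strips w f ys))) (sweepBound (xs , w , f))
      finish xs w f (ys , m) (yields (perm , desc) m≤) = after _ (strips-spec Γ ρ xs w f ys)
        where
        after : ∀ c → Yields c (_≡ strips w f ys) (1 ℕ.+ length ys ℕ.* 41 ℕ.+ past (strips w f ys) ℕ.* 21) →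
          Yields (step (step (proj₁ c , m ℕ.+ proj₂ c)
                 >>= foldList (eval {Γ = SweepTy ∷ Γ} {list (list obj)} nil ((xs , w , f) , ρ))
                      (λ s gs → eval {Γ = StripTy ∷ list (list obj) ∷ SweepTy ∷ Γ} (cons forgetLoop v₁) (s , gs , (xs , w , f) , ρ))))
          (λ gs → ∃[ ys ] (ys ↭ xs × Descending ys × gs ≡ map members (strips w f ys))) (sweepBound (xs , w , f))
        after (_ , m′) (yields ≡.refl m′≤) with forget-spec (SweepTy ∷ Γ) ((xs , w , f) , ρ) (strips w f ys)
        ... | yields value m″≤ = yields (ys , perm , desc , value)
          (lemma m m′ _ (length xs) (length xs ℕ.* suc f) (suc ⌊log₂ length xs ⌋ ℕ.* (length xs ℕ.* 112)) m≤
            (ℕₚ.≤-trans m′≤ (ℕₚ.+-mono-≤ (ℕₚ.+-monoʳ-≤ 1 (ℕₚ.≤-reflexive (≡.cong (ℕ._* 41) len)))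
              (ℕₚ.*-monoˡ-≤ 21 (ℕₚ.≤-trans (past≤entries (strips w f ys)) entries≤))))
            (ℕₚ.≤-trans m″≤ (ℕₚ.+-mono-≤ (ℕₚ.+-monoʳ-≤ 1 (ℕₚ.*-monoˡ-≤ 8
                (ℕₚ.≤-trans (strips-count w f ys) (ℕₚ.≤-reflexive len))))
              (ℕₚ.*-monoˡ-≤ 6 entries≤))))
          where
          len : length ys ≡ length xs
          len = ↭-length perm
          entries≤ : entries (strips w f ys) ℕ.≤ length xs ℕ.* suc f
          entries≤ = ℕₚ.≤-trans (ℕₚ.m≤m+n _ _) (ℕₚ.≤-trans (strips-fuel w f ys) (ℕₚ.≤-reflexive (≡.cong (ℕ._* suc f) len)))
          lemma : ∀ m m′ m″ a e l → m ℕ.≤ 4 ℕ.+ (8 ℕ.+ a ℕ.* 41 ℕ.+ l) → m′ ℕ.≤ 1 ℕ.+ a ℕ.* 41 ℕ.+ e ℕ.* 21 →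
            m″ ℕ.≤ 1 ℕ.+ a ℕ.* 8 ℕ.+ e ℕ.* 6 →
            suc (suc (m ℕ.+ m′) ℕ.+ m″) ℕ.≤ 16 ℕ.+ a ℕ.* 91 ℕ.+ e ℕ.* 27 ℕ.+ l
          lemma m m′ m″ a e l h h′ h″ = begin
            suc (suc (m ℕ.+ m′) ℕ.+ m″) ≤⟨ ℕ.s≤s (ℕₚ.+-mono-≤ (ℕ.s≤s (ℕₚ.+-mono-≤ h h′)) h″) ⟩
            suc (suc (4 ℕ.+ (8 ℕ.+ a ℕ.* 41 ℕ.+ l) ℕ.+ (1 ℕ.+ a ℕ.* 41 ℕ.+ e ℕ.* 21)) ℕ.+ (1 ℕ.+ a ℕ.* 8 ℕ.+ e ℕ.* 6))
              ≤⟨ ℕₚ.m≤m+n _ a ⟩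
            suc (suc (4 ℕ.+ (8 ℕ.+ a ℕ.* 41 ℕ.+ l) ℕ.+ (1 ℕ.+ a ℕ.* 41 ℕ.+ e ℕ.* 21)) ℕ.+ (1 ℕ.+ a ℕ.* 8 ℕ.+ e ℕ.* 6)) ℕ.+ a
              ≡⟨ shape a e l ⟩
            16 ℕ.+ a ℕ.* 91 ℕ.+ e ℕ.* 27 ℕ.+ l ∎
            where
            open ℕₚ.≤-Reasoning
            shape : ∀ a e l → suc (suc (4 ℕ.+ (8 ℕ.+ a ℕ.* 41 ℕ.+ l) ℕ.+ (1 ℕ.+ a ℕ.* 41 ℕ.+ e ℕ.* 21)) ℕ.+ (1 ℕ.+ a ℕ.* 8 ℕ.+ e ℕ.* 6)) ℕ.+ a
                              ≡ 16 ℕ.+ a ℕ.* 91 ℕ.+ e ℕ.* 27 ℕ.+ l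
            shape = solve-∀

-- Each bag consists of the intervals [key v , end v] that meet its strip
-- [t , t + w].
record IsSweep (R : RealNumbers) {n : ℕ} (key end : Fin n → RealNumbers.Carrier R)
               (w : RealNumbers.Carrier R) (gs : List (List (Fin n))) : Set where
  constructor isSweep
  open RealNumbers R
  field
    starts : List Carrier
    apart  : AllPairs (λ t t′ → ¬ t ≤ t′ + w) starts
    bags   : Pointwise (λ t g → ∀ v → (v ∈ˡ g → key v ≤ t + w × t ≤ end v) ×
                                      (key v ≤ t + w × t ≤ end v → v ∈ˡ g)) starts gs
    home   : ∀ v → Any (λ t → t ≤ key v × key v ≤ t + w) starts

-- Correctness of the sweep

module SweepCorrectness (R : RealNumbers) {n : ℕ} {O : Plane.Family R n} (B : Plane.BasicOperations R O)
  (keyᵐ endᵐ : ObjectMeasure) (w : RealNumbers.Carrier R) (F : ℕ) where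

  open RealNumbers R hiding (zero)
  open RealArithmetic R
  open Semantics R B
  open Sorting R B keyᵐ
  open Sweeping R B keyᵐ endᵐ

  key end : Fin n → Carrier
  key = measured keyᵐ
  end = measured endᵐ

  module _ (0≤w : 0# ≤ w) (ordered : ∀ v → key v ≤ end v) (short : ∀ v → end v ≤ key v + fromℕ F * w) where

    Apart : Strip → Strip → Set
    Apart (t , _) (t′ , _) = ¬ t ≤ t′ + w

    Bag : List (Fin n) → Strip → Set
    Bag xs (t , es) = ∀ v → (v ∈ˡ map proj₁ es → v ∈ˡ xs × key v ≤ t + w × t ≤ end v) ×
                            (v ∈ˡ xs → key v ≤ t + w → t ≤ end v → v ∈ˡ map proj₁ es)

    Home : Fin n → Strip → Set
    Home v (t , _) = t ≤ key v × key v ≤ t + w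

    -- An entry with g units of fuel left has been carried over F - g times,
    -- so the current strip starts at least (F - g - 1) w after its key.
    Fuelled : Carrier → Fin n × ℕ → Set
    Fuelled t (v , g) = key v + fromℕ F * w ≤ t + fromℕ (suc g) * w

    -- The newest strip starts at a key already swept, hence not after any key to come. No key swept
    -- so far lies beyond the strip, so whether such an object meets it is decided by its end alone.
    Front : List (Fin n) → List Strip → Set
    Front xs []             = ⊤
    Front xs ((t , es) ∷ _) =
      (∃[ u ] (u ∈ˡ xs × t ≡ key u)) × All (λ v → key v ≤ t + w) xs × All (Fuelled t) es

    record Swept (xs : List (Fin n)) (ss : List Strip) : Set where
      constructor swept
      field
        apart : AllPairs Apart ss
        bags  : All (Bag xs) ss
        home  : ∀ {v} → v ∈ˡ xs → Any (Home v) ss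
        front : Front xs ss

    x≤x+w : ∀ {x} → x ≤ x + w
    x≤x+w {x} = linear₁ 0≤w (solve 2 (λ x w → w :- con (0 , 0) := x :+ w :- x) refl x w)

    carry-⊆ : ∀ t es {v} → v ∈ˡ map proj₁ (carry t es) → v ∈ˡ map proj₁ es × t ≤ end v
    carry-⊆ t ((u , zero)  ∷ es) v∈ = let (v∈es , p) = carry-⊆ t es v∈ in there v∈es , p
    carry-⊆ t ((u , suc g) ∷ es) v∈ with t ≤? end u
    carry-⊆ t ((u , suc g) ∷ es) (here ≡.refl) | yes p = here ≡.refl , p
    carry-⊆ t ((u , suc g) ∷ es) (there v∈)    | yes _ = let (v∈es , p) = carry-⊆ t es v∈ in there v∈es , p
    carry-⊆ t ((u , suc g) ∷ es) v∈            | no _  = let (v∈es , p) = carry-⊆ t es v∈ in there v∈es , p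

    -- Fuel runs out only after the interval has ended: with none left, `Fuelled` puts key + F w at
    -- or below t′ + w, hence below t, whereas by `short` no end exceeds key + F w.
    carry-⊇ : ∀ {t t′ es v} → All (Fuelled t′) es → ¬ t ≤ t′ + w →
      v ∈ˡ map proj₁ es → t ≤ end v → v ∈ˡ map proj₁ (carry t es)
    carry-⊇ {t} {t′} {(u , zero) ∷ es} (fuelled ∷ _) t≰ (here ≡.refl) t≤end = ⊥-elim (t≰
      (linear₃ t≤end (short u) fuelled
        (solve 6 (λ t t′ e k m w → (e :- t) :+ (k :+ m :- e) :+ (t′ :+ (con (1 , 0) :+ con (0 , 0)) :* w :- (k :+ m))
                    := t′ :+ w :- t) refl t t′ (end u) (key u) (fromℕ F * w) w)))
    carry-⊇ {t} {t′} {(u , zero) ∷ es} (_ ∷ fuelled) t≰ (there v∈) t≤end = carry-⊇ fuelled t≰ v∈ t≤end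
    carry-⊇ {t} {t′} {(u , suc g) ∷ es} fuelled t≰ v∈ t≤end with t ≤? end u
    carry-⊇ {t} {t′} {(u , suc g) ∷ es} fuelled t≰ (here ≡.refl) t≤end | yes _ = here ≡.refl
    carry-⊇ {t} {t′} {(u , suc g) ∷ es} (_ ∷ fuelled) t≰ (there v∈) t≤end | yes _ = there (carry-⊇ fuelled t≰ v∈ t≤end)
    carry-⊇ {t} {t′} {(u , suc g) ∷ es} fuelled t≰ (here ≡.refl) t≤end | no ¬p = ⊥-elim (¬p t≤end)
    carry-⊇ {t} {t′} {(u , suc g) ∷ es} (_ ∷ fuelled) t≰ (there v∈) t≤end | no _ = carry-⊇ fuelled t≰ v∈ t≤end

    -- The unit of fuel spent is made up for by the start of the strip, which advances by at least
    -- `w`.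
    carry-fuelled : ∀ {t t′ es} → ¬ t ≤ t′ + w → All (Fuelled t′) es → All (Fuelled t) (carry t es)
    carry-fuelled {es = []} t≰ [] = []
    carry-fuelled {es = (u , zero) ∷ es} t≰ (_ ∷ fuelled) = carry-fuelled t≰ fuelled
    carry-fuelled {t} {t′} {(u , suc g) ∷ es} t≰ (fuelled ∷ rest) with t ≤? end u
    ... | yes _ = linear₂ fuelled (≰⇒≥ t≰)
        (solve 5 (λ t t′ a g w → (t′ :+ (con (1 , 0) :+ (con (1 , 0) :+ g)) :* w :- a) :+ (t :- (t′ :+ w))
                    := t :+ (con (1 , 0) :+ g) :* w :- a) refl t t′ (key u + fromℕ F * w) (fromℕ g) w)
        ∷ carry-fuelled t≰ rest
    ... | no _ = carry-fuelled t≰ rest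

    fresh-fuelled : ∀ {t x} → key x ≤ t + w → Fuelled t (x , F)
    fresh-fuelled {t} {x} p = linear₁ p
      (solve 4 (λ t k m w → t :+ w :- k := t :+ (con (1 , 0) :+ m) :* w :- (k :+ m :* w)) refl t (key x) (fromℕ F) w)

    later-bag : ∀ {x xs s} → ¬ key x ≤ proj₁ s + w → Bag xs s → Bag (x ∷ xs) s
    later-bag far bag v =
      (λ v∈ → let (v∈xs , p) = proj₁ (bag v) v∈ in there v∈xs , p) ,
      (λ { (here ≡.refl) k≤ _ → ⊥-elim (far k≤) ; (there v∈xs) → proj₂ (bag v) v∈xs })

    insert-swept : ∀ {x xs} ss → All (_≼ x) xs → Swept xs ss → Swept (x ∷ xs) (insert w F x ss)
    insert-swept {x} {xs} [] _ (swept apart bags home front) = swept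
      ([] ∷ [])
      ((λ v → (λ { (here ≡.refl) → here ≡.refl , x≤x+w , ordered x })
            , (λ { (here ≡.refl) _ _ → here ≡.refl ; (there v∈xs) _ _ → ⊥-elim (none v∈xs) })) ∷ [])
      (λ { (here ≡.refl) → here (≤-refl , x≤x+w) ; (there v∈xs) → ⊥-elim (none v∈xs) })
      ((x , here ≡.refl , ≡.refl) , x≤x+w ∷ All.tabulate (λ v∈xs → ⊥-elim (none v∈xs)) ,
       fresh-fuelled x≤x+w ∷ [])
      where
      -- Every object swept has a home, so without strips there is none.
      none : ∀ {v} → ¬ v ∈ˡ xs
      none v∈xs with home v∈xs
      ... | ()
    insert-swept {x} {xs} ((t , es) ∷ ss) below
      (swept (aparts ∷ apart) (bag ∷ bags) home ((u , u∈xs , ≡.refl) , upper , fuelled)) with key x ≤? t + w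
    ... | yes x≤t+w = swept
      (aparts ∷ apart)
      (here-bag ∷ All.zipWith (λ {s} (far , b) → later-bag {s = s} (λ p → far (≤-trans t≤x p)) b) (aparts , bags))
      (λ { (here ≡.refl) → here (t≤x , x≤t+w) ; (there v∈xs) → reHome (home v∈xs) })
      ((u , there u∈xs , ≡.refl) , x≤t+w ∷ upper , fresh-fuelled x≤t+w ∷ fuelled)
      where
      t≤x : t ≤ key x
      t≤x = All.lookup below u∈xs
      here-bag : Bag (x ∷ xs) (t , (x , F) ∷ es)
      here-bag v =
        (λ { (here ≡.refl) → here ≡.refl , x≤t+w , ≤-trans t≤x (ordered x)
           ; (there v∈) → let (v∈xs , p) = proj₁ (bag v) v∈ in there v∈xs , p }) ,
        (λ { (here ≡.refl) _ _ → here ≡.refl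
           ; (there v∈xs) p q → there (proj₂ (bag v) v∈xs p q) })
      reHome : ∀ {v} → Any (Home v) ((t , es) ∷ ss) → Any (Home v) ((t , (x , F) ∷ es) ∷ ss)
      reHome (here p)  = here p
      reHome (there p) = there p
    ... | no x≰t+w = swept
      ((x≰t+w ∷ All.map (λ far p → far (≤-trans t≤x p)) aparts) ∷ aparts ∷ apart)
      (here-bag ∷ later-bag {s = t , es} x≰t+w bag
        ∷ All.zipWith (λ {s} (far , b) → later-bag {s = s} (λ p → far (≤-trans t≤x p)) b) (aparts , bags))
      (λ { (here ≡.refl) → here (≤-refl , x≤x+w) ; (there v∈xs) → there (home v∈xs) })
      ((x , here ≡.refl , ≡.refl) , x≤x+w ∷ All.map (λ p → ≤-trans p x≤x+w) below ,
       fresh-fuelled x≤x+w ∷ carry-fuelled x≰t+w fuelled)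
      where
      t≤x : t ≤ key x
      t≤x = All.lookup below u∈xs
      here-bag : Bag (x ∷ xs) (key x , (x , F) ∷ carry (key x) es)
      here-bag v =
        (λ { (here ≡.refl) → here ≡.refl , x≤x+w , ordered x
           ; (there v∈) → let (v∈es , p) = carry-⊆ (key x) es v∈
                              (v∈xs , _) = proj₁ (bag v) v∈es
                          in there v∈xs , ≤-trans (All.lookup below v∈xs) x≤x+w , p }) ,
        (λ { (here ≡.refl) _ _ → here ≡.refl
           -- An earlier object that reaches the new strip also reaches the current one, hence is
           -- among its entries, and carrying keeps it.
           ; (there v∈xs) _ q → there (carry-⊇ fuelled x≰t+w
               (proj₂ (bag v) v∈xs (All.lookup upper v∈xs) (≤-trans t≤x q)) q) })

    strips-swept : ∀ {xs} → Descending xs → Swept xs (strips w F xs)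
    strips-swept []           = swept [] [] (λ ()) tt
    strips-swept {_ ∷ xs} (below ∷ desc) = insert-swept (strips w F xs) below (strips-swept desc)

    sweep-correct : ∀ {xs} → Descending xs → (∀ v → v ∈ˡ xs) →
      IsSweep R key end w (map members (strips w F xs))
    sweep-correct {xs} desc all∈ with strips-swept desc
    ... | swept apart bags home _ = isSweep
      (map proj₁ (strips w F xs)) (AllPairs.map⁺ apart) (convert (strips w F xs) bags) (λ v → Any.map⁺ (home (all∈ v)))
      where
      convert : ∀ ss → All (Bag xs) ss → Pointwise (λ t g → ∀ v → (v ∈ˡ g → key v ≤ t + w × t ≤ end v) ×
                                      (key v ≤ t + w × t ≤ end v → v ∈ˡ g)) (map proj₁ ss) (map members ss)
      convert []             []           = []
      convert ((t , es) ∷ ss) (bag ∷ bags) =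
        (λ v → (λ v∈ → proj₂ (proj₁ (bag v) v∈)) , (λ (p , q) → proj₂ (bag v) (all∈ v) p q)) ∷ convert ss bags

-- Graphs

∈-⋃⁺ : ∀ {n} {v : Fin n} {l} → v ∈ˡ l → v ∈ ⋃ (map ⁅_⁆ l)
∈-⋃⁺ {v = v} (here ≡.refl) = x∈p∪q⁺ (inj₁ (x∈⁅x⁆ v))
∈-⋃⁺ (there v∈)            = x∈p∪q⁺ (inj₂ (∈-⋃⁺ v∈))

∈-⋃⁻ : ∀ {n} {v : Fin n} l → v ∈ ⋃ (map ⁅_⁆ l) → v ∈ˡ l
∈-⋃⁻ []      v∈ = ⊥-elim (∉⊥ v∈)
∈-⋃⁻ (u ∷ l) v∈ with x∈p∪q⁻ ⁅ u ⁆ (⋃ (map ⁅_⁆ l)) v∈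
... | inj₁ v∈u = here (x∈⁅y⁆⇒x≡y u v∈u)
... | inj₂ v∈l = there (∈-⋃⁻ l v∈l)

∈-layer⁻ : ∀ {n} {v : Fin n} es gs ls i → v ∈ Output.layer (output es gs ls) i →
  ∃[ j ] (toℕ j ≡ i × v ∈ˡ lookup ls j)
∈-layer⁻ es gs []       i       v∈ = ⊥-elim (∉⊥ v∈)
∈-layer⁻ es gs (l ∷ ls) zero    v∈ = zero , ≡.refl , ∈-⋃⁻ l v∈
∈-layer⁻ es gs (l ∷ ls) (suc i) v∈ with ∈-layer⁻ es gs ls i v∈
... | j , e , v∈j = suc j , ≡.cong suc e , v∈j

∈-layer⁺ : ∀ {n} {v : Fin n} es gs ls j → v ∈ˡ lookup ls j → v ∈ Output.layer (output es gs ls) (toℕ j)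
∈-layer⁺ es gs (l ∷ ls) zero    v∈ = ∈-⋃⁺ v∈
∈-layer⁺ es gs (l ∷ ls) (suc j) v∈ = ∈-layer⁺ es gs ls j v∈

IsPathEdges : ℕ → List (ℕ × ℕ) → Set
IsPathEdges m es = (∀ {a b} → (a , b) ∈ˡ es → b ≡ suc a) × (∀ {a} → a ℕ.< m → (a , suc a) ∈ˡ es)

module PathGraph {n : ℕ} (D : Output n) {m : ℕ} (size≡ : Output.nodeCount D ≡ suc m)
                 (pathEdges : IsPathEdges m (Output.treeEdges D)) where

  open Output D

  adjacent : ∀ {s t} → Adj tree s t → toℕ t ≡ suc (toℕ s) ⊎ toℕ s ≡ suc (toℕ t)
  adjacent (_ , inj₁ e) = inj₁ (proj₁ pathEdges e)
  adjacent (_ , inj₂ e) = inj₂ (proj₁ pathEdges e)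

  consecutive : ∀ {s t} → toℕ t ≡ suc (toℕ s) → Adj tree s t
  consecutive {s} {t} e = (λ { ≡.refl → ℕₚ.1+n≢n (≡.sym e) }) ,
    inj₁ (≡.subst (λ b → (toℕ s , b) ∈ˡ treeEdges) (≡.sym e)
      (proj₂ pathEdges (ℕ.s≤s⁻¹ (ℕₚ.≤-trans (ℕₚ.≤-reflexive (≡.cong suc (≡.sym e)))
        (ℕₚ.≤-trans (Finₚ.toℕ<n t) (ℕₚ.≤-reflexive size≡))))))

  Convex : Pred (Fin nodeCount) 0ℓ → Set
  Convex P = ∀ {a b c} → toℕ a ℕ.≤ toℕ b → toℕ b ℕ.≤ toℕ c → P a → P c → P b

  walk : ∀ {P} → Convex P → ∀ k s t → toℕ s ℕ.+ k ≡ toℕ t → P s → P t → Star (λ a b → P a × P b × Adj tree a b) s t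
  walk convex zero s t e Ps Pt with Finₚ.toℕ-injective (≡.trans (≡.sym (ℕₚ.+-identityʳ _)) e)
  ... | ≡.refl = Star.ε
  walk {P} convex (suc k) s t e Ps Pt = (Ps , Ps′ , consecutive s′≡) ◅ walk convex k s′ t e′ Ps′ Pt
    where
    1+s+k≡t : suc (toℕ s) ℕ.+ k ≡ toℕ t
    1+s+k≡t = ≡.trans (≡.sym (ℕₚ.+-suc (toℕ s) k)) e
    1+s≤t : suc (toℕ s) ℕ.≤ toℕ t
    1+s≤t = ℕₚ.≤-trans (ℕₚ.m≤m+n _ k) (ℕₚ.≤-reflexive 1+s+k≡t)
    1+s< : suc (toℕ s) ℕ.< nodeCount
    1+s< = ℕₚ.≤-<-trans 1+s≤t (Finₚ.toℕ<n t)
    s′ : Fin nodeCount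
    s′ = fromℕ< 1+s<
    s′≡ : toℕ s′ ≡ suc (toℕ s)
    s′≡ = Finₚ.toℕ-fromℕ< 1+s<
    e′ : toℕ s′ ℕ.+ k ≡ toℕ t
    e′ = ≡.trans (≡.cong (ℕ._+ k) s′≡) 1+s+k≡t
    Ps′ : P s′
    Ps′ = convex (ℕₚ.≤-trans (ℕₚ.n≤1+n _) (ℕₚ.≤-reflexive (≡.sym s′≡)))
                 (ℕₚ.≤-trans (ℕₚ.≤-reflexive s′≡) 1+s≤t) Ps Pt
  convex⇒connected : ∀ {P} → Convex P → ConnectedOn tree P
  convex⇒connected convex {u} {v} Pu Pv with ℕₚ.≤-total (toℕ u) (toℕ v)
  ... | inj₁ u≤v = walk convex (toℕ v ℕ.∸ toℕ u) u v (ℕₚ.m+[n∸m]≡n u≤v) Pu Pv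
  ... | inj₂ v≤u = reverse (λ (Pa , Pb , adj) → Pb , Pa , Graph.sym-Adj tree adj)
                     (walk convex (toℕ u ℕ.∸ toℕ v) v u (ℕₚ.m+[n∸m]≡n v≤u) Pv Pu)

  -- A walk that never turns back keeps moving in the direction of its first step.
  ascending-walk : ∀ a b zs e → toℕ b ≡ suc (toℕ a) → Unique (a ∷ b ∷ zs) →
    Linked (Adj tree) (a ∷ b ∷ (zs ∷ʳ e)) → toℕ a ℕ.+ length zs ℕ.≤ toℕ e
  ascending-walk a b [] e b≡ _ (_ ∷ adj ∷ _) with adjacent adj
  ... | inj₁ e≡ = ℕₚ.≤-trans (ℕₚ.≤-reflexive (ℕₚ.+-identityʳ _))
    (ℕₚ.≤-trans (ℕₚ.n≤1+n _) (ℕₚ.≤-trans (ℕₚ.≤-reflexive (≡.sym b≡)) (ℕₚ.≤-trans (ℕₚ.n≤1+n _) (ℕₚ.≤-reflexive (≡.sym e≡)))))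
  -- The last step may turn back, as `e` is not among the vertices required to be distinct; this is
  -- why the bound counts only `zs`.
  ... | inj₂ b≡′ = ℕₚ.≤-reflexive (≡.trans (ℕₚ.+-identityʳ _) (ℕₚ.suc-injective (≡.trans (≡.sym b≡) b≡′)))
  ascending-walk a b (z ∷ zs) e b≡ ((_ ∷ a≢z ∷ _) ∷ unique) (_ ∷ adj ∷ linked) with adjacent adj
  ... | inj₁ z≡ = ℕₚ.≤-trans (ℕₚ.≤-reflexive (≡.trans (ℕₚ.+-suc (toℕ a) (length zs)) (≡.cong (ℕ._+ length zs) (≡.sym b≡))))
                    (ascending-walk b z zs e z≡ unique (adj ∷ linked))
  ... | inj₂ b≡′ = ⊥-elim (a≢z (Finₚ.toℕ-injective (ℕₚ.suc-injective (≡.trans (≡.sym b≡) b≡′))))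

  descending-walk : ∀ a b zs e → toℕ a ≡ suc (toℕ b) → Unique (a ∷ b ∷ zs) →
    Linked (Adj tree) (a ∷ b ∷ (zs ∷ʳ e)) → toℕ e ℕ.+ length zs ℕ.≤ toℕ a
  descending-walk a b [] e a≡ _ (_ ∷ adj ∷ _) with adjacent adj
  ... | inj₁ e≡ = ℕₚ.≤-reflexive (≡.trans (ℕₚ.+-identityʳ _) (≡.trans e≡ (≡.sym a≡)))
  ... | inj₂ b≡ = ℕₚ.≤-trans (ℕₚ.≤-reflexive (ℕₚ.+-identityʳ _))
    (ℕₚ.≤-trans (ℕₚ.n≤1+n _) (ℕₚ.≤-trans (ℕₚ.≤-reflexive (≡.sym b≡)) (ℕₚ.≤-trans (ℕₚ.n≤1+n _) (ℕₚ.≤-reflexive (≡.sym a≡)))))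
  descending-walk a b (z ∷ zs) e a≡ ((_ ∷ a≢z ∷ _) ∷ unique) (_ ∷ adj ∷ linked) with adjacent adj
  ... | inj₁ z≡ = ⊥-elim (a≢z (Finₚ.toℕ-injective (≡.trans a≡ (≡.sym z≡))))
  ... | inj₂ b≡ = ℕₚ.≤-trans (ℕₚ.≤-reflexive (ℕₚ.+-suc (toℕ e) (length zs)))
    (ℕₚ.≤-trans (ℕ.s≤s (descending-walk b z zs e b≡ unique (adj ∷ linked))) (ℕₚ.≤-reflexive (≡.sym a≡)))

  isTree : IsTree tree
  isTree = record
    { nonempty  = ≡.subst Fin (≡.sym size≡) zero
    ; connected = convex⇒connected (λ _ _ _ _ → tt)
    ; acyclic   = acyclic
    }
    where
    acyclic : ∀ x ys → ¬ IsCycle tree x ys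
    acyclic x (y ∷ z ∷ zs) (_ , unique , linked@(adj ∷ _)) with adjacent adj
    -- The vertex `z`, granted by the length of a cycle, displaces the end of the walk from its
    -- start by at least one, yet both are `x`.
    ... | inj₁ y≡ = ℕₚ.m+1+n≰m (toℕ x) (ascending-walk x y (z ∷ zs) x y≡ unique linked)
    ... | inj₂ x≡ = ℕₚ.m+1+n≰m (toℕ x) (descending-walk x y (z ∷ zs) x x≡ unique linked)
    acyclic x []       (() , _)
    acyclic x (_ ∷ []) (ℕ.s≤s () , _)

-- Tree decompositions and layerings from sweeps

module SweptGraphs (R : RealNumbers) {n : ℕ} where

  open RealNumbers R hiding (zero)
  open RealArithmetic R

  -- Positions run against the sweep: the strip opened last comes first, so starts decrease.
  record IndexedSweep (key end : Fin n → Carrier) (w : Carrier) (gs : List (List (Fin n))) : Set where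
    field
      start   : Fin (length gs) → Carrier
      apart   : ∀ i j → toℕ i ℕ.< toℕ j → ¬ start i ≤ start j + w
      member  : ∀ i {v} → v ∈ˡ lookup gs i → key v ≤ start i + w × start i ≤ end v
      member⁻ : ∀ i {v} → key v ≤ start i + w → start i ≤ end v → v ∈ˡ lookup gs i
      home    : ∀ v → ∃[ i ] (start i ≤ key v × key v ≤ start i + w)

  index : ∀ {key end w gs} → IsSweep R key end w gs → IndexedSweep key end w gs
  index {key} {end} {w} (isSweep starts apart bags home) = record
    { start   = startAt bags
    ; apart   = apartAt bags apart
    ; member  = λ i v∈ → proj₁ (bagAt bags i _) v∈
    ; member⁻ = λ i p q → proj₂ (bagAt bags i _) (p , q)
    ; home    = λ v → homeAt bags (home v)
    }
    where
    Bags : List Carrier → List (List (Fin n)) → Set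
    Bags = Pointwise (λ t g → ∀ v → (v ∈ˡ g → key v ≤ t + w × t ≤ end v) ×
                                    (key v ≤ t + w × t ≤ end v → v ∈ˡ g))
    startAt : ∀ {ts gs} → Bags ts gs → Fin (length gs) → Carrier
    startAt (_∷_ {x = t} _ bs) zero    = t
    startAt (b ∷ bs) (suc i) = startAt bs i
    bagAt : ∀ {ts gs} (bs : Bags ts gs) i v →
      (v ∈ˡ lookup gs i → key v ≤ startAt bs i + w × startAt bs i ≤ end v) ×
      (key v ≤ startAt bs i + w × startAt bs i ≤ end v → v ∈ˡ lookup gs i)
    bagAt (b ∷ bs) zero    = b
    bagAt (b ∷ bs) (suc i) = bagAt bs i
    allAt : ∀ {ts gs} {P : Carrier → Set} (bs : Bags ts gs) → All P ts → ∀ i → P (startAt bs i)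
    allAt (b ∷ bs) (p ∷ ps) zero    = p
    allAt (b ∷ bs) (p ∷ ps) (suc i) = allAt bs ps i
    apartAt : ∀ {ts gs} (bs : Bags ts gs) → AllPairs (λ t t′ → ¬ t ≤ t′ + w) ts →
      ∀ i j → toℕ i ℕ.< toℕ j → ¬ startAt bs i ≤ startAt bs j + w
    apartAt (b ∷ bs) (far ∷ _)   zero    (suc j) _         = allAt bs far j
    apartAt (b ∷ bs) (_ ∷ apart) (suc i) (suc j) (ℕ.s≤s p) = apartAt bs apart i j p
    homeAt : ∀ {ts gs v} (bs : Bags ts gs) → Any (λ t → t ≤ key v × key v ≤ t + w) ts →
      ∃[ i ] (startAt bs i ≤ key v × key v ≤ startAt bs i + w)
    homeAt (b ∷ bs) (here p)  = zero , p
    homeAt (b ∷ bs) (there p) with homeAt bs p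
    ... | i , q = suc i , q

  module _ (G : Graph n) {key : Fin n → Carrier} {w : Carrier} (0≤w : 0# ≤ w) where

    -- An edge lies in the home bag of its endpoint with the larger key: that strip starts no later
    -- than this key, and the other interval reaches at least as far. The bags of a vertex are
    -- consecutive because, of the two conditions for meeting a strip, one is inherited by strips
    -- with larger starts and the other by strips with smaller starts.
    sweep⇒treeDecomposition : ∀ {end} es gs ls → IsSweep R key end w gs → IsPathEdges (length gs) es →
      (∀ v → key v ≤ end v) → (∀ {u v} → Adj G u v → key u ≤ end v) →
      let D = output es ([] ∷ gs) ls in IsTreeDecomposition G (Output.tree D) (Output.bag D)
    sweep⇒treeDecomposition es gs ls sweep pathEdges ordered crossing = record
      { tree     = isTree
      ; vertices = vertices
      ; edges    = edges
      ; subtrees = λ v → convex⇒connected (convex v)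
      }
      where
      D : Output n
      D = output es ([] ∷ gs) ls
      open PathGraph D ≡.refl pathEdges
      open IndexedSweep (index sweep)

      vertices : ∀ v → ∃[ t ] v ∈ Output.bag D t
      vertices v with home v
      ... | i , p , q = suc i , ∈-⋃⁺ (member⁻ i q (≤-trans p (ordered v)))

      edges : ∀ {u v} → Adj G u v → ∃[ t ] (u ∈ Output.bag D t × v ∈ Output.bag D t)
      edges {u} {v} adj with ≤-total (key u) (key v)
      ... | inj₁ u≤v with home v
      ...   | i , p , q = suc i , ∈-⋃⁺ (member⁻ i (≤-trans u≤v q) (≤-trans p (crossing (Graph.sym-Adj G adj))))
                                , ∈-⋃⁺ (member⁻ i q (≤-trans p (ordered v)))
      edges {u} {v} adj | inj₂ v≤u with home u
      ...   | i , p , q = suc i , ∈-⋃⁺ (member⁻ i q (≤-trans p (ordered u)))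
                                , ∈-⋃⁺ (member⁻ i (≤-trans v≤u q) (≤-trans p (crossing adj)))

      decreasing : ∀ i j → toℕ i ℕ.≤ toℕ j → start j ≤ start i
      decreasing i j i≤j with ℕₚ.m≤n⇒m<n∨m≡n i≤j
      ... | inj₂ e = ≤-reflexive (reflexive (≡.cong start (≡.sym (Finₚ.toℕ-injective e))))
      ... | inj₁ i<j = ≤-trans
        (linear₁ 0≤w (solve 2 (λ s w → w :- con (0 , 0) := s :+ w :- s) refl (start j) w))
        (≰⇒≥ (apart i j i<j))

      convex : ∀ v → Convex (λ t → v ∈ Output.bag D t)
      convex v {zero} {b} {c} _ _ v∈a _ = ⊥-elim (∉⊥ v∈a)
      convex v {suc a} {zero} {c} () _ _ _
      convex v {suc a} {suc b} {zero} _ () _ _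
      convex v {suc a} {suc b} {suc c} (ℕ.s≤s a≤b) (ℕ.s≤s b≤c) v∈a v∈c = ∈-⋃⁺ (member⁻ b
        (≤-trans (proj₁ (member c (∈-⋃⁻ (lookup gs c) v∈c))) (+-mono-≤ (decreasing b c b≤c) ≤-refl))
        (≤-trans (decreasing a b a≤b) (proj₂ (member a (∈-⋃⁻ (lookup gs a) v∈a)))))

    sweep⇒layering : ∀ es gs ls → IsSweep R key key w ls →
      (∀ {u v} → Adj G u v → key u ≤ key v + w) → IsLayering G (Output.layer (output es gs ls))
    sweep⇒layering es gs ls sweep near = record
      { covers   = covers
      ; disjoint = disjoint
      ; edges    = edges
      }
      where
      open IndexedSweep (index sweep)

      covers : ∀ v → ∃[ i ] v ∈ Output.layer (output es gs ls) i
      covers v with home v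
      ... | j , p , q = toℕ j , ∈-layer⁺ es gs ls j (member⁻ j q p)

      disjoint : ∀ {v i j} → v ∈ Output.layer (output es gs ls) i → v ∈ Output.layer (output es gs ls) j → i ≡ j
      disjoint {v} {i} {j} v∈i v∈j with ∈-layer⁻ es gs ls i v∈i | ∈-layer⁻ es gs ls j v∈j
      ... | a , ≡.refl , v∈a | b , ≡.refl , v∈b with ℕₚ.<-cmp (toℕ a) (toℕ b)
      ...   | tri< a<b _ _ = ⊥-elim (apart a b a<b (≤-trans (proj₂ (member a v∈a)) (proj₁ (member b v∈b))))
      ...   | tri≈ _ a≡b _ = a≡b
      ...   | tri> _ _ b<a = ⊥-elim (apart b a b<a (≤-trans (proj₂ (member b v∈b)) (proj₁ (member a v∈a))))

      -- Were there a strip `m` in between, its start would be above `key v`, while `key u` would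
      -- lie more than `w` above that start, against `near`.
      close : ∀ a b {u v} → Adj G u v → u ∈ˡ lookup ls a → v ∈ˡ lookup ls b → toℕ b ℕ.≤ suc (toℕ a)
      close a b {u} {v} adj u∈a v∈b with toℕ b ℕ.≤? suc (toℕ a)
      ... | yes p = p
      ... | no ¬p = ⊥-elim (apart a m a<m (≤-trans (proj₂ (member a u∈a)) (≤-trans (near adj)
          (+-mono-≤ (≤-trans (proj₁ (member b v∈b)) (≰⇒≥ (apart m b m<b))) ≤-refl))))
        where
        1+a<b : suc (toℕ a) ℕ.< toℕ b
        1+a<b = ℕₚ.≰⇒> ¬p
        m : Fin (length ls)
        m = fromℕ< (ℕₚ.<-trans 1+a<b (Finₚ.toℕ<n b))
        m≡ : toℕ m ≡ suc (toℕ a)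
        m≡ = Finₚ.toℕ-fromℕ< (ℕₚ.<-trans 1+a<b (Finₚ.toℕ<n b))
        a<m : toℕ a ℕ.< toℕ m
        a<m = ℕₚ.≤-reflexive (≡.sym m≡)
        m<b : toℕ m ℕ.< toℕ b
        m<b = ℕₚ.≤-trans (ℕ.s≤s (ℕₚ.≤-reflexive m≡)) 1+a<b

      edges : ∀ {u v i j} → Adj G u v → u ∈ Output.layer (output es gs ls) i →
        v ∈ Output.layer (output es gs ls) j → ℕ.∣ i - j ∣ ℕ.≤ 1
      edges {u} {v} {i} {j} adj u∈i v∈j with ∈-layer⁻ es gs ls i u∈i | ∈-layer⁻ es gs ls j v∈j
      ... | a , ≡.refl , u∈a | b , ≡.refl , v∈b =
        gap (toℕ a) (toℕ b) (close a b adj u∈a v∈b) (close b a (Graph.sym-Adj G adj) v∈b u∈a)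
        where
        gap : ∀ a b → b ℕ.≤ suc a → a ℕ.≤ suc b → ℕ.∣ a - b ∣ ℕ.≤ 1
        gap zero    b       p _ = p
        gap (suc a) zero    _ q = q
        gap (suc a) (suc b) p q = gap a b (ℕ.s≤s⁻¹ p) (ℕ.s≤s⁻¹ q)

-- Existence of the graph parameters

greatest : ∀ {ℓ} → ExcludedMiddle ℓ → (P : Pred ℕ ℓ) → ∃ P → ∀ b → (∀ m → P m → m ℕ.≤ b) → ∃ (IsGreatest ℕ._≤_ P)
greatest em P (m , Pm) zero    bound = m , Pm , λ k Pk → ℕₚ.≤-trans (bound k Pk) ℕ.z≤n
greatest em P p        (suc b) bound with em {P (suc b)}
... | yes Pb = suc b , Pb , bound
... | no ¬Pb = greatest em P p b λ m Pm → ℕ.s≤s⁻¹ (ℕₚ.≤∧≢⇒< (bound m Pm) λ { ≡.refl → ¬Pb Pm })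

-- Applied one universe up: the widths competing for the layered tree-independence number quantify
-- over graphs, which form a large type.
least : ∀ {ℓ} → ExcludedMiddle ℓ → (P : Pred ℕ ℓ) → ∀ b → P b → ∃[ m ] (IsLeast ℕ._≤_ P m × m ℕ.≤ b)
least em P b Pb = search b (b , Pb , ℕₚ.≤-refl)
  where
  search : ∀ c → ∃[ m ] (P m × m ℕ.≤ c) → ∃[ m ] (IsLeast ℕ._≤_ P m × m ℕ.≤ c)
  search zero    (_ , Pm , ℕ.z≤n) = 0 , (Pm , λ _ _ → ℕ.z≤n) , ℕ.z≤n
  search (suc c) (m , Pm , m≤1+c) with em {∃[ k ] (P k × k ℕ.≤ c)}
  ... | yes lower = let (k , k-least , k≤c) = search c lower in k , k-least , ℕₚ.m≤n⇒m≤1+n k≤c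
  ... | no none = m , (Pm , λ k Pk → ℕₚ.≤-trans m≤1+c (ℕₚ.≰⇒> λ k≤c → none (k , Pk , k≤c))) , m≤1+c

independenceNumber : ExcludedMiddle 0ℓ → ∀ {n} (G : Graph n) S → ∃ (IsIndependenceNumber G S)
independenceNumber em {n} G S = greatest em _ (0 , ∅ , empty , ∣⊥∣≡0 n)
  n λ { _ (I , _ , ≡.refl) → ∣p∣≤n I }
  where
  empty : IsIndependentIn G S ∅
  empty = (λ v∈ → ⊥-elim (∉⊥ v∈)) , λ v∈ → ⊥-elim (∉⊥ v∈)

layeredWidth : ExcludedMiddle 0ℓ → ∀ {n m} (G : Graph n) (X : Fin m → Subset n) V → Fin m → ∃ (IsLayeredWidth G X V)
layeredWidth em {n} G X V t = greatest em _
  (proj₁ (independenceNumber em G (X t ∩ V 0)) , t , 0 , proj₂ (independenceNumber em G (X t ∩ V 0)))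
  n λ { _ (_ , _ , (I , _ , ≡.refl) , _) → ∣p∣≤n I }

-- The algorithm

EdgeState : Ty
EdgeState = list (nat ⊗ nat) ⊗ nat

opaque

  numeral : ∀ {Γ} → ℕ → Tm Γ nat
  numeral zero    = ze
  numeral (suc m) = su (numeral m)

  realNumeral : ∀ {Γ} → ℕ → Tm Γ real
  realNumeral zero    = rzero
  realNumeral (suc m) = radd rone (realNumeral m)

  diameterStep : ∀ {Γ} → Tm (obj ∷ real ∷ Γ) real
  diameterStep = case (rleq (measure diameter v₀) v₁) v₂ (measure diameter v₁)

  maximumDiameter : ∀ {Γ} → Tm (list obj ∷ Γ) real
  maximumDiameter = lfold v₀ rzero diameterStep

  edgeStep : ∀ {Γ} → Tm (list obj ∷ EdgeState ∷ Γ) EdgeState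
  edgeStep = pair (cons (pair (snd v₁) (su (snd v₁))) (fst v₁)) (su (snd v₁))

  pathLoop : ∀ {Γ} → Tm (list (list obj) ∷ Γ) EdgeState
  pathLoop = lfold v₀ (pair nil ze) edgeStep

  pathTm : ∀ {Γ} → Tm (list (list obj) ∷ Γ) (list (nat ⊗ nat))
  pathTm = fst pathLoop

opaque

  -- The counters start at `M`, which is enough because no object is wider than D and `M` strips
  -- have total width 2D.
  bagArguments : ∀ {Γ} → ℕ → Tm (real ∷ list obj ∷ Γ) SweepTy
  bagArguments M = pair v₁ (pair (rmul (radd v₀ v₀) (rinv (realNumeral M))) (numeral M))

  bagsTm : ∀ {Γ} → ℕ → Tm (real ∷ list obj ∷ Γ) (list (list obj))
  bagsTm M = app (sweepTm xmin xmax) (bagArguments M)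

  -- With `ymin` as both key and end, an object belongs to its home strip only. So nothing is
  -- carried over, the counter can start at 0, and the layers form a partition.
  layersTm : ∀ {Γ} → Tm (list (list obj) ∷ real ∷ list obj ∷ Γ) (list (list obj))
  layersTm = app (sweepTm ymin ymin) (pair v₂ (pair v₁ ze))

opaque

  -- The extra empty bag keeps the tree nonempty when there are no objects.
  outputTm : ∀ {Γ} → Tm (list (list obj) ∷ real ∷ list obj ∷ Γ) OutputTy
  outputTm = pair pathTm (pair (cons nil v₀) layersTm)

  program : ℕ → Program
  program M = app (lam (app (lam outputTm) (bagsTm M))) maximumDiameter

runtime : ℕ → ℕ → ℕ → ℕ
runtime M n L = (69 ℕ.+ M ℕ.* 3) ℕ.+ n ℕ.* (266 ℕ.+ M ℕ.* 27) ℕ.+ suc L ℕ.* (n ℕ.* 224)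

-- From n = 2 on the logarithm is at least 1, so n log n absorbs the constant and linear terms and
-- `suc L` is at most 2L; the factor 783 + 30M collects the coefficients.
runtime-bound : ∀ M n → 2 ℕ.≤ n →
  runtime M n ⌊log₂ n ⌋ ℕ.≤ (783 ℕ.+ M ℕ.* 30) ℕ.* (n ℕ.* ⌊log₂ n ⌋)
runtime-bound M n 2≤n = begin
  a ℕ.+ n ℕ.* b ℕ.+ suc L ℕ.* (n ℕ.* 224)                ≤⟨ ℕₚ.+-mono-≤ (ℕₚ.+-mono-≤ (scale a 1≤nL) (ℕₚ.*-monoˡ-≤ b n≤nL))
                                                              (ℕₚ.*-monoˡ-≤ (n ℕ.* 224) (ℕₚ.+-monoˡ-≤ L 1≤L)) ⟩
  a ℕ.* (n ℕ.* L) ℕ.+ n ℕ.* L ℕ.* b ℕ.+ (L ℕ.+ L) ℕ.* (n ℕ.* 224) ≡⟨ collect M n L ⟩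
  (783 ℕ.+ M ℕ.* 30) ℕ.* (n ℕ.* L)                       ∎
  where
  open ℕₚ.≤-Reasoning
  L a b : ℕ
  L = ⌊log₂ n ⌋
  a = 69 ℕ.+ M ℕ.* 3
  b = 266 ℕ.+ M ℕ.* 27
  1≤L : 1 ℕ.≤ L
  1≤L = ⌊log₂⌋-mono-≤ {2} {n} 2≤n
  1≤nL : 1 ℕ.≤ n ℕ.* L
  1≤nL = ℕₚ.*-mono-≤ (ℕₚ.≤-trans (ℕ.s≤s ℕ.z≤n) 2≤n) 1≤L
  n≤nL : n ℕ.≤ n ℕ.* L
  n≤nL = ℕₚ.≤-trans (ℕₚ.≤-reflexive (≡.sym (ℕₚ.*-identityʳ n))) (ℕₚ.*-monoʳ-≤ n 1≤L)
  scale : ∀ a {z} → 1 ℕ.≤ z → a ℕ.≤ a ℕ.* z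
  scale a p = ℕₚ.≤-trans (ℕₚ.≤-reflexive (≡.sym (ℕₚ.*-identityʳ a))) (ℕₚ.*-monoʳ-≤ a p)
  collect : ∀ M n L → (69 ℕ.+ M ℕ.* 3) ℕ.* (n ℕ.* L) ℕ.+ n ℕ.* L ℕ.* (266 ℕ.+ M ℕ.* 27) ℕ.+ (L ℕ.+ L) ℕ.* (n ℕ.* 224)
                      ≡ (783 ℕ.+ M ℕ.* 30) ℕ.* (n ℕ.* L)
  collect = solve-∀

-- Correctness and cost of the program

module ProgramCorrectness (R : RealNumbers) {n : ℕ} {O : Plane.Family R n} (B : Plane.BasicOperations R O) where

  open RealNumbers R hiding (zero)
  open RealArithmetic R
  open Semantics R B
  open Rules R B
  open Sweeping R B using (members; strips; sweepBound; sweepTm-spec; strips-count)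
  open Sorting R B using (Descending)

  -- Taking 0 into account gives the empty family a value. Leastness is what turns the comparison of
  -- every diameter with that of `v` into D ≤ k times the diameter of `v`.
  IsMaximumDiameter : List (Fin n) → Carrier → Set
  IsMaximumDiameter xs D = 0# ≤ D × All (λ v → B.diameter v ≤ D) xs ×
    (∀ b → 0# ≤ b → All (λ v → B.diameter v ≤ b) xs → D ≤ b)

  opaque
    unfolding numeral

    numeral-spec : ∀ Γ (ρ : Env Γ) m → Yields (eval (numeral {Γ} m) ρ) (_≡ m) (suc m)
    numeral-spec Γ ρ zero = yields ≡.refl ≤-literal
    numeral-spec Γ ρ (suc m) with numeral-spec Γ ρ m
    ... | yields value m≤ = yields (≡.cong suc value) (ℕ.s≤s (ℕₚ.≤-trans (ℕₚ.≤-reflexive (ℕₚ.+-identityʳ _)) m≤))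

    realNumeral-spec : ∀ Γ (ρ : Env Γ) m → Yields (eval (realNumeral {Γ} m) ρ) (_≡ fromℕ m) (suc (m ℕ.* 2))
    realNumeral-spec Γ ρ zero = yields ≡.refl ≤-literal
    realNumeral-spec Γ ρ (suc m) with realNumeral-spec Γ ρ m
    ... | yields value m≤ = yields (≡.cong (1# +_) value)
      (ℕ.s≤s (ℕ.s≤s (ℕₚ.≤-trans (ℕₚ.≤-reflexive (ℕₚ.+-identityʳ _)) m≤)))

    diameterStep-spec : ∀ Γ (ρ : Env Γ) v D xs → IsMaximumDiameter xs D →
      Yields (eval (diameterStep {Γ}) (v , D , ρ)) (IsMaximumDiameter (v ∷ xs)) 9
    diameterStep-spec Γ ρ v D xs (0≤D , upper , least) with B.diameter v ≤? D
    ... | yes p = yields (0≤D , p ∷ upper , λ { b 0≤b (_ ∷ bound) → least b 0≤b bound }) ≤-literal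
    ... | no ¬p = yields (≤-trans 0≤D (≰⇒≥ ¬p) , ≤-refl ∷ All.map (λ q → ≤-trans q (≰⇒≥ ¬p)) upper ,
                          λ { b 0≤b (q ∷ _) → q }) ≤-literal

    maximumDiameter-spec : ∀ Γ (ρ : Env Γ) xs → Yields (eval (maximumDiameter {Γ}) (xs , ρ))
      (IsMaximumDiameter xs) (3 ℕ.+ length xs ℕ.* 10)
    maximumDiameter-spec Γ ρ xs₀ = lfold-rule {Γ = list obj ∷ Γ} {obj} {real} v₀ rzero diameterStep (xs₀ , ρ)
      IsMaximumDiameter 1 9 (yields (≤-refl , [] , λ b 0≤b _ → 0≤b) ≤-literal)
      (λ v xs D → diameterStep-spec (list obj ∷ Γ) (xs₀ , ρ) v D xs)

    pathTm-spec : ∀ Γ (ρ : Env Γ) gs → Yields (eval (pathTm {Γ}) (gs , ρ))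
      (IsPathEdges (length gs)) (6 ℕ.+ length gs ℕ.* 20)
    pathTm-spec Γ ρ gs = fst-rule pathLoop (gs , ρ) (weaken (λ _ → proj₂) ℕₚ.≤-refl
      (lfold-rule {Γ = list (list obj) ∷ Γ} {list obj} {EdgeState} v₀ (pair nil ze) edgeStep (gs , ρ)
        (λ done (es , i) → i ≡ length done × IsPathEdges (length done) es) 3 19
        (yields (≡.refl , (λ ()) , λ ()) ≤-literal)
        (λ { g done (es , _) (≡.refl , edges) → yields (≡.refl , extend edges) ≤-literal })))
      where
      extend : ∀ {i es} → IsPathEdges i es → IsPathEdges (suc i) ((i , suc i) ∷ es)
      extend {i} {es} (consecutive , all) =
        (λ { (here ≡.refl) → ≡.refl ; (there e) → consecutive e }) ,
        λ {a} a<1+i → extended (ℕₚ.m≤n⇒m<n∨m≡n (ℕ.s≤s⁻¹ a<1+i))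
        where
        extended : ∀ {a} → a ℕ.< i ⊎ a ≡ i → (a , suc a) ∈ˡ ((i , suc i) ∷ es)
        extended (inj₁ a<i)    = there (all a<i)
        extended (inj₂ ≡.refl) = here ≡.refl

  SweepOf : ObjectMeasure → ObjectMeasure → List (Fin n) → Carrier → ℕ → List (List (Fin n)) → Set
  SweepOf key end xs w f gs =
    ∃[ ys ] (ys ↭ xs × Descending key ys × gs ≡ map (members key end) (strips key end w f ys))

  stripWidth : ℕ → Carrier → Carrier
  stripWidth M D = (D + D) * fromℕ M ⁻¹

  opaque
    unfolding bagsTm

    bagArguments-spec : ∀ Γ (ρ : Env Γ) M D xs → Yields (eval (bagArguments {Γ} M) (D , xs , ρ))
      (_≡ (xs , stripWidth M D , M)) (10 ℕ.+ M ℕ.* 3)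
    bagArguments-spec Γ ρ M D xs
      with realNumeral-spec (real ∷ list obj ∷ Γ) (D , xs , ρ) M | numeral-spec (real ∷ list obj ∷ Γ) (D , xs , ρ) M
    ... | yields value c≤ | yields value′ c′≤ = yields
      (≡.cong₂ (λ x m → xs , (D + D) * x ⁻¹ , m) value value′)
      (ℕₚ.≤-trans (ℕₚ.≤-reflexive (shape (proj₂ (eval (realNumeral {real ∷ list obj ∷ Γ} M) (D , xs , ρ))) (proj₂ (eval (numeral {real ∷ list obj ∷ Γ} M) (D , xs , ρ))))) (ℕₚ.≤-trans (ℕₚ.+-monoʳ-≤ 8 (ℕₚ.+-mono-≤ c≤ c′≤)) (ℕₚ.≤-reflexive (collect M))))
      where
      shape : ∀ a b → 7 ℕ.+ (suc (a ℕ.+ 0) ℕ.+ 0 ℕ.+ (b ℕ.+ 0) ℕ.+ 0) ≡ 8 ℕ.+ (a ℕ.+ b)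
      shape = solve-∀
      collect : ∀ m → 8 ℕ.+ (suc (m ℕ.* 2) ℕ.+ suc m) ≡ 10 ℕ.+ m ℕ.* 3
      collect = solve-∀

    bagsTm-spec : ∀ Γ (ρ : Env Γ) M D xs → Yields (eval (bagsTm {Γ} M) (D , xs , ρ))
      (SweepOf xmin xmax xs (stripWidth M D) M)
      (2 ℕ.+ (10 ℕ.+ M ℕ.* 3 ℕ.+ sweepBound xmin xmax (xs , stripWidth M D , M)))
    bagsTm-spec Γ ρ M D xs = app-rule {Γ = real ∷ list obj ∷ Γ} (sweepTm xmin xmax) (bagArguments M) (D , xs , ρ)
      (sweepTm-spec xmin xmax)
      (weaken (λ { _ ≡.refl → (λ gs p → p) , ℕₚ.≤-refl }) ℕₚ.≤-refl (bagArguments-spec Γ ρ M D xs))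

    layersTm-spec : ∀ Γ (ρ : Env Γ) gs D xs → Yields (eval (layersTm {Γ}) (gs , D , xs , ρ))
      (SweepOf ymin ymin xs D 0) (2 ℕ.+ (5 ℕ.+ sweepBound ymin ymin (xs , D , 0)))
    layersTm-spec Γ ρ gs D xs = app-rule {Γ = list (list obj) ∷ real ∷ list obj ∷ Γ} (sweepTm ymin ymin)
      (pair v₂ (pair v₁ ze)) (gs , D , xs , ρ) (sweepTm-spec ymin ymin)
      (yields {P = λ x → (∀ zs → _ → _) × _} ((λ zs q → q) , ℕₚ.≤-refl) (≤-literal {_} {5}))

  ProgramResult : ℕ → Val OutputTy → Set
  ProgramResult M (es , bs , ls) = ∃[ D ] ∃[ gs ] (IsMaximumDiameter (allFin n) D × bs ≡ [] ∷ gs ×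
    IsPathEdges (length gs) es × SweepOf xmin xmax (allFin n) (stripWidth M D) M gs ×
    SweepOf ymin ymin (allFin n) D 0 ls)

  sweep-count : ∀ {key end xs w f gs} → SweepOf key end xs w f gs → length gs ℕ.≤ length xs
  sweep-count {key} {end} {xs} {w} {f} (ys , perm , _ , ≡.refl) = ℕₚ.≤-trans
    (ℕₚ.≤-reflexive (length-map _ (strips key end w f ys)))
    (ℕₚ.≤-trans (strips-count key end w f ys) (ℕₚ.≤-reflexive (↭-length perm)))

  opaque
    unfolding program

    -- `0#` stands in for the strip widths, which become known only during the run; the cost bounds
    -- are functions of lengths and counters.
    program-spec : ∀ M → Yields (eval (program M) (allFin n , tt)) (ProgramResult M)
      (2 ℕ.+ (3 ℕ.+ length (allFin n) ℕ.* 10 ℕ.+ (2 ℕ.+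
        ((2 ℕ.+ (10 ℕ.+ M ℕ.* 3 ℕ.+ sweepBound xmin xmax (allFin n , 0# , M))) ℕ.+
          suc ((6 ℕ.+ length (allFin n) ℕ.* 20) ℕ.+ suc (3 ℕ.+ (2 ℕ.+ (5 ℕ.+ sweepBound ymin ymin (allFin n , 0# , 0)))))))))
    program-spec M = let-rule {Γ = list obj ∷ []} maximumDiameter (app (lam outputTm) (bagsTm M)) (xs , tt)
      (weaken (λ D D-max → let-rule {Γ = real ∷ list obj ∷ []} (bagsTm M) outputTm (D , xs , tt)
        (weaken (λ gs bags → weaken (λ (es , bs , ls) (edges , bs≡ , layers) → D , gs , D-max , bs≡ , edges , bags , layers)
            (ℕ.s≤s (ℕₚ.+-monoˡ-≤ _ (ℕₚ.+-monoʳ-≤ 6 (ℕₚ.*-monoˡ-≤ 20 (sweep-count bags)))))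
            (pair-rule {Γ = list (list obj) ∷ real ∷ list obj ∷ []} pathTm (pair (cons nil v₀) layersTm) (gs , D , xs , tt)
              (pathTm-spec _ (D , xs , tt) gs)
              (pair-rule {Γ = list (list obj) ∷ real ∷ list obj ∷ []} (cons nil v₀) layersTm (gs , D , xs , tt)
                (yields ≡.refl (≤-literal {_} {3})) (layersTm-spec [] tt gs D xs))))
          ℕₚ.≤-refl (bagsTm-spec [] tt M D xs)))
        ℕₚ.≤-refl (maximumDiameter-spec [] tt xs))
      where
      xs : List (Fin n)
      xs = allFin n

  program-time : ∀ M → Run.time R (program M) B ℕ.≤ runtime M n ⌊log₂ n ⌋
  program-time M = ℕₚ.≤-trans (cost (program-spec M))
    (ℕₚ.≤-reflexive (≡.trans (≡.cong exact (length-tabulate {n = n} id)) (collect M n (suc ⌊log₂ n ⌋))))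
    where
    exact : ℕ → ℕ
    exact l = 2 ℕ.+ (3 ℕ.+ l ℕ.* 10 ℕ.+ (2 ℕ.+
      ((2 ℕ.+ (10 ℕ.+ M ℕ.* 3 ℕ.+ (16 ℕ.+ l ℕ.* 91 ℕ.+ l ℕ.* suc M ℕ.* 27 ℕ.+ suc ⌊log₂ l ⌋ ℕ.* (l ℕ.* 112)))) ℕ.+
        suc ((6 ℕ.+ l ℕ.* 20) ℕ.+ suc (3 ℕ.+ (2 ℕ.+ (5 ℕ.+
          (16 ℕ.+ l ℕ.* 91 ℕ.+ l ℕ.* 1 ℕ.* 27 ℕ.+ suc ⌊log₂ l ⌋ ℕ.* (l ℕ.* 112)))))))))
    collect : ∀ M l L → 2 ℕ.+ (3 ℕ.+ l ℕ.* 10 ℕ.+ (2 ℕ.+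
      ((2 ℕ.+ (10 ℕ.+ M ℕ.* 3 ℕ.+ (16 ℕ.+ l ℕ.* 91 ℕ.+ l ℕ.* suc M ℕ.* 27 ℕ.+ L ℕ.* (l ℕ.* 112)))) ℕ.+
        suc ((6 ℕ.+ l ℕ.* 20) ℕ.+ suc (3 ℕ.+ (2 ℕ.+ (5 ℕ.+
          (16 ℕ.+ l ℕ.* 91 ℕ.+ l ℕ.* 1 ℕ.* 27 ℕ.+ L ℕ.* (l ℕ.* 112)))))))))
      ≡ (69 ℕ.+ M ℕ.* 3) ℕ.+ l ℕ.* (266 ℕ.+ M ℕ.* 27) ℕ.+ L ℕ.* (l ℕ.* 224)
    collect = solve-∀

  module _ (em : ExcludedMiddle 0ℓ) {c k √2 : Carrier} {M : ℕ} (1≤k : 1# ≤ k)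
    (isSqrt : IsSqrt (1# + 1#) √2) (isCeiling : IsCeiling ((1# + 1#) * √2 * k) M)
    (fat : Plane.IsFat R c O) (similar : Plane.IsSimilarlySized R k O) where

    open Plane R
    open PlaneGeometry R
    open SweptGraphs R

    module _ {D : ℝ} (D-max : IsMaximumDiameter (allFin n) D) where

      0≤D : 0# ≤ D
      0≤D = proj₁ D-max

      diameter≤D : ∀ v → B.diameter v ≤ D
      diameter≤D v = All.lookup (proj₁ (proj₂ D-max)) (∈-allFin v)

      r : ℝ
      r = stripWidth M D

      √2-positive : ¬ √2 ≤ 0#
      √2-positive p = +-positiveˡ 1≰0 0≤1 (≤-respˡ (proj₂ isSqrt)
        (≤-respˡ (*-congˡ (antisym (proj₁ isSqrt) p)) (≤-reflexive (zeroʳ √2))))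

      M-positive : ¬ fromℕ M ≤ 0#
      M-positive p = *-positive (*-positive (+-positiveˡ 1≰0 0≤1) √2-positive)
        (λ k≤0 → 1≰0 (≤-trans 1≤k k≤0)) (≤-trans (proj₁ isCeiling) p)

      0≤r : 0# ≤ r
      0≤r = *-nonneg (0≤-+ 0≤D 0≤D) (⁻¹-nonneg M-positive)

      Mr≈2D : fromℕ M * r ≈ D + D
      Mr≈2D = begin
        fromℕ M * ((D + D) * fromℕ M ⁻¹) ≈⟨ solve 3 (λ m d i → m :* (d :* i) := (m :* i) :* d) refl (fromℕ M) (D + D) (fromℕ M ⁻¹) ⟩
        (fromℕ M * fromℕ M ⁻¹) * (D + D) ≈⟨ *-congʳ (*-inverseʳ (λ e → M-positive (≤-reflexive e))) ⟩
        1# * (D + D)                     ≈⟨ *-identityˡ _ ⟩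
        D + D                            ∎
        where open SetoidReasoning setoid

      diameter-nonneg′ : ∀ v → 0# ≤ B.diameter v
      diameter-nonneg′ v = diameter-nonneg {O v} (B.diameter-spec v)

      r≤size : ∀ v → r ≤ B.size v
      r≤size v = *-cancelˡ-≤ M-positive (≤-respˡ (sym Mr≈2D)
        (≤-trans (+-mono-≤ D≤k√2s D≤k√2s)
        (≤-respˡ (solve 3 (λ k q s → s :* ((con (1 , 0) :+ con (1 , 0)) :* q :* k)
                    := k :* (q :* s) :+ k :* (q :* s)) refl k √2 s)
        (≤-respʳ (*-comm s (fromℕ M)) (*-monoˡ-≤ 0≤s (proj₁ isCeiling))))))
        where
        s : ℝ
        s = B.size v
        0≤s : 0# ≤ s
        0≤s = proj₁ (proj₁ (B.size-spec v))
        0≤k : 0# ≤ k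
        0≤k = ≤-trans 0≤1 1≤k
        D≤k√2s : D ≤ k * (√2 * s)
        D≤k√2s = ≤-trans
          (proj₂ (proj₂ D-max) (k * B.diameter v) (*-nonneg 0≤k (diameter-nonneg′ v))
            (All.tabulate (λ {u} _ → similar u v _ _ (B.diameter-spec u) (B.diameter-spec v))))
          (*-monoˡ-≤ 0≤k (diameter≤√2size {O v} isSqrt (B.diameter-spec v) (B.size-spec v)))

      leftmost rightmost lowest : ∀ v → ∃[ p ] Contains (O v) p
      leftmost v  = let (y , p∈) = proj₁ (B.xmin-spec v) in (B.xmin v , y) , p∈
      rightmost v = let (y , p∈) = proj₁ (B.xmax-spec v) in (B.xmax v , y) , p∈
      lowest v    = let (x , p∈) = proj₁ (B.ymin-spec v) in (x , B.ymin v) , p∈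

      xmin≤ : ∀ v {p} → Contains (O v) p → B.xmin v ≤ proj₁ p
      xmin≤ v {x , y} p∈ = proj₂ (B.xmin-spec v) x (y , p∈)

      ≤xmax : ∀ v {p} → Contains (O v) p → proj₁ p ≤ B.xmax v
      ≤xmax v {x , y} p∈ = proj₂ (B.xmax-spec v) x (y , p∈)

      ymin≤ : ∀ v {p} → Contains (O v) p → B.ymin v ≤ proj₂ p
      ymin≤ v {x , y} p∈ = proj₂ (B.ymin-spec v) y (x , p∈)

      ≤ymin+D : ∀ v {p} → Contains (O v) p → proj₂ p ≤ B.ymin v + D
      ≤ymin+D v {p} p∈ = ≤-trans
        (nonexpansive≤diameter {proj₂} {O v} {p = p} {q = proj₁ (lowest v)} (λ {p} {q} → y-nonexpansive {p} {q})
          (B.diameter-spec v) p∈ (proj₂ (lowest v)))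
        (+-mono-≤ ≤-refl (diameter≤D v))

      xmin≤xmax : ∀ v → B.xmin v ≤ B.xmax v
      xmin≤xmax v = xmin≤ v (proj₂ (rightmost v))

      xmax≤xmin+Mr : ∀ v → B.xmax v ≤ B.xmin v + fromℕ M * r
      xmax≤xmin+Mr v = ≤-trans
        (nonexpansive≤diameter {proj₁} {O v} {p = proj₁ (rightmost v)} {q = proj₁ (leftmost v)}
          (λ {p} {q} → x-nonexpansive {p} {q}) (B.diameter-spec v) (proj₂ (rightmost v)) (proj₂ (leftmost v)))
        (+-mono-≤ ≤-refl (≤-respʳ (sym Mr≈2D) (≤-trans (diameter≤D v)
          (linear₁ 0≤D (solve 1 (λ d → d :- con (0 , 0) := d :+ d :- d) refl D)))))

      all∈ : ∀ {ys} → ys ↭ allFin n → ∀ v → v ∈ˡ ys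
      all∈ perm v = ∈-resp-↭ (↭-sym perm) (∈-allFin v)

      bags-sweep : ∀ {gs} → SweepOf xmin xmax (allFin n) r M gs → IsSweep R B.xmin B.xmax r gs
      bags-sweep (ys , perm , desc , ≡.refl) =
        SweepCorrectness.sweep-correct R B xmin xmax r M 0≤r xmin≤xmax xmax≤xmin+Mr desc (all∈ perm)

      layers-sweep : ∀ {ls} → SweepOf ymin ymin (allFin n) D 0 ls → IsSweep R B.ymin B.ymin D ls
      layers-sweep (ys , perm , desc , ≡.refl) =
        SweepCorrectness.sweep-correct R B ymin ymin D 0 0≤D (λ _ → ≤-refl)
          (λ v → ≤-reflexive (solve 2 (λ y d → y := y :+ con (0 , 0) :* d) refl (B.ymin v) D)) desc (all∈ perm)

      -- The leftmost point serves unless it lies at or before `t`; then the object reaches the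
      -- vertical line at `t` and has a point on it. Whichever point is found, it is at most D above
      -- the lowest point of the object, which is at most D above `y`.
      in-column : ∀ v {t y} → B.xmin v ≤ t + r → t ≤ B.xmax v → B.ymin v ≤ y + D → y ≤ B.ymin v →
        ∃[ p ] (Contains (O v) p × (t ≤ proj₁ p × proj₁ p ≤ t + r) × (y ≤ proj₂ p × proj₂ p ≤ y + fromℕ M * r))
      in-column v {t} {y} left right low high = locate (B.xmin v ≤? t)
        where
        column : ∀ {p} → Contains (O v) p → y ≤ proj₂ p × proj₂ p ≤ y + fromℕ M * r
        column {p} p∈ = ≤-trans high (ymin≤ v p∈) ,
          ≤-respʳ (+-congˡ (sym Mr≈2D)) (linear₂ (≤ymin+D v p∈) low
            (solve 4 (λ a b y d → (b :+ d :- a) :+ (y :+ d :- b) := y :+ (d :+ d) :- a) refl (proj₂ p) (B.ymin v) y D))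
        locate : Dec (B.xmin v ≤ t) → ∃[ p ] (Contains (O v) p × (t ≤ proj₁ p × proj₁ p ≤ t + r) ×
                   (y ≤ proj₂ p × proj₂ p ≤ y + fromℕ M * r))
        locate (no xmin≰t) = proj₁ (leftmost v) , proj₂ (leftmost v) , (≰⇒≥ xmin≰t , left) , column (proj₂ (leftmost v))
        locate (yes xmin≤t) with meets-vertical-line (O v) (proj₂ (leftmost v)) (proj₂ (rightmost v)) xmin≤t right
        ... | p , p∈ , x≈t = p , p∈ , (≤-reflexive (sym x≈t) , ≤-respˡ (sym x≈t)
          (linear₁ 0≤r (solve 2 (λ t r → r :- con (0 , 0) := t :+ r :- t) refl t r))) , column p∈

      module _ (es : List (ℕ × ℕ)) {gs ls : List (List (Fin n))} (bags : IsSweep R B.xmin B.xmax r gs) (layers : IsSweep R B.ymin B.ymin D ls) where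

        G : Graph n
        G = intersectionGraph O

        out : Output n
        out = output es ([] ∷ gs) ls

        bounded : ∀ t i I → IsIndependentIn G (Output.bag out t ∩ Output.layer out i) I → fromℕ ∣ I ∣ ≤ fromℕ M * c
        bounded t i I (I⊆ , independent) = column M ≡.refl t (λ v∈ → proj₁ (both v∈)) (em {∃[ v ] v ∈ I})
          where
          both : ∀ {v} → v ∈ I → v ∈ Output.bag out t × v ∈ Output.layer out i
          both v∈ = x∈p∩q⁻ (Output.bag out t) (Output.layer out i) (I⊆ v∈)

          disjoint : ∀ {u v} → u ∈ I → v ∈ I → u ≢ v → ¬ Meets (Contains (O u)) (Contains (O v))
          disjoint u∈ v∈ u≢v meets = independent u∈ v∈ (u≢v , meets)

          large : ∀ {v} → v ∈ I → ∃[ s ] (IsSize (O v) s × r ≤ s)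
          large {v} _ = B.size v , B.size-spec v , r≤size v

          column : ∀ m → M ≡ m → ∀ t → (∀ {v} → v ∈ I → v ∈ Output.bag out t) → Dec (∃[ v ] v ∈ I) →
            fromℕ ∣ I ∣ ≤ fromℕ m * c
          column zero ≡.refl _ _ _ = ⊥-elim (M-positive ≤-refl)
          -- The extra bag is empty, so the premises about members of `I` hold vacuously and any
          -- column will do. Fatness is still invoked because it also supplies the sign of `c`.
          column (suc m) M≡ zero in-bag _ =
            fat-column em {a = 0#} {O} fat 0≤r m 0# I disjoint large (λ v∈ → ⊥-elim (∉⊥ (in-bag v∈)))
          column (suc m) M≡ (suc t) in-bag (no none) =
            fat-column em {a = 0#} {O} fat 0≤r m 0# I disjoint large (λ v∈ → ⊥-elim (none (_ , v∈)))
          -- Layers past the end of the list are empty; a member of `I` is needed to see that `i` is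
          -- the position of an actual strip, at which the column is then placed.
          column (suc m) ≡.refl (suc t) in-bag (yes (u , u∈)) with ∈-layer⁻ es ([] ∷ gs) ls i (proj₂ (both u∈))
          ... | j , ≡.refl , _ = fat-column em {a = X.start t} {O} fat 0≤r m (V.start j) I disjoint large meet
            where
            module X = IndexedSweep (index bags)
            module V = IndexedSweep (index layers)
            meet : ∀ {v} → v ∈ I → _
            meet {v} v∈ with ∈-layer⁻ es ([] ∷ gs) ls (toℕ j) (proj₂ (both v∈))
            ... | j′ , e , v∈j′ with Finₚ.toℕ-injective e
            ...   | ≡.refl =
              let (left , right) = X.member t (∈-⋃⁻ (lookup gs t) (in-bag v∈))
                  (low , high)   = V.member j v∈j′
              in in-column v left right low high

        small : ∀ t i → ∃[ a ] (IsIndependenceNumber G (Output.bag out t ∩ Output.layer out i) a ×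
                               fromℕ a ≤ fromℕ M * c)
        small t i with independenceNumber em G (Output.bag out t ∩ Output.layer out i)
        ... | a , number@((I , independent , ≡.refl) , _) = a , number , bounded t i I independent

        adjacent-x : ∀ {u v} → Adj G u v → B.xmin u ≤ B.xmax v
        adjacent-x {u} {v} (_ , p , p∈u , p∈v) = ≤-trans (xmin≤ u p∈u) (≤xmax v p∈v)

        adjacent-y : ∀ {u v} → Adj G u v → B.ymin u ≤ B.ymin v + D
        adjacent-y {u} {v} (_ , p , p∈u , p∈v) = ≤-trans (ymin≤ u p∈u) (≤ymin+D v p∈v)

        correct-output : IsPathEdges (length gs) es →
          IsTreeDecomposition G (Output.tree out) (Output.bag out) × IsLayering G (Output.layer out) ×
          (∀ t i → ∃[ a ] (IsIndependenceNumber G (Output.bag out t ∩ Output.layer out i) a × fromℕ a ≤ fromℕ M * c))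
        correct-output path =
          sweep⇒treeDecomposition G 0≤r es gs ls bags path xmin≤xmax adjacent-x ,
          sweep⇒layering G 0≤D es ([] ∷ gs) ls layers adjacent-y , small

    correct-result : ∀ es bs ls → ProgramResult M (es , bs , ls) →
      let D = output es bs ls ; G = intersectionGraph O in
      IsTreeDecomposition G (Output.tree D) (Output.bag D) × IsLayering G (Output.layer D) ×
      (∀ t i → ∃[ a ] (IsIndependenceNumber G (Output.bag D t ∩ Output.layer D i) a × fromℕ a ≤ fromℕ M * c))
    correct-result es _ ls (D , gs , D-max , ≡.refl , path , bags , layers) =
      correct-output D-max es (bags-sweep D-max bags) (layers-sweep D-max layers) path

  node-count : ∀ {M} es bs ls → ProgramResult M (es , bs , ls) → length bs ℕ.≤ suc n
  node-count es _ ls (D , gs , _ , ≡.refl , _ , bags , _) =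
    ℕ.s≤s (ℕₚ.≤-trans (sweep-count bags) (ℕₚ.≤-reflexive (length-tabulate id)))

bounded-number : (R : RealNumbers) → let open RealNumbers R in ExcludedMiddle (lsuc 0ℓ) → ExcludedMiddle 0ℓ →
  ∀ {n m b} (G : Graph n) {T : Graph m} {X V} → IsTreeDecomposition G T X → IsLayering G V →
  (∀ t i → ∃[ a ] (IsIndependenceNumber G (X t ∩ V i) a × fromℕ a ≤ b)) →
  ∃[ w ] (IsLayeredTreeIndependenceNumber G w × fromℕ w ≤ b)
bounded-number R em em₀ G {X = X} {V} decomposition layering small
  with layeredWidth em₀ G X V (IsTree.nonempty (IsTreeDecomposition.tree decomposition))
... | w , width@((t , i , w-number) , _)
  with least em _ w (_ , _ , _ , _ , decomposition , layering , width) | small t i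
... | w₀ , w₀-least , w₀≤w | a , a-number , a≤b =
  w₀ , w₀-least , ≤-trans (fromℕ-mono-≤ (ℕₚ.≤-trans w₀≤w (proj₂ a-number w (proj₁ w-number)))) a≤b
  where open RealArithmetic R

theorem4p10 :
    ExcludedMiddle (lsuc 0ℓ) →
    (R : RealNumbers) →
    let open RealNumbers R
        open Plane R
        open Output
    in
    (c k √2 : ℝ) (M : ℕ) →
    1# ≤ k →
    IsSqrt (1# + 1#) √2 →
    IsCeiling ((1# + 1#) * √2 * k) M →
    (Σ Program λ P →
      (∀ n (O : Family n) (B : BasicOperations O) →
        IsFat c O → IsSimilarlySized k O →
        let G = intersectionGraph O
            D = Run.result R P B
        in
        IsTreeDecomposition G (tree D) (bag D) ×
        IsLayering G (layer D) ×
        (∀ t i → ∃[ a ] (IsIndependenceNumber G (bag D t ∩ layer D i) a ×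
                         fromℕ a ≤ fromℕ M * c)))
      ×
      (∃[ A ] ∃[ N ] ∀ n (O : Family n) (B : BasicOperations O) →
        IsFat c O → IsSimilarlySized k O → N ≤ℕ n →
        Run.time R P B ≤ℕ A *ℕ (n *ℕ ⌊log₂ n ⌋))
      ×
      (∃[ A ] ∃[ N ] ∀ n (O : Family n) (B : BasicOperations O) →
        IsFat c O → IsSimilarlySized k O → N ≤ℕ n →
        nodeCount (Run.result R P B) ≤ℕ A *ℕ n))
    ×
    (∀ n (O : Family n) → IsFat c O → IsSimilarlySized k O →
      ∃[ w ] (IsLayeredTreeIndependenceNumber (intersectionGraph O) w ×
              fromℕ w ≤ fromℕ M * c))
theorem4p10 em R c k √2 M 1≤k isSqrt isCeiling =
  ( program M
  , correct
  , (783 ℕ.+ M ℕ.* 30 , 2 , λ n O B _ _ 2≤n →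
      ℕₚ.≤-trans (ProgramCorrectness.program-time R B M) (runtime-bound M n 2≤n))
  -- There are at most n + 1 nodes, one of them for the extra bag, which is at most 2n once n is
  -- positive.
  , (2 , 1 , λ n O B _ _ 1≤n → ℕₚ.≤-trans (nodes n O B)
      (ℕₚ.≤-trans (ℕₚ.+-monoˡ-≤ n 1≤n) (ℕₚ.≤-reflexive (≡.cong (n ℕ.+_) (≡.sym (ℕₚ.+-identityʳ n)))))) )
  , number
  where
  open RealNumbers R using (_≤_; fromℕ; _*_)
  open Plane R
  open Output

  em₀ : ExcludedMiddle 0ℓ
  em₀ = lowerExcludedMiddle em

  correct : ∀ n (O : Family n) (B : BasicOperations O) → IsFat c O → IsSimilarlySized k O →
    let G = intersectionGraph O
        D = Run.result R (program M) B
    in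
    IsTreeDecomposition G (tree D) (bag D) × IsLayering G (layer D) ×
    (∀ t i → ∃[ a ] (IsIndependenceNumber G (bag D t ∩ layer D i) a × fromℕ a ≤ fromℕ M * c))
  correct n O B fat similar =
    ProgramCorrectness.correct-result R B em₀ 1≤k isSqrt isCeiling fat similar
      (treeEdges D) (bagList D) (layerList D) (result (ProgramCorrectness.program-spec R B M))
    where
    D : Output n
    D = Run.result R (program M) B

  nodes : ∀ n (O : Family n) (B : BasicOperations O) → nodeCount (Run.result R (program M) B) ≤ℕ suc n
  nodes n O B = ProgramCorrectness.node-count R B {M}
    (treeEdges D) (bagList D) (layerList D) (result (ProgramCorrectness.program-spec R B M))
    where
    D : Output n
    D = Run.result R (program M) B

  number : ∀ n (O : Family n) → IsFat c O → IsSimilarlySized k O →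
    ∃[ w ] (IsLayeredTreeIndependenceNumber (intersectionGraph O) w × fromℕ w ≤ fromℕ M * c)
  number n O fat similar =
    let (decomposition , layering , small) = correct n O (PlaneGeometry.basicOperations R em₀ O) fat similar
    in bounded-number R em em₀ (intersectionGraph O) decomposition layering small
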